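{- Let $k\ge 1$, let $M_1,\dots,M_k$ be matroids on a common finite ground set $U$, and let $\mathbf{x}\in\bigcap_{i=1}^k P(M_i)$, where $P(M_i)$ is the independence polytope of $M_i$. Let $a_e\in[0,1]$ for each $e\in U$, and let $S$ be the (random) output of the $k$-matroid AW contention resolution scheme on $M_1,\dots,M_k$ and $\mathbf{x}$. Let $Q=\sum_{e\in U}a_e x_e$ and $a(S):=\sum_{e\in S}a_e$. Then for all $\delta\in(0,1/5)$, $$\Pr\left[a(S)\le\left(\frac15-\delta\right)\frac{Q}{k+1}\right]\le 4\exp\left(-\frac{\delta^2 Q}{3(k+1)^3}\right).$$
   Context: For a matroid $M=(U,\mathcal I)$, $P(M)\subseteq[0,1]^U$ is the convex hull of the indicator vectors of independent sets. Let $n=|U|$. Exchange mapping: for independent sets $I,J\in\mathcal I$, an exchange mapping is a function $\phi:I\to J\cup\{\perp\}$ such that (1) $\phi(e)=e$ if $e\in I\cap J$; (2) if $\phi(e)=\perp$ then $J+e\in\mathcal I$; (3) if $\phi(e)=f\ne\perp$ then $J+e-f\in\mathcal I$; (4) for every $f\in J$ there is at most one $e\in I$ with $\phi(e)=f$. Such mappings always exist. Single-matroid AW scheme (random-order contention resolution scheme of Adamczyk and W\l{}odarczyk). Input: a matroid $M=(U,\mathcal I)$, a point $\mathbf{x}\in P(M)$, and a random set $R\subseteq U$ containing each $e$ independently with probability $x_e$. Initialization: $S=\emptyset$; write $\mathbf{x}=\sum_{i=1}^{m}\beta_i\mathbf 1_{I_i}$ as a convex combination ($\beta_i\ge0$,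 $\sum_i\beta_i=1$, $m\le n+1$) of indicator vectors of independent sets $I_1,\dots,I_m$; the sets $I_i$ will be updated over time, the weights $\beta_i$ never change. Each element $e$ with $x_e>0$ independently selects a controller index $i$ among those with $e\in I_i$, $\beta_i\neq 0$ (for the initial sets), index $i$ being selected with probability $\beta_i/x_e$. For each ordered pair $(i,j)$ the scheme maintains an exchange mapping $\phi_{ij}$ from the current $I_i$ to the current $I_j$. Iteration: choose a uniformly random ordering $\sigma:[n]\to U$ and process elements in this order. When $e=\sigma(t)$ is processed, $e$ is added to $S$ if and only if $e\in R$ and $e$ still belongs to the current set $I_i$, where $i$ is the controller of $e$. If $e$ is added to $S$, every $I_j$ with $\beta_j\ne0$ is updated by deleting $\phi_{ij}(e)$ (if $\phi_{ij}(e)\ne\perp$) and adding $e$. The output is the final $S$. $k$-matroid AW scheme: given $M_1,\dots,M_k$ and $\mathbf{x}\in\bigcap_i P(M_i)$, run the single-matroid AW scheme for each $M_j$ (with its own decomposition, controllers and exchange mappings) using the same random order $\sigma$ and the same random set $R$, obtaining $S_1,\dots,S_k$; output $S=\bigcap_{j=1}^k S_j$. -}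

module Defs where

open import Algebra.Bundles using (CommutativeRing; Semiring)
open import Data.Bool.Base using (Bool; true; false; if_then_else_)
open import Data.Fin.Base as Fin using (Fin)
import Data.Fin.Properties as Fin
open import Data.Fin.Subset
  using (Subset; _∈_; _∉_; _⊆_; _∪_; _-_; ⁅_⁆; ∣_∣; ⋂; ⊥)
open import Data.Fin.Subset.Properties using (_∈?_)
open import Data.List.Base as List using (List; []; _∷_; [_])
open import Data.Maybe.Base using (Maybe; just; nothing)
open import Data.Nat.Base as ℕ using (ℕ; zero; suc; _!)
import Data.Nat.Properties as ℕ
open import Data.Product.Base using (∃; ∃-syntax; _×_; _,_; proj₁; proj₂)
open import Data.Sum.Base using (_⊎_; inj₁; inj₂)
open import Data.Vec.Base as Vec using (Vec; []; _∷_)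
import Data.Vec.Relation.Unary.AllPairs as AllPairs
open import Data.Vec.Relation.Unary.Unique.Propositional using (Unique)
open import Data.Empty using (⊥-elim)
open import Function.Base using (_∘_; _$_)
open import Level using (_⊔_) renaming (suc to lsuc)
open import Relation.Binary.Bundles using (Poset)
open import Relation.Binary.Core using (Rel)
open import Relation.Binary.Structures using (IsDecTotalOrder)
open import Relation.Binary.PropositionalEquality.Core as ≡ using (_≡_)
open import Relation.Nullary using (¬_; Dec; does; yes; no)
open import Relation.Nullary.Decidable using (¬?; _×-dec_)
open import Relation.Unary using (Pred; Decidable)
import Algebra.Definitions.RawSemiring as RawSemiringDefs
import Algebra.Properties.Semiring.Mult as SemiringMult
import Algebra.Properties.Ring as RingProps
import Relation.Binary.Reasoning.PartialOrder as PartialOrderReasoning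

-- Cauchy-complete Archimedean ordered fields. Classically these are
-- exactly the fields isomorphic to ℝ; the order is decidable because
-- the mathematics is classical.

record Reals c ℓ₁ ℓ₂ : Set (lsuc (c ⊔ ℓ₁ ⊔ ℓ₂)) where
  field
    commutativeRing : CommutativeRing c ℓ₁

  open CommutativeRing commutativeRing public
    hiding (_-_)
    renaming (Carrier to ℝ)

  infix 4 _≤_
  infix 8 _⁻¹

  field
    _≤_             : Rel ℝ ℓ₂
    isDecTotalOrder : IsDecTotalOrder _≈_ _≤_
    0≉1             : ¬ (0# ≈ 1#)
    -- The value of 0# ⁻¹ is unspecified.
    _⁻¹             : ℝ → ℝ
    ⁻¹-cong         : ∀ {x y} → x ≈ y → x ⁻¹ ≈ y ⁻¹
    ⁻¹-inverse      : ∀ {x} → ¬ (x ≈ 0#) → x * x ⁻¹ ≈ 1#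
    +-monoʳ-≤       : ∀ x {y z} → y ≤ z → x + y ≤ x + z
    *-nonNegative   : ∀ {x y} → 0# ≤ x → 0# ≤ y → 0# ≤ x * y

  open IsDecTotalOrder isDecTotalOrder public
    using (_≤?_; _≟_; total; antisym; isPartialOrder; ≤-respˡ-≈; ≤-respʳ-≈)
    renaming (refl to ≤-refl; reflexive to ≤-reflexive; trans to ≤-trans)

  open RawSemiringDefs (Semiring.rawSemiring semiring) public
    using (_^_; sum)
    renaming (_×_ to _·_)

  infix 4 _<_
  infixl 6 _−_
  infixl 7 _÷_

  _<_ : Rel ℝ (ℓ₁ ⊔ ℓ₂)
  x < y = x ≤ y × ¬ (x ≈ y)

  _<?_ : ∀ x y → Dec (x < y)
  x <? y = (x ≤? y) ×-dec ¬? (x ≟ y)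

  _−_ : ℝ → ℝ → ℝ
  x − y = x + - y

  _÷_ : ℝ → ℝ → ℝ
  x ÷ y = x * y ⁻¹

  fromℕ : ℕ → ℝ
  fromℕ n = n · 1#

  ∣_-_∣≤_ : ℝ → ℝ → ℝ → Set ℓ₂
  ∣ x - y ∣≤ ε = x ≤ y + ε × y ≤ x + ε

  Cauchy : (ℕ → ℝ) → Set _
  Cauchy s = ∀ ε → 0# < ε →
    ∃[ N ] ∀ m n → N ℕ.≤ m → N ℕ.≤ n → ∣ s m - s n ∣≤ ε

  _ConvergesTo_ : (ℕ → ℝ) → ℝ → Set _
  s ConvergesTo L = ∀ ε → 0# < ε → ∃[ N ] ∀ n → N ℕ.≤ n → ∣ s n - L ∣≤ ε

  field
    archimedean : ∀ x ε → 0# < ε → ∃[ n ] x ≤ fromℕ n * ε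
    complete    : ∀ s → Cauchy s → ∃[ L ] s ConvergesTo L

module OrderProperties {c ℓ₁ ℓ₂} {{R : Reals c ℓ₁ ℓ₂}} where
  open Reals R

  private
    module P = RingProps ring

  poset : Poset c ℓ₁ ℓ₂
  poset = record { isPartialOrder = isPartialOrder }
  open PartialOrderReasoning poset

  +-mono-≤ : ∀ {x y u v} → x ≤ y → u ≤ v → x + u ≤ y + v
  +-mono-≤ {x} {y} {u} {v} p q = begin
    x + u  ≤⟨ +-monoʳ-≤ x q ⟩
    x + v  ≈⟨ +-comm x v ⟩
    v + x  ≤⟨ +-monoʳ-≤ v p ⟩
    v + y  ≈⟨ +-comm v y ⟩
    y + v  ∎

  x≤y⇒0≤y−x : ∀ {x y} → x ≤ y → 0# ≤ y − x
  x≤y⇒0≤y−x {x} {y} p = begin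
    0#     ≈⟨ -‿inverseʳ x ⟨
    x − x  ≤⟨ +-mono-≤ p ≤-refl ⟩
    y − x  ∎

  −+-cancel : ∀ x y → (y − x) + x ≈ y
  −+-cancel x y = begin-equality
    (y − x) + x    ≈⟨ +-assoc y (- x) x ⟩
    y + (- x + x)  ≈⟨ +-congˡ (-‿inverseˡ x) ⟩
    y + 0#         ≈⟨ +-identityʳ y ⟩
    y              ∎

  0≤y−x⇒x≤y : ∀ {x y} → 0# ≤ y − x → x ≤ y
  0≤y−x⇒x≤y {x} {y} p = begin
    x            ≈⟨ +-identityˡ x ⟨
    0# + x       ≤⟨ +-mono-≤ p ≤-refl ⟩
    (y − x) + x  ≈⟨ −+-cancel x y ⟩
    y            ∎

  *-monoˡ-≤ : ∀ {z x y} → 0# ≤ z → x ≤ y → z * x ≤ z * y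
  *-monoˡ-≤ {z} {x} {y} 0≤z x≤y = 0≤y−x⇒x≤y $ begin
    0#               ≤⟨ *-nonNegative 0≤z (x≤y⇒0≤y−x x≤y) ⟩
    z * (y − x)      ≈⟨ distribˡ z y (- x) ⟩
    z * y + z * - x  ≈⟨ +-congˡ (P.-‿distribʳ-* z x) ⟨
    z * y − z * x    ∎

  *-monoʳ-≤ : ∀ {z x y} → 0# ≤ z → x ≤ y → x * z ≤ y * z
  *-monoʳ-≤ {z} {x} {y} 0≤z x≤y = begin
    x * z  ≈⟨ *-comm x z ⟩
    z * x  ≤⟨ *-monoˡ-≤ 0≤z x≤y ⟩
    z * y  ≈⟨ *-comm z y ⟩
    y * z  ∎

  x≤0⇒0≤-x : ∀ {x} → x ≤ 0# → 0# ≤ - x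
  x≤0⇒0≤-x {x} p = begin
    0#      ≤⟨ x≤y⇒0≤y−x p ⟩
    0# − x  ≈⟨ +-identityˡ (- x) ⟩
    - x     ∎

  -1*-1≈1 : - 1# * - 1# ≈ 1#
  -1*-1≈1 = begin-equality
    - 1# * - 1#    ≈⟨ P.-‿distribˡ-* 1# (- 1#) ⟨
    - (1# * - 1#)  ≈⟨ -‿cong (*-identityˡ (- 1#)) ⟩
    - - 1#         ≈⟨ P.-‿involutive 1# ⟩
    1#             ∎

  0≤1 : 0# ≤ 1#
  0≤1 with total 0# 1#
  ... | inj₁ p = p
  ... | inj₂ p =
    ≤-respʳ-≈ -1*-1≈1 (*-nonNegative (x≤0⇒0≤-x p) (x≤0⇒0≤-x p))

  1≰0 : ¬ (1# ≤ 0#)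
  1≰0 p = 0≉1 (antisym 0≤1 p)

  0≤fromℕ : ∀ n → 0# ≤ fromℕ n
  0≤fromℕ zero    = ≤-refl
  0≤fromℕ (suc n) = begin
    0#            ≈⟨ +-identityˡ 0# ⟨
    0# + 0#       ≤⟨ +-mono-≤ 0≤1 (0≤fromℕ n) ⟩
    1# + fromℕ n  ∎

  fromℕ≉0 : ∀ n → .{{ℕ.NonZero n}} → ¬ (fromℕ n ≈ 0#)
  fromℕ≉0 (suc n) eq = 1≰0 $ begin
    1#            ≈⟨ +-identityʳ 1# ⟨
    1# + 0#       ≤⟨ +-monoʳ-≤ 1# (0≤fromℕ n) ⟩
    1# + fromℕ n  ≈⟨ eq ⟩
    0#            ∎

  0≤⁻¹ : ∀ {x} → 0# ≤ x → ¬ (x ≈ 0#) → 0# ≤ x ⁻¹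
  0≤⁻¹ {x} 0≤x x≉0 with total 0# (x ⁻¹)
  ... | inj₁ p = p
  ... | inj₂ p = ⊥-elim $ 1≰0 $ begin
    1#        ≈⟨ ⁻¹-inverse x≉0 ⟨
    x * x ⁻¹  ≤⟨ *-monoˡ-≤ 0≤x p ⟩
    x * 0#    ≈⟨ zeroʳ x ⟩
    0#        ∎

  *-cancelʳ-≤ : ∀ {x y z} → 0# ≤ z → ¬ (z ≈ 0#) → x * z ≤ y * z → x ≤ y
  *-cancelʳ-≤ {x} {y} {z} 0≤z z≉0 p = begin
    x               ≈⟨ cancel x ⟨
    (x * z) * z ⁻¹  ≤⟨ *-monoʳ-≤ (0≤⁻¹ 0≤z z≉0) p ⟩
    (y * z) * z ⁻¹  ≈⟨ cancel y ⟩
    y               ∎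
    where
    cancel : ∀ w → (w * z) * z ⁻¹ ≈ w
    cancel w = begin-equality
      (w * z) * z ⁻¹  ≈⟨ *-assoc w z (z ⁻¹) ⟩
      w * (z * z ⁻¹)  ≈⟨ *-congˡ (⁻¹-inverse z≉0) ⟩
      w * 1#          ≈⟨ *-identityʳ w ⟩
      w               ∎

module Exponential {c ℓ₁ ℓ₂} {{R : Reals c ℓ₁ ℓ₂}} where
  open Reals R
  open OrderProperties {{R}}
  open PartialOrderReasoning poset

  private
    module M = SemiringMult semiring
    module P = RingProps ring

  expTerm : ℝ → ℕ → ℝ
  expTerm x n = x ^ n ÷ fromℕ (n !)

  partialSum : (ℕ → ℝ) → ℕ → ℝ
  partialSum t zero    = 0#
  partialSum t (suc n) = partialSum t n + t n

  0≤n!⁻¹ : ∀ n → 0# ≤ fromℕ (n !) ⁻¹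
  0≤n!⁻¹ n = 0≤⁻¹ (0≤fromℕ (n !)) (fromℕ≉0 (n !) {{ℕ._!≢0 n}})

  expTerm-suc : ∀ x n → expTerm x (suc n) * fromℕ (suc n) ≈ expTerm x n * x
  expTerm-suc x n = begin-equality
    (x * p * c′) * b     ≈⟨ *-assoc (x * p) c′ b ⟩
    (x * p) * (c′ * b)   ≈⟨ *-congˡ c′b≈a′ ⟩
    (x * p) * a′         ≈⟨ *-assoc x p a′ ⟩
    x * (p * a′)         ≈⟨ *-comm x (p * a′) ⟩
    (p * a′) * x         ∎
    where
    p = x ^ n
    a = fromℕ (n !)
    b = fromℕ (suc n)
    cc = fromℕ (suc n !)
    a′ = a ⁻¹
    c′ = cc ⁻¹
    b*a≈c : b * a ≈ cc
    b*a≈c = sym (M.×1-homo-* (suc n) (n !))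
    c′b≈a′ : c′ * b ≈ a′
    c′b≈a′ = begin-equality
      c′ * b               ≈⟨ *-identityʳ (c′ * b) ⟨
      (c′ * b) * 1#        ≈⟨ *-congˡ (⁻¹-inverse (fromℕ≉0 (n !) {{ℕ._!≢0 n}})) ⟨
      (c′ * b) * (a * a′)  ≈⟨ *-assoc (c′ * b) a a′ ⟨
      ((c′ * b) * a) * a′  ≈⟨ *-congʳ (*-assoc c′ b a) ⟩
      (c′ * (b * a)) * a′  ≈⟨ *-congʳ (*-congˡ b*a≈c) ⟩
      (c′ * cc) * a′       ≈⟨ *-congʳ (*-comm c′ cc) ⟩
      (cc * c′) * a′       ≈⟨ *-congʳ (⁻¹-inverse (fromℕ≉0 (suc n !) {{ℕ._!≢0 (suc n)}})) ⟩
      1# * a′              ≈⟨ *-identityˡ a′ ⟩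
      a′                   ∎

  Bounded : ℝ → ℝ → Set ℓ₂
  Bounded p q = p ≤ q × - p ≤ q

  IsAbs : ℝ → ℝ → Set _
  IsAbs x y = 0# ≤ y × (x ≈ y ⊎ x ≈ - y)

  abs : ∀ x → ∃ (IsAbs x)
  abs x with total 0# x
  ... | inj₁ p = x , p , inj₁ refl
  ... | inj₂ p = - x , x≤0⇒0≤-x p , inj₂ (sym (P.-‿involutive x))

  bounded-*ˡ : ∀ {x y p q} → IsAbs x y → Bounded p q → Bounded (x * p) (y * q)
  bounded-*ˡ {x} {y} {p} {q} (0≤y , inj₁ x≈y) (p≤q , -p≤q) =
    (begin
      x * p  ≈⟨ *-congʳ x≈y ⟩
      y * p  ≤⟨ *-monoˡ-≤ 0≤y p≤q ⟩
      y * q  ∎) ,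
    (begin
      - (x * p)  ≈⟨ -‿cong (*-congʳ x≈y) ⟩
      - (y * p)  ≈⟨ P.-‿distribʳ-* y p ⟩
      y * - p    ≤⟨ *-monoˡ-≤ 0≤y -p≤q ⟩
      y * q      ∎)
  bounded-*ˡ {x} {y} {p} {q} (0≤y , inj₂ x≈-y) (p≤q , -p≤q) =
    (begin
      x * p      ≈⟨ *-congʳ x≈-y ⟩
      - y * p    ≈⟨ P.-‿distribˡ-* y p ⟨
      - (y * p)  ≈⟨ P.-‿distribʳ-* y p ⟩
      y * - p    ≤⟨ *-monoˡ-≤ 0≤y -p≤q ⟩
      y * q      ∎) ,
    (begin
      - (x * p)      ≈⟨ -‿cong (*-congʳ x≈-y) ⟩
      - (- y * p)    ≈⟨ -‿cong (P.-‿distribˡ-* y p) ⟨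
      - - (y * p)    ≈⟨ P.-‿involutive (y * p) ⟩
      y * p          ≤⟨ *-monoˡ-≤ 0≤y p≤q ⟩
      y * q          ∎)

  bounded-*ʳ : ∀ {p q z} → 0# ≤ z → Bounded p q → Bounded (p * z) (q * z)
  bounded-*ʳ {p} {q} {z} 0≤z (p≤q , -p≤q) =
    *-monoʳ-≤ 0≤z p≤q ,
    ≤-respˡ-≈ (sym (P.-‿distribˡ-* p z)) (*-monoʳ-≤ 0≤z -p≤q)

  bounded-^ : ∀ {x y} → IsAbs x y → ∀ n → Bounded (x ^ n) (y ^ n)
  bounded-^ h zero    = ≤-refl , (begin
    - 1#      ≈⟨ +-identityˡ (- 1#) ⟨
    0# − 1#   ≤⟨ +-mono-≤ 0≤1 ≤-refl ⟩
    1# − 1#   ≈⟨ -‿inverseʳ 1# ⟩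
    0#        ≤⟨ 0≤1 ⟩
    1#        ∎)
  bounded-^ h (suc n) = bounded-*ˡ h (bounded-^ h n)

  bounded-expTerm : ∀ {x y} → IsAbs x y → ∀ n → Bounded (expTerm x n) (expTerm y n)
  bounded-expTerm h n = bounded-*ʳ (0≤n!⁻¹ n) (bounded-^ h n)

  0≤^ : ∀ {y} → 0# ≤ y → ∀ n → 0# ≤ y ^ n
  0≤^ p zero    = 0≤1
  0≤^ p (suc n) = *-nonNegative p (0≤^ p n)

  0≤expTerm : ∀ {y} → 0# ≤ y → ∀ n → 0# ≤ expTerm y n
  0≤expTerm p n = *-nonNegative (0≤^ p n) (0≤n!⁻¹ n)

  fromℕ-mono : ∀ i j → fromℕ i ≤ fromℕ (j ℕ.+ i)
  fromℕ-mono i j = begin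
    fromℕ i            ≈⟨ +-identityˡ (fromℕ i) ⟨
    0# + fromℕ i       ≤⟨ +-mono-≤ (0≤fromℕ j) ≤-refl ⟩
    fromℕ j + fromℕ i  ≈⟨ M.×-homo-+ 1# j i ⟨
    fromℕ (j ℕ.+ i)    ∎

  -- Beyond index 2y the terms at least halve.
  expTerm-halves : ∀ {y} n → 0# ≤ y → y + y ≤ fromℕ (suc n) →
    expTerm y (suc n) + expTerm y (suc n) ≤ expTerm y n
  expTerm-halves {y} n 0≤y 2y≤n = *-cancelʳ-≤ (0≤fromℕ (suc n)) (fromℕ≉0 (suc n)) $ begin
    (v + v) * b    ≈⟨ distribʳ b v v ⟩
    v * b + v * b  ≈⟨ +-cong (expTerm-suc y n) (expTerm-suc y n) ⟩
    u * y + u * y  ≈⟨ distribˡ u y y ⟨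
    u * (y + y)    ≤⟨ *-monoˡ-≤ (0≤expTerm 0≤y n) 2y≤n ⟩
    u * b          ∎
    where
    u = expTerm y n
    v = expTerm y (suc n)
    b = fromℕ (suc n)

  x≤x+y : ∀ {x y} → 0# ≤ y → x ≤ x + y
  x≤x+y {x} {y} p = ≤-respˡ-≈ (+-identityʳ x) (+-monoʳ-≤ x p)

  -- If |tₙ| ≤ uₙ and 2uₙ₊₁ ≤ uₙ from N on, then partialSum t n + 2uₙ is
  -- nonincreasing from N on. Applied to t and - t, this bounds tails.
  module Tail (t u : ℕ → ℝ) (0≤u : ∀ n → 0# ≤ u n)
              (dom : ∀ n → Bounded (t n) (u n)) (N : ℕ)
              (halves : ∀ j → u (suc j ℕ.+ N) + u (suc j ℕ.+ N) ≤ u (j ℕ.+ N)) where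

    S : ℕ → ℝ
    S = partialSum t

    tail-upper : ∀ {M} p → N ℕ.≤ M →
      S (p ℕ.+ M) + (u (p ℕ.+ M) + u (p ℕ.+ M)) ≤ S M + (u M + u M)
    tail-upper zero    N≤M = ≤-refl
    tail-upper {M} (suc p) N≤M = begin
      (S m + t m) + (u (suc m) + u (suc m))  ≤⟨ +-monoʳ-≤ _ (halves′ m N≤m) ⟩
      (S m + t m) + u m                      ≤⟨ +-mono-≤ (+-monoʳ-≤ (S m) (proj₁ (dom m))) ≤-refl ⟩
      (S m + u m) + u m                      ≈⟨ +-assoc (S m) (u m) (u m) ⟩
      S m + (u m + u m)                      ≤⟨ tail-upper p N≤M ⟩
      S M + (u M + u M)                      ∎
      where
      m = p ℕ.+ M
      N≤m : N ℕ.≤ m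
      N≤m = ℕ.≤-trans N≤M (ℕ.m≤n+m M p)
      halves′ : ∀ m → N ℕ.≤ m → u (suc m) + u (suc m) ≤ u m
      halves′ m N≤m =
        ≡.subst (λ k → u (suc k) + u (suc k) ≤ u k) (ℕ.m∸n+n≡m N≤m) (halves (m ℕ.∸ N))

  neg-dom : ∀ {t u : ℕ → ℝ} → (∀ n → Bounded (t n) (u n)) → ∀ n → Bounded (- t n) (u n)
  neg-dom dom n = proj₂ (dom n) , ≤-respˡ-≈ (sym (P.-‿involutive _)) (proj₁ (dom n))

  partialSum-neg : ∀ t n → partialSum (λ i → - t i) n ≈ - partialSum t n
  partialSum-neg t zero    = sym P.-0#≈0#
  partialSum-neg t (suc n) = begin-equality
    partialSum (λ i → - t i) n − t n  ≈⟨ +-congʳ (partialSum-neg t n) ⟩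
    - partialSum t n − t n            ≈⟨ P.-‿+-comm (partialSum t n) (t n) ⟩
    - (partialSum t n + t n)          ∎

  -‿swap : ∀ {a b d} → - a ≤ - b + d → b ≤ a + d
  -‿swap {a} {b} {d} p = begin
    b                      ≈⟨ +-identityʳ b ⟨
    b + 0#                 ≈⟨ +-congˡ (-‿inverseˡ a) ⟨
    b + (- a + a)          ≤⟨ +-monoʳ-≤ b (+-mono-≤ p ≤-refl) ⟩
    b + ((- b + d) + a)    ≈⟨ +-assoc b (- b + d) a ⟨
    (b + (- b + d)) + a    ≈⟨ +-congʳ (+-assoc b (- b) d) ⟨
    ((b − b) + d) + a      ≈⟨ +-congʳ (+-congʳ (-‿inverseʳ b)) ⟩
    (0# + d) + a           ≈⟨ +-congʳ (+-identityˡ d) ⟩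
    d + a                  ≈⟨ +-comm d a ⟩
    a + d                  ∎

  module Proof (x ε : ℝ) (0<ε : 0# < ε) where
    y = proj₁ (abs x)
    isAbs = proj₂ (abs x)
    0≤y = proj₁ isAbs
    t = expTerm x
    u = expTerm y

    0<1 : 0# < 1#
    0<1 = 0≤1 , 0≉1

    N = proj₁ (archimedean (y + y) 1# 0<1)

    2y≤N : y + y ≤ fromℕ N
    2y≤N = ≤-respʳ-≈ (*-identityʳ (fromℕ N)) (proj₂ (archimedean (y + y) 1# 0<1))

    halves : ∀ j → u (suc j ℕ.+ N) + u (suc j ℕ.+ N) ≤ u (j ℕ.+ N)
    halves j = expTerm-halves (j ℕ.+ N) 0≤y (≤-trans 2y≤N (fromℕ-mono N (suc j)))

    d : ℕ → ℝ
    d n = u n + u n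

    e : ℕ → ℝ
    e n = d n + d n

    decay : ∀ j → fromℕ (suc j) * u (j ℕ.+ N) ≤ u N
    decay zero    = ≤-reflexive (trans (*-congʳ (+-identityʳ 1#)) (*-identityˡ (u N)))
    decay (suc j) = begin
      (1# + b) * v     ≤⟨ *-monoʳ-≤ (0≤expTerm 0≤y (suc j ℕ.+ N)) (+-mono-≤ (x≤x+y (0≤fromℕ j)) ≤-refl) ⟩
      (b + b) * v      ≈⟨ distribʳ v b b ⟩
      b * v + b * v    ≈⟨ distribˡ b v v ⟨
      b * (v + v)      ≤⟨ *-monoˡ-≤ (0≤fromℕ (suc j)) (halves j) ⟩
      b * u (j ℕ.+ N)  ≤⟨ decay j ⟩
      u N              ∎
      where
      b = fromℕ (suc j)
      v = u (suc j ℕ.+ N)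

    p = proj₁ (archimedean (e N) ε 0<ε)
    K = p ℕ.+ N

    b*e≈ : ∀ b w → b * ((w + w) + (w + w)) ≈ (b * w + b * w) + (b * w + b * w)
    b*e≈ b w = trans (distribˡ b (w + w) (w + w)) (+-cong (distribˡ b w w) (distribˡ b w w))

    small : e K ≤ ε
    small = *-cancelʳ-≤ (0≤fromℕ (suc p)) (fromℕ≉0 (suc p)) $ begin
      e K * b              ≈⟨ *-comm (e K) b ⟩
      b * e K              ≈⟨ b*e≈ b (u K) ⟩
      (b * u K + b * u K) + (b * u K + b * u K)
        ≤⟨ +-mono-≤ (+-mono-≤ (decay p) (decay p)) (+-mono-≤ (decay p) (decay p)) ⟩
      e N                  ≤⟨ proj₂ (archimedean (e N) ε 0<ε) ⟩
      fromℕ p * ε          ≤⟨ *-monoʳ-≤ (proj₁ 0<ε) (fromℕ-mono p 1) ⟩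
      b * ε                ≈⟨ *-comm b ε ⟩
      ε * b                ∎
      where b = fromℕ (suc p)

    0≤u : ∀ n → 0# ≤ u n
    0≤u = 0≤expTerm 0≤y

    0≤d : ∀ n → 0# ≤ d n
    0≤d n = ≤-trans (0≤u n) (x≤x+y (0≤u n))

    S : ℕ → ℝ
    S = partialSum t

    from : ∀ {A : ℕ → Set ℓ₂} → (∀ j → A (j ℕ.+ K)) → ∀ m → K ℕ.≤ m → A m
    from {A} f m K≤m = ≡.subst A (ℕ.m∸n+n≡m K≤m) (f (m ℕ.∸ K))

    upper : ∀ m → K ℕ.≤ m → S m ≤ S K + d K
    upper = from {λ m → S m ≤ S K + d K} λ j →
      ≤-trans (x≤x+y (0≤d (j ℕ.+ K))) (Tail.tail-upper t u 0≤u (bounded-expTerm isAbs) N halves j (ℕ.m≤n+m N p))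

    lower : ∀ m → K ℕ.≤ m → S K ≤ S m + d K
    lower = from {λ m → S K ≤ S m + d K} λ j → -‿swap $ begin
      - S (j ℕ.+ K)   ≈⟨ partialSum-neg t (j ℕ.+ K) ⟨
      partialSum (λ i → - t i) (j ℕ.+ K)
        ≤⟨ x≤x+y (0≤d (j ℕ.+ K)) ⟩
      partialSum (λ i → - t i) (j ℕ.+ K) + d (j ℕ.+ K)
        ≤⟨ Tail.tail-upper (λ i → - t i) u 0≤u (neg-dom {t} {u} (bounded-expTerm isAbs)) N halves j (ℕ.m≤n+m N p) ⟩
      partialSum (λ i → - t i) K + d K  ≈⟨ +-congʳ (partialSum-neg t K) ⟩
      - S K + d K     ∎

    close : ∀ m n → K ℕ.≤ m → K ℕ.≤ n → S m ≤ S n + ε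
    close m n K≤m K≤n = begin
      S m                ≤⟨ upper m K≤m ⟩
      S K + d K          ≤⟨ +-mono-≤ (lower n K≤n) ≤-refl ⟩
      (S n + d K) + d K  ≈⟨ +-assoc (S n) (d K) (d K) ⟩
      S n + e K          ≤⟨ +-monoʳ-≤ (S n) small ⟩
      S n + ε            ∎

  abstract
    exp-cauchy : ∀ x → Cauchy (partialSum (expTerm x))
    exp-cauchy x ε 0<ε = K , λ m n K≤m K≤n → close m n K≤m K≤n , close n m K≤n K≤m
      where open Proof x ε 0<ε

  exp : ℝ → ℝ
  exp x = proj₁ (complete (partialSum (expTerm x)) (exp-cauchy x))

module Probability {c ℓ₁ ℓ₂} {{R : Reals c ℓ₁ ℓ₂}} where
  open Reals R

  -- Finite lists of weighted outcomes; an outcome may occur several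
  -- times, its probability being the sum of the weights.
  Dist : Set → Set c
  Dist A = List (ℝ × A)

  private variable
    A B : Set

  return : A → Dist A
  return a = [ 1# , a ]

  infixl 1 _>>=_
  _>>=_ : Dist A → (A → Dist B) → Dist B
  μ >>= f = List.concatMap (λ (p , a) → List.map (λ (q , b) → p * q , b) (f a)) μ

  independently : ∀ {n} → (Fin n → Dist A) → Dist (Vec A n)
  independently {n = zero}  μ = return []
  independently {n = suc n} μ = do
    a  ← μ Fin.zero
    as ← independently (μ ∘ Fin.suc)
    return (a ∷ as)

  uniform : List A → Dist A
  uniform as = List.map (λ a → fromℕ (List.length as) ⁻¹ , a) as

  bernoulli : ℝ → Dist Bool
  bernoulli p = (p , true) ∷ (1# − p , false) ∷ []

  Pr : ∀ {p} {P : Pred A p} → Dist A → Decidable P → ℝ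
  Pr μ P? = List.foldr _+_ 0# (List.map proj₁ (List.filter (P? ∘ proj₂) μ))

words : ∀ n m → List (Vec (Fin n) m)
words n zero    = [ [] ]
words n (suc m) = List.cartesianProductWith _∷_ (List.allFin n) (words n m)

unique? : ∀ {n m} → Decidable (Unique {A = Fin n} {n = m})
unique? = AllPairs.allPairs? (λ i j → ¬? (i Fin.≟ j))

-- A bijection σ : [n] → U is a repetition-free word of length n.
orderings : ∀ n → List (Vec (Fin n) n)
orderings n = List.filter unique? (words n n)

record Matroid (n : ℕ) : Set₁ where
  field
    Indep      : Subset n → Set
    Indep?     : Decidable Indep
    Indep-⊥    : Indep ⊥
    Indep-⊆    : ∀ {I J} → I ⊆ J → Indep J → Indep I
    augmentation : ∀ {I J} → Indep I → Indep J → ∣ I ∣ ℕ.< ∣ J ∣ →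
                   ∃[ e ] e ∈ J × e ∉ I × Indep (I ∪ ⁅ e ⁆)

-- Only the values of φ on I are meaningful; nothing plays the role of ⊥.
record IsExchangeMapping {n} (M : Matroid n) (I J : Subset n)
                         (φ : Fin n → Maybe (Fin n)) : Set where
  open Matroid M
  field
    into-J    : ∀ {e f} → e ∈ I → φ e ≡ just f → f ∈ J
    fixes-I∩J : ∀ {e} → e ∈ I → e ∈ J → φ e ≡ just e
    adds      : ∀ {e} → e ∈ I → φ e ≡ nothing → Indep (J ∪ ⁅ e ⁆)
    exchanges : ∀ {e f} → e ∈ I → φ e ≡ just f → Indep ((J - f) ∪ ⁅ e ⁆)
    injective : ∀ {e e′ f} → e ∈ I → e′ ∈ I →
                φ e ≡ just f → φ e′ ≡ just f → e ≡ e′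

module Scheme {c ℓ₁ ℓ₂} {{R : Reals c ℓ₁ ℓ₂}} where
  open Reals R
  open Probability {{R}}

  private variable
    n : ℕ

  indicator : Subset n → Fin n → ℝ
  indicator S e = if does (e ∈? S) then 1# else 0#

  record ConvexCombination (M : Matroid n) (x : Fin n → ℝ) (m : ℕ) :
                           Set (c ⊔ ℓ₁ ⊔ ℓ₂) where
    open Matroid M
    field
      β           : Fin m → ℝ
      β-nonNeg    : ∀ i → 0# ≤ β i
      β-sum       : sum β ≈ 1#
      I           : Fin m → Subset n
      I-indep     : ∀ i → Indep (I i)
      x-decomposed : ∀ e → x e ≈ sum (λ i → β i * indicator (I i) e)

  _∈Polytope_ : (Fin n → ℝ) → Matroid n → Set _
  x ∈Polytope M = ∃ (ConvexCombination M x)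

  -- What the scheme for one matroid learns by processing an element; no
  -- controller is drawn when x e = 0.
  record Observation (n m : ℕ) : Set where
    constructor observed
    field
      element    : Fin n
      active     : Bool
      controller : Maybe (Fin m)

  -- The choices left open by the description of the scheme: the
  -- decomposition of x, and the exchange mappings. The mapping φᵢⱼ in
  -- force at any time may depend on everything observed so far (most
  -- recent observation first), but not on elements yet to be processed.
  record Choices (M : Matroid n) (x : Fin n → ℝ) : Set (c ⊔ ℓ₁ ⊔ ℓ₂) where
    open Matroid M
    field
      m             : ℕ
      m≤n+1         : m ℕ.≤ n ℕ.+ 1
      decomposition : ConvexCombination M x m
      φ             : List (Observation n m) → (i j : Fin m) →
                      (I J : Subset n) → Fin n → Maybe (Fin n)
      φ-exchange    : ∀ h i j {I J} → Indep I → Indep J →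
                      IsExchangeMapping M I J (φ h i j I J)

  module SingleMatroid {M : Matroid n} {x : Fin n → ℝ} (C : Choices M x) where
    open Choices C
    open ConvexCombination decomposition

    pickController : Fin n → Dist (Maybe (Fin m))
    pickController e with 0# <? x e
    ... | no  _ = return nothing
    ... | yes _ =
      List.map (λ i → β i ÷ x e , just i)
        (List.filter (λ i → (e ∈? I i) ×-dec ¬? (β i ≟ 0#)) (List.allFin m))

    record State : Set where
      constructor state
      field
        history : List (Observation n m)
        current : Fin m → Subset n
        chosen  : Subset n

    initial : State
    initial = state [] I ⊥

    -- Deletion precedes insertion, so that a set already containing e
    -- (where φᵢⱼ e ≡ just e) is left unchanged.
    exchange : Subset n → Fin n → Maybe (Fin n) → Subset n
    exchange J e nothing  = J ∪ ⁅ e ⁆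
    exchange J e (just f) = (J - f) ∪ ⁅ e ⁆

    process : Subset n → Vec (Maybe (Fin m)) n → State → Fin n → State
    process A controllers (state h cur S) e = decide (Vec.lookup controllers e)
      where
      h′ = observed e (does (e ∈? A)) (Vec.lookup controllers e) ∷ h

      update : Fin m → Fin m → Subset n
      update i j with β j ≟ 0#
      ... | yes _ = cur j
      ... | no  _ = exchange (cur j) e (φ h i j (cur i) (cur j) e)

      decide : Maybe (Fin m) → State
      decide nothing  = state h′ cur S
      decide (just i) with (e ∈? A) ×-dec (e ∈? cur i)
      ... | yes _ = state h′ (update i) (S ∪ ⁅ e ⁆)
      ... | no  _ = state h′ cur S

    -- Given the common order and active set, the k schemes have
    -- independent controllers, hence conditionally independent outputs.
    scheme : Vec (Fin n) n → Subset n → Dist (Subset n)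
    scheme σ A = do
      controllers ← independently pickController
      return (State.chosen (List.foldl (process A controllers) initial (Vec.toList σ)))

  awScheme : ∀ {k} {M : Fin k → Matroid n} {x : Fin n → ℝ} →
             (∀ j → Choices (M j) x) → Dist (Subset n)
  awScheme {n = n} {x = x} C = do
    σ ← uniform (orderings n)
    A ← independently (bernoulli ∘ x)
    Ss ← independently (λ j → SingleMatroid.scheme (C j) σ A)
    return (⋂ (Vec.toList Ss))

  weight : (Fin n → ℝ) → Subset n → ℝ
  weight a S = sum (λ e → indicator S e * a e)

open Reals {{...}} public
  using (ℝ; 0#; 1#; _≤_; _≤?_; _<_; _*_; -_; _−_; _÷_; _^_; sum; fromℕ)
open Exponential {{...}} public
  using (exp)
open Probability {{...}} public
  using (Pr)
open Scheme {{...}} public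
  using (_∈Polytope_; Choices; awScheme; weight)

module Submission where

-- Let K = k + 1. For an element f not yet processed let p_f be the
-- probability that f, if it came next, would enter all k of the sets Sⱼ.
-- Processing another element lowers p_f only when an exchange mapping
-- removes f from some Iᵢ. Since these mappings are injective, a uniformly
-- random next element does so with probability at most 1/r in each matroid,
-- r being the number of unprocessed elements, and it is f itself with
-- probability 1/r. So in one step the pending weight Z = Σ a_f p_f (over
-- unprocessed f) drops by at most KZ/r in expectation, while a(S) gains
-- exactly Z/r. As the gain is at most 1 and the drop at most K, the bound
--   exp (⅓ v − u) ≤ 1 + ½ (v − u)  for u, v ∈ [0, 1]
-- makes exp (− a(S) − Z/3K) a supermartingale. Initially Z = Q and finally
-- Z = 0, so E exp (− a(S)) ≤ exp (− Q/3K), and Markov's inequality gives the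
-- result because ⅓ > ⅕.

import Algebra.Properties.CommutativeMonoid.Sum as MonoidSum
import Algebra.Properties.Ring as RingProperties
import Algebra.Properties.Semiring.Mult as SemiringMult
import Algebra.Properties.Semiring.Mult.TCOptimised as SemiringMultOptimised
import Algebra.Properties.Semiring.Sum as SemiringSum
import Algebra.Solver.Ring as RingSolver
open import Algebra.Bundles using (CommutativeRing)
open import Algebra.Solver.Ring.AlmostCommutativeRing
  using (AlmostCommutativeRing; fromCommutativeRing; _-Raw-AlmostCommutative⟶_)
open import Data.Bool.Base using (Bool; true; false; _∧_; not; if_then_else_)
import Data.Bool.Properties as Bool
open import Data.Fin.Base as Fin using (Fin)
import Data.Fin.Properties as Fin
open import Data.Fin.Subset as Subset using (Subset; ⊤; ⁅_⁆; ∣_∣; ⋂; _∪_; _∈_; _⊆_)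
import Data.Fin.Subset.Properties as Subset
import Data.Integer.Base as ℤ
import Data.Integer.Properties as ℤ
open import Data.List.Base as List using (List; []; _∷_; _++_)
open import Data.List.Relation.Unary.All using ([]; _∷_) renaming (All to ListAll)
open import Data.List.Relation.Unary.AllPairs using ([]; _∷_)
open import Data.List.Relation.Unary.Unique.Propositional
  using () renaming (Unique to ListUnique)
open import Data.Maybe.Base using (Maybe; just; nothing)
import Data.Maybe.Properties as Maybe
open import Data.Nat.Base as ℕ using (ℕ; zero; suc; _!; _∸_; z≤n)
import Data.Nat.Properties as ℕ
open import Data.Product.Base using (∃-syntax; _×_; _,_; proj₁; proj₂)
open import Data.Sum.Base using (inj₁; inj₂)
import Data.Unit.Base as Unit
open import Data.Vec.Base as Vec using (Vec; []; _∷_; lookup; _[_]≔_)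
import Data.Vec.Properties as Vec
open import Data.Vec.Relation.Unary.All as VecAll using (All; []; _∷_)
import Data.Vec.Relation.Unary.All.Properties as VecAll
open import Data.Vec.Relation.Unary.AllPairs using ([]; _∷_)
open import Data.Vec.Relation.Unary.Unique.Propositional using (Unique)
open import Function.Base using (_∘_; id)
open import Function.Bundles using (mk⇔)
import Level
open import Relation.Binary.PropositionalEquality.Core as ≡ using (_≡_; _≢_)
import Relation.Binary.Reasoning.PartialOrder as PartialOrderReasoning
open import Relation.Nullary using (¬_; Dec; yes; no; does; contradiction)
open import Relation.Nullary.Decidable using (_×-dec_; ¬?)
open import Relation.Unary using (Pred; Decidable)

open import Defs using (Reals; module Reals; module OrderProperties; module Exponential;
  module Probability; module Scheme; Matroid; IsExchangeMapping; module IsExchangeMapping;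
  words; unique?; orderings)

-- The sets Sⱼ are correlated through the common order and active set, and exchange mappings may
-- depend on the whole past. Deferred decisions cope with both: the past involves only bits and
-- controllers of processed elements, so those of an unprocessed f are still fresh, and p_f is `x f`
-- times a product of one survival probability per matroid. The rate 1/r in each matroid comes from
-- a cancellation. An element e is active with probability x_e and picks index i with probability
-- βᵢ/x_e, so it acts through i with weight at most βᵢ, whatever x_e is. For fixed i and j,
-- injectivity leaves at most one e ∈ Iᵢ that removes f from Iⱼ, and the weights βᵢ sum to 1. Only
-- conditional means of drop and gain are compared. The exponential increment must therefore be
-- bounded by an affine function with the same slope in both: slope ½ is what the gain allows on
-- [0, 1], and ⅓ is the factor on the drop that matches it. The reals are axiomatic and `exp` is the
-- limit of its series, so its functional equation has to be proved before any of this can be used.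

-- Ring solver with integer coefficients

module IntegerCoefficients {c ℓ} (CR : CommutativeRing c ℓ) where
  open CommutativeRing CR hiding (zero)
  open RingProperties ring
  open SemiringMultOptimised semiring using (×-homo-+; ×1-homo-*) renaming (_×_ to _·_)
  open import Relation.Binary.Reasoning.Setoid setoid

  -- Chosen so that ⟦ 0 ⟧, ⟦ 1 ⟧ and ⟦ 2 ⟧ compute to 0#, 1# and 1# + 1#.
  ⟦_⟧ℕ : ℕ → Carrier
  ⟦ n ⟧ℕ = n · 1#

  ⟦_⟧ : ℤ.ℤ → Carrier
  ⟦ ℤ.+ n ⟧      = ⟦ n ⟧ℕ
  ⟦ ℤ.-[1+ n ] ⟧ = - ⟦ suc n ⟧ℕ

  ℕ-suc : ∀ n → ⟦ suc n ⟧ℕ ≈ 1# + ⟦ n ⟧ℕ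
  ℕ-suc n = ×-homo-+ 1# 1 n

  cancel : ∀ a b d → (d + a) - (d + b) ≈ a - b
  cancel a b d = begin
    (d + a) - (d + b)      ≈⟨ +-congˡ (-‿+-comm d b) ⟨
    (d + a) + (- d - b)    ≈⟨ +-assoc (d + a) (- d) (- b) ⟨
    ((d + a) - d) - b      ≈⟨ +-congʳ (+-congʳ (+-comm d a)) ⟩
    ((a + d) - d) - b      ≈⟨ +-congʳ (+-assoc a d (- d)) ⟩
    (a + (d - d)) - b      ≈⟨ +-congʳ (+-congˡ (-‿inverseʳ d)) ⟩
    (a + 0#) - b           ≈⟨ +-congʳ (+-identityʳ a) ⟩
    a - b                  ∎

  ⊖-homo : ∀ m n → ⟦ m ℤ.⊖ n ⟧ ≈ ⟦ m ⟧ℕ - ⟦ n ⟧ℕ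
  ⊖-homo m       zero    = sym (trans (+-congˡ -0#≈0#) (+-identityʳ ⟦ m ⟧ℕ))
  ⊖-homo zero    (suc n) = sym (+-identityˡ (- ⟦ suc n ⟧ℕ))
  ⊖-homo (suc m) (suc n) = begin
    ⟦ suc m ℤ.⊖ suc n ⟧              ≡⟨ ≡.cong ⟦_⟧ (ℤ.[1+m]⊖[1+n]≡m⊖n m n) ⟩
    ⟦ m ℤ.⊖ n ⟧                      ≈⟨ ⊖-homo m n ⟩
    ⟦ m ⟧ℕ - ⟦ n ⟧ℕ                  ≈⟨ cancel ⟦ m ⟧ℕ ⟦ n ⟧ℕ 1# ⟨
    (1# + ⟦ m ⟧ℕ) - (1# + ⟦ n ⟧ℕ)    ≈⟨ +-cong (ℕ-suc m) (-‿cong (ℕ-suc n)) ⟨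
    ⟦ suc m ⟧ℕ - ⟦ suc n ⟧ℕ          ∎

  +-homo : ∀ i j → ⟦ i ℤ.+ j ⟧ ≈ ⟦ i ⟧ + ⟦ j ⟧
  +-homo (ℤ.+ m)      (ℤ.+ n)      = ×-homo-+ 1# m n
  +-homo (ℤ.+ m)      (ℤ.-[1+ n ]) = ⊖-homo m (suc n)
  +-homo (ℤ.-[1+ m ]) (ℤ.+ n)      = trans (⊖-homo n (suc m)) (+-comm _ _)
  +-homo (ℤ.-[1+ m ]) (ℤ.-[1+ n ]) = begin
    - ⟦ suc (suc (m ℕ.+ n)) ⟧ℕ     ≡⟨ ≡.cong (λ k → - ⟦ suc k ⟧ℕ) (ℕ.+-suc m n) ⟨
    - ⟦ suc m ℕ.+ suc n ⟧ℕ         ≈⟨ -‿cong (×-homo-+ 1# (suc m) (suc n)) ⟩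
    - (⟦ suc m ⟧ℕ + ⟦ suc n ⟧ℕ)    ≈⟨ -‿+-comm _ _ ⟨
    - ⟦ suc m ⟧ℕ - ⟦ suc n ⟧ℕ      ∎

  -‿homo : ∀ i → ⟦ ℤ.- i ⟧ ≈ - ⟦ i ⟧
  -‿homo (ℤ.+ zero)   = sym -0#≈0#
  -‿homo (ℤ.+ suc n)  = refl
  -‿homo ℤ.-[1+ n ]   = sym (-‿involutive _)

  *-homo⁺ : ∀ m j → ⟦ ℤ.+ m ℤ.* j ⟧ ≈ ⟦ m ⟧ℕ * ⟦ j ⟧
  *-homo⁺ m (ℤ.+ n) = begin
    ⟦ ℤ.+ m ℤ.* ℤ.+ n ⟧    ≡⟨ ≡.cong ⟦_⟧ (ℤ.pos-* m n) ⟨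
    ⟦ m ℕ.* n ⟧ℕ           ≈⟨ ×1-homo-* m n ⟩
    ⟦ m ⟧ℕ * ⟦ n ⟧ℕ        ∎
  *-homo⁺ m ℤ.-[1+ n ] = begin
    ⟦ ℤ.+ m ℤ.* ℤ.-[1+ n ] ⟧       ≡⟨ ≡.cong ⟦_⟧ (ℤ.neg-distribʳ-* (ℤ.+ m) (ℤ.+ suc n)) ⟨
    ⟦ ℤ.- (ℤ.+ m ℤ.* ℤ.+ suc n) ⟧  ≈⟨ -‿homo (ℤ.+ m ℤ.* ℤ.+ suc n) ⟩
    - ⟦ ℤ.+ m ℤ.* ℤ.+ suc n ⟧      ≈⟨ -‿cong (*-homo⁺ m (ℤ.+ suc n)) ⟩
    - (⟦ m ⟧ℕ * ⟦ suc n ⟧ℕ)        ≈⟨ -‿distribʳ-* _ _ ⟩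
    ⟦ m ⟧ℕ * - ⟦ suc n ⟧ℕ          ∎

  *-homo : ∀ i j → ⟦ i ℤ.* j ⟧ ≈ ⟦ i ⟧ * ⟦ j ⟧
  *-homo (ℤ.+ m)    j = *-homo⁺ m j
  *-homo ℤ.-[1+ m ] j = begin
    ⟦ ℤ.-[1+ m ] ℤ.* j ⟧         ≡⟨ ≡.cong ⟦_⟧ (ℤ.neg-distribˡ-* (ℤ.+ suc m) j) ⟨
    ⟦ ℤ.- (ℤ.+ suc m ℤ.* j) ⟧    ≈⟨ -‿homo (ℤ.+ suc m ℤ.* j) ⟩
    - ⟦ ℤ.+ suc m ℤ.* j ⟧        ≈⟨ -‿cong (*-homo⁺ (suc m) j) ⟩
    - (⟦ suc m ⟧ℕ * ⟦ j ⟧)       ≈⟨ -‿distribˡ-* _ _ ⟩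
    - ⟦ suc m ⟧ℕ * ⟦ j ⟧         ∎

  almostCommutativeRing : AlmostCommutativeRing c ℓ
  almostCommutativeRing = fromCommutativeRing CR

  -- Coefficients come from ℤ and not from the ring itself: cancellations such as 1 - 1 = 0 are
  -- visible to the solver only if equality of coefficients can be computed.
  ℤ-morphism : ℤ.+-*-rawRing -Raw-AlmostCommutative⟶ almostCommutativeRing
  ℤ-morphism = record
    { ⟦_⟧    = ⟦_⟧
    ; +-homo = +-homo
    ; *-homo = *-homo
    ; -‿homo = -‿homo
    ; 0-homo = refl
    ; 1-homo = refl
    }

  coeff≟ : ∀ i j → Maybe (⟦ i ⟧ ≈ ⟦ j ⟧)
  coeff≟ i j with i ℤ.≟ j
  ... | yes ≡.refl = just refl
  ... | no  _      = nothing

  open RingSolver ℤ.+-*-rawRing almostCommutativeRing ℤ-morphism coeff≟ public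
    using (solve; _:=_; con; _:+_; _:*_; _:-_; :-_; Polynomial)

  :0 :1 : ∀ {n} → Polynomial n
  :0 = con (ℤ.+ 0)
  :1 = con (ℤ.+ 1)

-- Inequalities in ordered fields

module OrderedField {c ℓ₁ ℓ₂} (R : Reals c ℓ₁ ℓ₂) where
  open Reals R public
  open OrderProperties {{R}} public
  open IntegerCoefficients commutativeRing public
    using (solve; _:=_; :0; :1; _:+_; _:*_; _:-_; :-_)
  open MonoidSum +-commutativeMonoid public
    using (sum-cong-≋; ∑-distrib-+; ∑-comm; sum-replicate; sum-replicate-zero)
  open SemiringSum semiring public
    using (*-distribˡ-sum; *-distribʳ-sum)
  open SemiringMult semiring public
    using () renaming (×-homo-+ to ·-homo-+; ×1-homo-* to fromℕ-*)
  open PartialOrderReasoning poset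

  -- Splits an inequality into the nonnegativity of an explicit difference and a ring identity,
  -- which `solve` can then close.
  ≤-from-difference : ∀ {x y d} → 0# ≤ d → y ≈ x + d → x ≤ y
  ≤-from-difference {x} {y} {d} 0≤d eq = begin
    x       ≈⟨ +-identityʳ x ⟨
    x + 0#  ≤⟨ +-monoʳ-≤ x 0≤d ⟩
    x + d   ≈⟨ eq ⟨
    y       ∎

  +-nonNegative : ∀ {x y} → 0# ≤ x → 0# ≤ y → 0# ≤ x + y
  +-nonNegative 0≤x 0≤y = ≤-respˡ-≈ (+-identityʳ 0#) (+-mono-≤ 0≤x 0≤y)

  *-mono-≤ : ∀ {x y u v} → 0# ≤ x → 0# ≤ u → x ≤ y → u ≤ v → x * u ≤ y * v
  *-mono-≤ 0≤x 0≤u x≤y u≤v =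
    ≤-trans (*-monoʳ-≤ 0≤u x≤y) (*-monoˡ-≤ (≤-trans 0≤x x≤y) u≤v)

  -‿anti-≤ : ∀ {x y} → x ≤ y → - y ≤ - x
  -‿anti-≤ {x} {y} x≤y = ≤-from-difference (x≤y⇒0≤y−x x≤y)
    (solve 2 (λ x y → :- x := :- y :+ (y :- x)) refl x y)

  sum-mono-≤ : ∀ {n} {f g : Fin n → ℝ} → (∀ i → f i ≤ g i) → sum f ≤ sum g
  sum-mono-≤ {zero}  p = ≤-refl
  sum-mono-≤ {suc n} p = +-mono-≤ (p Fin.zero) (sum-mono-≤ (λ i → p (Fin.suc i)))

  sum-nonNegative : ∀ {n} {f : Fin n → ℝ} → (∀ i → 0# ≤ f i) → 0# ≤ sum f
  sum-nonNegative {zero}  p = ≤-refl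
  sum-nonNegative {suc n} p = +-nonNegative (p Fin.zero) (sum-nonNegative (λ i → p (Fin.suc i)))

  0<1 : 0# < 1#
  0<1 = 0≤1 , 0≉1

  <⇒≉0 : ∀ {x} → 0# < x → ¬ (x ≈ 0#)
  <⇒≉0 (_ , 0≉x) x≈0 = 0≉x (sym x≈0)

  +-positiveʳ : ∀ {a b} → 0# ≤ a → 0# < b → 0# < a + b
  +-positiveʳ {a} {b} 0≤a (0≤b , 0≉b) = +-nonNegative 0≤a 0≤b , λ 0≈a+b →
    0≉b (antisym 0≤b (begin
      b       ≈⟨ +-identityˡ b ⟨
      0# + b  ≤⟨ +-mono-≤ 0≤a ≤-refl ⟩
      a + b   ≈⟨ 0≈a+b ⟨
      0#      ∎))

  *-positive : ∀ {a b} → 0# < a → 0# < b → 0# < a * b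
  *-positive {a} {b} (0≤a , 0≉a) (0≤b , 0≉b) = *-nonNegative 0≤a 0≤b , λ 0≈ab →
    0≉a (begin-equality
      0#              ≈⟨ zeroˡ (b ⁻¹) ⟨
      0# * b ⁻¹       ≈⟨ *-congʳ 0≈ab ⟩
      (a * b) * b ⁻¹  ≈⟨ *-assoc a b (b ⁻¹) ⟩
      a * (b * b ⁻¹)  ≈⟨ *-congˡ (⁻¹-inverse (<⇒≉0 (0≤b , 0≉b))) ⟩
      a * 1#          ≈⟨ *-identityʳ a ⟩
      a               ∎)

  ⁻¹-positive : ∀ {x} → 0# < x → 0# < x ⁻¹
  ⁻¹-positive {x} 0<x = 0≤⁻¹ (proj₁ 0<x) x≉0 , λ 0≈x⁻¹ → 0≉1 (begin-equality
      0#        ≈⟨ zeroʳ x ⟨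
      x * 0#    ≈⟨ *-congˡ 0≈x⁻¹ ⟩
      x * x ⁻¹  ≈⟨ ⁻¹-inverse x≉0 ⟩
      1#        ∎)
    where x≉0 = <⇒≉0 0<x

  fromℕ-positive : ∀ n → .{{ℕ.NonZero n}} → 0# < fromℕ n
  fromℕ-positive n = 0≤fromℕ n , λ 0≈n → fromℕ≉0 n (sym 0≈n)

  ≰⇒0<− : ∀ {x y} → ¬ (x ≤ y) → 0# < x − y
  ≰⇒0<− {x} {y} x≰y with total x y
  ... | inj₁ x≤y = contradiction x≤y x≰y
  ... | inj₂ y≤x = x≤y⇒0≤y−x y≤x , λ 0≈x−y → x≰y (≤-reflexive (begin-equality
      x            ≈⟨ −+-cancel y x ⟨
      (x − y) + y  ≈⟨ +-congʳ 0≈x−y ⟨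
      0# + y       ≈⟨ +-identityˡ y ⟩
      y            ∎))

  -- If x exceeds y by d > 0, then ε = d / (K + 1 + d) is a counterexample: it is positive, at most
  -- 1, and Kε < d. The factor `K` admits errors with a fixed coefficient, and the restriction ε ≤ 1
  -- lets ε² be absorbed into ε; the product estimate for `exp` uses both.
  ≤-from-scaled-ε : ∀ {x y K} → 0# ≤ K →
    (∀ ε → 0# < ε → ε ≤ 1# → x ≤ y + K * ε) → x ≤ y
  ≤-from-scaled-ε {x} {y} {K} 0≤K h with x ≤? y
  ... | yes x≤y = x≤y
  ... | no  x≰y = contradiction 0≈d·i (proj₂ (*-positive 0<d 0<i))
    where
    d = x − y
    0<d : 0# < d
    0<d = ≰⇒0<− x≰y
    D = (K + 1#) + d
    0<D : 0# < D
    0<D = +-positiveʳ (+-nonNegative 0≤K 0≤1) 0<d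
    i = D ⁻¹
    0<i : 0# < i
    0<i = ⁻¹-positive 0<D
    ε = d * i
    Di≈1 : D * i ≈ 1#
    Di≈1 = ⁻¹-inverse (<⇒≉0 0<D)
    ε≤1 : ε ≤ 1#
    ε≤1 = ≤-from-difference (*-nonNegative (+-nonNegative 0≤K 0≤1) (proj₁ 0<i)) (begin-equality
      1#                  ≈⟨ Di≈1 ⟨
      D * i
        ≈⟨ solve 3 (λ k d i → (k :+ d) :* i := d :* i :+ k :* i) refl (K + 1#) d i ⟩
      ε + (K + 1#) * i    ∎)
    -- Kε = d − (1 + d)ε, so the hypothesis forces (1 + d)ε ≤ 0.
    εd≤0 : ε ≤ 0#
    εd≤0 = 0≤y−x⇒x≤y (begin
      0#                                ≤⟨ x≤y⇒0≤y−x (h ε (*-positive 0<d 0<i) ε≤1) ⟩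
      (y + K * ε) − x                   ≈⟨ solve 4 (λ x y k i → (y :+ k :* ((x :- y) :* i)) :- x
                                             := (x :- y) :* ((k :+ :1 :+ (x :- y)) :* i :- :1)
                                                :- (x :- y) :* i :- (x :- y) :*
                                                  ((x :- y) :* i)) refl x y K i ⟩
      d * (D * i − 1#) − ε − d * ε
        ≈⟨ +-congʳ (+-congʳ (trans (*-congˡ (trans (+-congʳ Di≈1) (-‿inverseʳ 1#))) (zeroʳ d))) ⟩
      0# − ε − d * ε
        ≤⟨ +-monoʳ-≤ (0# − ε) (-‿anti-≤ (*-nonNegative (proj₁ 0<d) (proj₁ (*-positive 0<d 0<i)))) ⟩
      0# − ε − 0#                       ≈⟨ solve 1 (λ e → :0 :- e :- :0 := :0 :- e) refl ε ⟩
      0# − ε                            ∎)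
    0≈d·i : 0# ≈ d * i
    0≈d·i = antisym (proj₁ (*-positive 0<d 0<i)) εd≤0

  ≤-from-ε : ∀ {x y} → (∀ ε → 0# < ε → x ≤ y + ε) → x ≤ y
  ≤-from-ε h = ≤-from-scaled-ε 0≤1 λ ε 0<ε _ → ≤-respʳ-≈ (+-congˡ (sym (*-identityˡ ε))) (h ε 0<ε)

  *-cancelʳ-≈ : ∀ {x y z} → 0# ≤ z → ¬ (z ≈ 0#) → x * z ≈ y * z → x ≈ y
  *-cancelʳ-≈ 0≤z z≉0 eq = antisym
    (*-cancelʳ-≤ 0≤z z≉0 (≤-reflexive eq)) (*-cancelʳ-≤ 0≤z z≉0 (≤-reflexive (sym eq)))

  0<−⇒< : ∀ {x y} → 0# < y − x → x < y
  0<−⇒< {x} {y} (0≤ , 0≉) = 0≤y−x⇒x≤y 0≤ , λ x≈y → 0≉ (begin-equality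
    0#     ≈⟨ -‿inverseʳ x ⟨
    x − x  ≈⟨ +-congʳ x≈y ⟩
    y − x  ∎)

  *-≤ˡ : ∀ {x y} → 0# ≤ y → x ≤ 1# → x * y ≤ y
  *-≤ˡ 0≤y x≤1 = ≤-respʳ-≈ (*-identityˡ _) (*-monoʳ-≤ 0≤y x≤1)

  fromℕ-+ : ∀ m n → fromℕ (m ℕ.+ n) ≈ fromℕ m + fromℕ n
  fromℕ-+ = ·-homo-+ 1#

-- Algebra of partial sums

module PartialSums {c ℓ₁ ℓ₂} (R : Reals c ℓ₁ ℓ₂) where
  open OrderedField R
  open Exponential {{R}} using (partialSum; x≤x+y) public
  open PartialOrderReasoning poset

  partialSum-cong : ∀ {f g : ℕ → ℝ} n → (∀ i → i ℕ.< n → f i ≈ g i) →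
    partialSum f n ≈ partialSum g n
  partialSum-cong zero    h = refl
  partialSum-cong (suc n) h = +-cong (partialSum-cong n (λ i i<n → h i (ℕ.m<n⇒m<1+n i<n)))
    (h n (ℕ.n<1+n n))

  partialSum-mono : ∀ {f g : ℕ → ℝ} n → (∀ i → i ℕ.< n → f i ≤ g i) →
    partialSum f n ≤ partialSum g n
  partialSum-mono zero    h = ≤-refl
  partialSum-mono (suc n) h = +-mono-≤ (partialSum-mono n (λ i i<n → h i (ℕ.m<n⇒m<1+n i<n)))
    (h n (ℕ.n<1+n n))

  partialSum-extend : ∀ {f : ℕ → ℝ} → (∀ i → 0# ≤ f i) → ∀ {m n} → m ℕ.≤ n →
    partialSum f m ≤ partialSum f n
  partialSum-extend {f} 0≤f {m} {n} m≤n =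
    ≡.subst (λ k → partialSum f m ≤ partialSum f k) (ℕ.m∸n+n≡m m≤n) (go (n ∸ m))
    where
    go : ∀ j → partialSum f m ≤ partialSum f (j ℕ.+ m)
    go zero    = ≤-refl
    go (suc j) = ≤-trans (go j) (x≤x+y (0≤f (j ℕ.+ m)))

  partialSum-+ : ∀ (f g : ℕ → ℝ) n →
    partialSum (λ i → f i + g i) n ≈ partialSum f n + partialSum g n
  partialSum-+ f g zero    = sym (+-identityʳ 0#)
  partialSum-+ f g (suc n) = trans (+-congʳ (partialSum-+ f g n))
    (solve 4 (λ a b u v → (a :+ b) :+ (u :+ v) := (a :+ u) :+ (b :+ v)) refl _ _ _ _)

  partialSum-*ˡ : ∀ a (f : ℕ → ℝ) n → a * partialSum f n ≈ partialSum (λ i → a * f i) n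
  partialSum-*ˡ a f zero    = zeroʳ a
  partialSum-*ˡ a f (suc n) = trans (distribˡ a _ _) (+-congʳ (partialSum-*ˡ a f n))

  partialSum-− : ∀ (f g : ℕ → ℝ) n →
    partialSum f n − partialSum g n ≈ partialSum (λ i → f i − g i) n
  partialSum-− f g zero    = -‿inverseʳ 0#
  partialSum-− f g (suc n) = trans
    (solve 4 (λ a b u v → (a :+ b) :- (u :+ v) := (a :- u) :+ (b :- v)) refl _ _ _ _)
    (+-congʳ (partialSum-− f g n))

  partialSum-head : ∀ (f : ℕ → ℝ) n → partialSum f (suc n) ≈ f 0 + partialSum (λ i → f (suc i)) n
  partialSum-head f zero    = +-comm 0# (f 0)
  partialSum-head f (suc n) = trans (+-congʳ (partialSum-head f n)) (+-assoc _ _ _)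

-- First bounds on the exponential series

module ExponentialLaws {c ℓ₁ ℓ₂} (R : Reals c ℓ₁ ℓ₂) where
  open OrderedField R
  open PartialSums R public
  open Exponential {{R}}
    using (expTerm; expTerm-suc; exp; exp-cauchy; Bounded; IsAbs; abs;
           bounded-*ˡ; bounded-expTerm; 0≤expTerm; 0≤^)
  open PartialOrderReasoning poset

  S : ℝ → ℕ → ℝ
  S x = partialSum (expTerm x)

  S→exp : ∀ x → S x ConvergesTo exp x
  S→exp x = proj₂ (complete (S x) (exp-cauchy x))

  limit-≤ : ∀ {s L B} → s ConvergesTo L → (∃[ M ] ∀ n → M ℕ.≤ n → s n ≤ B) → L ≤ B
  limit-≤ {s} {L} {B} s→L (M , s≤B) = ≤-from-ε λ ε 0<ε →
    let (N , close) = s→L ε 0<ε in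
    ≤-trans (proj₂ (close (N ℕ.+ M) (ℕ.m≤m+n N M)))
            (+-mono-≤ (s≤B (N ℕ.+ M) (ℕ.m≤n+m M N)) ≤-refl)

  limit-≥ : ∀ {s L B} → s ConvergesTo L → (∃[ M ] ∀ n → M ℕ.≤ n → B ≤ s n) → B ≤ L
  limit-≥ {s} {L} {B} s→L (M , B≤s) = ≤-from-ε λ ε 0<ε →
    let (N , close) = s→L ε 0<ε in
    ≤-trans (B≤s (N ℕ.+ M) (ℕ.m≤n+m M N)) (proj₁ (close (N ℕ.+ M) (ℕ.m≤m+n N M)))

  fromℕ1≈1 : fromℕ 1 ≈ 1#
  fromℕ1≈1 = +-identityʳ 1#

  expTerm₀ : ∀ x → expTerm x 0 ≈ 1#
  expTerm₀ x = trans (*-congʳ (sym fromℕ1≈1)) (⁻¹-inverse (fromℕ≉0 1))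

  expTerm₁ : ∀ x → expTerm x 1 ≈ x
  expTerm₁ x = begin-equality
    expTerm x 1            ≈⟨ *-identityʳ _ ⟨
    expTerm x 1 * 1#       ≈⟨ *-congˡ fromℕ1≈1 ⟨
    expTerm x 1 * fromℕ 1  ≈⟨ expTerm-suc x 0 ⟩
    expTerm x 0 * x        ≈⟨ *-congʳ (expTerm₀ x) ⟩
    1# * x                 ≈⟨ *-identityˡ x ⟩
    x                      ∎

  -- For x ≥ 0 the terms dropped after the first two are nonnegative. Negative arguments are reached
  -- later through `exp-inverse`.
  1+x≤exp : ∀ {x} → 0# ≤ x → 1# + x ≤ exp x
  1+x≤exp {x} 0≤x = limit-≥ (S→exp x) (2 , λ n 2≤n → begin
    1# + x                             ≈⟨ +-cong (expTerm₀ x) (expTerm₁ x) ⟨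
    expTerm x 0 + expTerm x 1          ≈⟨ +-congʳ (+-identityˡ (expTerm x 0)) ⟨
    S x 2                              ≤⟨ partialSum-extend (0≤expTerm 0≤x) 2≤n ⟩
    S x n                              ∎)

  expTerm≤^ : ∀ {x} → 0# ≤ x → ∀ n → expTerm x n ≤ x ^ n
  expTerm≤^ {x} 0≤x zero    = ≤-reflexive (expTerm₀ x)
  expTerm≤^ {x} 0≤x (suc n) = *-cancelʳ-≤ (0≤fromℕ (suc n)) (fromℕ≉0 (suc n)) (begin
    expTerm x (suc n) * fromℕ (suc n)  ≈⟨ expTerm-suc x n ⟩
    expTerm x n * x                    ≤⟨ *-monoʳ-≤ 0≤x (expTerm≤^ 0≤x n) ⟩
    x ^ n * x                          ≈⟨ *-comm _ _ ⟩
    x * x ^ n                          ≈⟨ *-identityʳ _ ⟨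
    x * x ^ n * 1#                     ≤⟨ *-monoˡ-≤ (0≤^ 0≤x (suc n)) (x≤x+y (0≤fromℕ n)) ⟩
    x * x ^ n * fromℕ (suc n)          ∎)

  -- Dropping the factorials leaves the geometric series, whose partial sums telescope against
  -- `1# − x`. This gives `exp 0# ≤ 1#` as well as the upper bound on growth.
  exp-geometric : ∀ {x} → 0# ≤ x → x < 1# → exp x * (1# − x) ≤ 1#
  exp-geometric {x} 0≤x (x≤1 , x≉1) = begin
    exp x * (1# − x)    ≤⟨ *-monoʳ-≤ 0≤1-x (limit-≤ (S→exp x) (0 , λ n _ → S≤ n)) ⟩
    (1# − x) ⁻¹ * (1# − x) ≈⟨ *-comm _ _ ⟩
    (1# − x) * (1# − x) ⁻¹ ≈⟨ ⁻¹-inverse 1-x≉0 ⟩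
    1#                  ∎
    where
    0≤1-x = x≤y⇒0≤y−x x≤1
    1-x≉0 : ¬ (1# − x ≈ 0#)
    1-x≉0 eq = x≉1 (begin-equality
      x               ≈⟨ +-identityˡ x ⟨
      0# + x          ≈⟨ +-congʳ eq ⟨
      (1# − x) + x    ≈⟨ −+-cancel x 1# ⟩
      1#              ∎)
    telescope : ∀ n → S x n * (1# − x) ≤ 1# − x ^ n
    telescope zero    = ≤-reflexive (trans (zeroˡ _) (sym (-‿inverseʳ 1#)))
    telescope (suc n) = begin
      (S x n + expTerm x n) * (1# − x)            ≈⟨ distribʳ (1# − x) (S x n) (expTerm x n) ⟩
      S x n * (1# − x) + expTerm x n * (1# − x)
        ≤⟨ +-mono-≤ (telescope n) (*-monoʳ-≤ 0≤1-x (expTerm≤^ 0≤x n)) ⟩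
      (1# − x ^ n) + x ^ n * (1# − x)
        ≈⟨ solve 2 (λ x p → (:1 :- p) :+ p :* (:1 :- x) := :1 :- x :* p) refl x (x ^ n) ⟩
      1# − x * x ^ n                              ∎
    S≤ : ∀ n → S x n ≤ (1# − x) ⁻¹
    S≤ n = *-cancelʳ-≤ 0≤1-x 1-x≉0 (begin
      S x n * (1# − x)        ≤⟨ telescope n ⟩
      1# − x ^ n
        ≤⟨ ≤-from-difference (0≤^ 0≤x n) (solve 1 (λ p → :1 := :1 :- p :+ p) refl (x ^ n)) ⟩
      1#                      ≈⟨ ⁻¹-inverse 1-x≉0 ⟨
      (1# − x) * (1# − x) ⁻¹  ≈⟨ *-comm _ _ ⟩
      (1# − x) ⁻¹ * (1# − x)  ∎)

  expTerm-cong : ∀ {x y} → x ≈ y → ∀ n → expTerm x n ≈ expTerm y n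
  expTerm-cong {x} {y} x≈y n = *-congʳ (^-cong n)
    where
    ^-cong : ∀ n → x ^ n ≈ y ^ n
    ^-cong zero    = refl
    ^-cong (suc n) = *-cong x≈y (^-cong n)

  -- `exp x` is the limit that `complete` returns for one particular Cauchy proof, and `complete` is
  -- not assumed to respect `≈`. Equality therefore has to come from the partial sums.
  exp-cong : ∀ {x y} → x ≈ y → exp x ≈ exp y
  exp-cong x≈y = antisym (exp-≤ x≈y) (exp-≤ (sym x≈y))
    where
    exp-≤ : ∀ {x y} → x ≈ y → exp x ≤ exp y
    exp-≤ {x} {y} x≈y = ≤-from-ε λ ε 0<ε →
      let (N , close) = S→exp y ε 0<ε in
      limit-≤ (S→exp x) (N , λ n N≤n → ≤-respˡ-≈
        (partialSum-cong n (λ i _ → sym (expTerm-cong x≈y i))) (proj₁ (close n N≤n)))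

  -- The functional equation of `exp` by Cauchy products

  -- `Bounded p q` reads |p| ≤ q and forces q ≥ 0. First |p| takes the place of p, and then q that
  -- of |p|, which requires s ≥ 0.
  bounded-* : ∀ {p q r s} → Bounded p q → Bounded r s → Bounded (p * r) (q * s)
  bounded-* {p} {q} {r} {s} (p≤q , -p≤q) (r≤s , -r≤s) =
    let (y , isAbs@(0≤y , _)) = abs p
        (pr≤ys , -pr≤ys) = bounded-*ˡ isAbs (r≤s , -r≤s)
        ys≤qs = *-monoʳ-≤ 0≤s (y≤q isAbs)
    in ≤-trans pr≤ys ys≤qs , ≤-trans -pr≤ys ys≤qs
    where
    0≤s : 0# ≤ s
    0≤s with total 0# r
    ... | inj₁ 0≤r = ≤-trans 0≤r r≤s
    ... | inj₂ r≤0 = ≤-trans (x≤0⇒0≤-x r≤0) -r≤s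
    y≤q : ∀ {y} → IsAbs p y → y ≤ q
    y≤q (_ , inj₁ p≈y)  = ≤-respˡ-≈ p≈y p≤q
    y≤q (_ , inj₂ p≈-y) = ≤-respˡ-≈ (trans (-‿cong p≈-y)
      (solve 1 (λ y → :- (:- y) := y) refl _)) -p≤q

  bounded-+ : ∀ {p q r s} → Bounded p q → Bounded r s → Bounded (p + r) (q + s)
  bounded-+ {p} {q} {r} {s} (p≤q , -p≤q) (r≤s , -r≤s) =
    +-mono-≤ p≤q r≤s ,
    ≤-respˡ-≈ (solve 2 (λ p r → :- p :+ :- r := :- (p :+ r)) refl p r) (+-mono-≤ -p≤q -r≤s)

  bounded-resp-≈ : ∀ {p p′ q q′} → p ≈ p′ → q ≈ q′ → Bounded p q → Bounded p′ q′
  bounded-resp-≈ p≈p′ q≈q′ (p≤q , -p≤q) =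
    ≤-respˡ-≈ p≈p′ (≤-respʳ-≈ q≈q′ p≤q) , ≤-respˡ-≈ (-‿cong p≈p′) (≤-respʳ-≈ q≈q′ -p≤q)

  bounded-partialSum : ∀ {f g : ℕ → ℝ} n → (∀ i → i ℕ.< n → Bounded (f i) (g i)) →
    Bounded (partialSum f n) (partialSum g n)
  bounded-partialSum zero    h = ≤-refl , ≤-reflexive (solve 0 (:- :0 := :0) refl)
  bounded-partialSum (suc n) h =
    bounded-+ (bounded-partialSum n (λ i i<n → h i (ℕ.m<n⇒m<1+n i<n))) (h n (ℕ.n<1+n n))

  -- triangle x y N is the Cauchy product truncated below total degree N.
  convolution : ℝ → ℝ → ℕ → ℝ
  convolution x y n = partialSum (λ i → expTerm x i * expTerm y (n ∸ i)) (suc n)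

  triangle : ℝ → ℝ → ℕ → ℝ
  triangle x y N = partialSum (λ i → expTerm x i * S y (N ∸ i)) N

  -- Each row gains its term of total degree `N`. The new row `N` consists of such a term alone,
  -- because the sum `S y 0` it would add to the old triangle is empty.
  triangle-suc : ∀ x y N → triangle x y (suc N) ≈ triangle x y N + convolution x y N
  triangle-suc x y N = begin-equality
    triangle x y (suc N)
      ≈⟨ partialSum-cong (suc N) (λ i i<1+N → begin-equality
           t i * S y (suc N ∸ i)
             ≡⟨ ≡.cong (λ k → t i * S y k) (ℕ.+-∸-assoc 1 (ℕ.s≤s⁻¹ i<1+N)) ⟩
           t i * (S y (N ∸ i) + u (N ∸ i))              ≈⟨ distribˡ _ _ _ ⟩
           t i * S y (N ∸ i) + t i * u (N ∸ i)          ∎) ⟩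
    partialSum (λ i → t i * S y (N ∸ i) + t i * u (N ∸ i)) (suc N)
      ≈⟨ partialSum-+ (λ i → t i * S y (N ∸ i)) (λ i → t i * u (N ∸ i)) (suc N) ⟩
    (triangle x y N + t N * S y (N ∸ N)) + convolution x y N
      ≡⟨ ≡.cong (λ k → (triangle x y N + t N * S y k) + convolution x y N) (ℕ.n∸n≡0 N) ⟩
    (triangle x y N + t N * 0#) + convolution x y N
      ≈⟨ +-congʳ (trans (+-congˡ (zeroʳ _)) (+-identityʳ _)) ⟩
    triangle x y N + convolution x y N ∎
    where
    t = expTerm x
    u = expTerm y

  -- Weight the degree-(n+1) products by i + (n + 1 − i) = n + 1.
  convolution-suc : ∀ x y n → convolution x y (suc n) * fromℕ (suc n) ≈ convolution x y n * (x + y)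
  convolution-suc x y n = begin-equality
    convolution x y (suc n) * fromℕ (suc n)
      ≈⟨ *-comm _ _ ⟩
    fromℕ (suc n) * convolution x y (suc n)
      ≈⟨ partialSum-*ˡ (fromℕ (suc n)) _ (suc (suc n)) ⟩
    partialSum (λ i → fromℕ (suc n) * (t i * u (suc n ∸ i))) (suc (suc n))
      ≈⟨ partialSum-cong (suc (suc n)) (λ i i<2+n → split i (ℕ.s≤s⁻¹ i<2+n)) ⟩
    partialSum (λ i → A i + B i) (suc (suc n))
      ≈⟨ partialSum-+ A B (suc (suc n)) ⟩
    partialSum A (suc (suc n)) + partialSum B (suc (suc n))
      ≈⟨ +-cong sumA sumB ⟩
    x * convolution x y n + y * convolution x y n
      ≈⟨ solve 3 (λ x y c → x :* c :+ y :* c := c :* (x :+ y)) refl x y _ ⟩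
    convolution x y n * (x + y) ∎
    where
    t = expTerm x
    u = expTerm y
    A B : ℕ → ℝ
    A i = (t i * fromℕ i) * u (suc n ∸ i)
    B i = t i * (u (suc n ∸ i) * fromℕ (suc n ∸ i))
    split : ∀ i → i ℕ.≤ suc n → fromℕ (suc n) * (t i * u (suc n ∸ i)) ≈ A i + B i
    split i i≤ = begin-equality
      fromℕ (suc n) * (t i * u (suc n ∸ i))
        ≡⟨ ≡.cong (λ k → fromℕ k * (t i * u (suc n ∸ i))) (ℕ.m+[n∸m]≡n i≤) ⟨
      fromℕ (i ℕ.+ (suc n ∸ i)) * (t i * u (suc n ∸ i))
        ≈⟨ *-congʳ (fromℕ-+ i (suc n ∸ i)) ⟩
      (fromℕ i + fromℕ (suc n ∸ i)) * (t i * u (suc n ∸ i))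
        ≈⟨ solve 4 (λ a b t u → (a :+ b) :* (t :* u)
             := (t :* a) :* u :+ t :* (u :* b)) refl _ _ _ _ ⟩
      A i + B i ∎
    sumA : partialSum A (suc (suc n)) ≈ x * convolution x y n
    sumA = begin-equality
      partialSum A (suc (suc n))
        ≈⟨ partialSum-head A (suc n) ⟩
      (t 0 * 0#) * u (suc n) + partialSum (λ i → A (suc i)) (suc n)
        ≈⟨ trans (+-congʳ (trans (*-congʳ (zeroʳ _)) (zeroˡ _))) (+-identityˡ _) ⟩
      partialSum (λ i → A (suc i)) (suc n)
        ≈⟨ partialSum-cong (suc n) (λ i _ →
             trans (*-congʳ (trans (expTerm-suc x i) (*-comm _ _))) (*-assoc _ _ _)) ⟩
      partialSum (λ i → x * (t i * u (n ∸ i))) (suc n)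
        ≈⟨ partialSum-*ˡ x _ (suc n) ⟨
      x * convolution x y n ∎
    sumB : partialSum B (suc (suc n)) ≈ y * convolution x y n
    sumB = begin-equality
      partialSum B (suc n) + B (suc n)
        ≡⟨ ≡.cong (λ k → partialSum B (suc n) + t (suc n) * (u k * fromℕ k)) (ℕ.n∸n≡0 n) ⟩
      partialSum B (suc n) + t (suc n) * (u 0 * 0#)
        ≈⟨ trans (+-congˡ (trans (*-congˡ (zeroʳ _)) (zeroʳ _))) (+-identityʳ _) ⟩
      partialSum B (suc n)
        ≈⟨ partialSum-cong (suc n) (λ i i<1+n → begin-equality
             B i
               ≡⟨ ≡.cong (λ k → t i * (u k * fromℕ k)) (ℕ.+-∸-assoc 1 (ℕ.s≤s⁻¹ i<1+n)) ⟩
             t i * (u (suc (n ∸ i)) * fromℕ (suc (n ∸ i)))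
               ≈⟨ *-congˡ (expTerm-suc y (n ∸ i)) ⟩
             t i * (u (n ∸ i) * y)
               ≈⟨ solve 3 (λ t u y → t :* (u :* y) := y :* (t :* u)) refl _ _ _ ⟩
             y * (t i * u (n ∸ i)) ∎) ⟩
      partialSum (λ i → y * (t i * u (n ∸ i))) (suc n)
        ≈⟨ partialSum-*ˡ y _ (suc n) ⟨
      y * convolution x y n ∎

  -- The binomial theorem divided by n!, without binomial coefficients: both sides satisfy the same
  -- first-order recurrence in `n`, and its factor `fromℕ (suc n)` can be cancelled.
  convolution-expTerm : ∀ x y n → convolution x y n ≈ expTerm (x + y) n
  convolution-expTerm x y zero = begin-equality
    0# + expTerm x 0 * expTerm y 0  ≈⟨ +-identityˡ _ ⟩
    expTerm x 0 * expTerm y 0       ≈⟨ *-cong (expTerm₀ x) (expTerm₀ y) ⟩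
    1# * 1#                         ≈⟨ *-identityˡ 1# ⟩
    1#                              ≈⟨ expTerm₀ (x + y) ⟨
    expTerm (x + y) 0               ∎
  convolution-expTerm x y (suc n) = *-cancelʳ-≈ (0≤fromℕ (suc n)) (fromℕ≉0 (suc n)) (begin-equality
    convolution x y (suc n) * fromℕ (suc n)    ≈⟨ convolution-suc x y n ⟩
    convolution x y n * (x + y)                ≈⟨ *-congʳ (convolution-expTerm x y n) ⟩
    expTerm (x + y) n * (x + y)                ≈⟨ expTerm-suc (x + y) n ⟨
    expTerm (x + y) (suc n) * fromℕ (suc n)    ∎)

  triangle≈S : ∀ x y N → triangle x y N ≈ S (x + y) N
  triangle≈S x y zero    = refl
  triangle≈S x y (suc N) = trans (triangle-suc x y N)
    (+-cong (triangle≈S x y N) (convolution-expTerm x y N))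

  square−triangle : ∀ x y N → S x N * S y N − triangle x y N ≈
    partialSum (λ i → expTerm x i * (S y N − S y (N ∸ i))) N
  square−triangle x y N = begin-equality
    S x N * S y N − triangle x y N
      ≈⟨ +-congʳ (trans (*-comm _ _) (partialSum-*ˡ (S y N) (expTerm x) N)) ⟩
    partialSum (λ i → S y N * expTerm x i) N − triangle x y N
      ≈⟨ partialSum-− _ _ N ⟩
    partialSum (λ i → S y N * expTerm x i − expTerm x i * S y (N ∸ i)) N
      ≈⟨ partialSum-cong N (λ i _ → solve 3
           (λ s t v → s :* t :- t :* v := t :* (s :- v)) refl _ _ _) ⟩
    partialSum (λ i → expTerm x i * (S y N − S y (N ∸ i))) N ∎

  bounded-S-difference : ∀ {y q} → IsAbs y q → ∀ {m n} → m ℕ.≤ n →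
    Bounded (S y n − S y m) (S q n − S q m)
  bounded-S-difference {y} {q} isAbs {m} {n} m≤n =
    ≡.subst (λ k → Bounded (S y k − S y m) (S q k − S q m)) (ℕ.m∸n+n≡m m≤n) (go (n ∸ m))
    where
    go : ∀ j → Bounded (S y (j ℕ.+ m) − S y m) (S q (j ℕ.+ m) − S q m)
    go zero    = bounded-resp-≈ (sym (-‿inverseʳ _)) (sym (-‿inverseʳ _))
      (bounded-partialSum {λ _ → 0#} {λ _ → 0#} 0 (λ _ ()))
    go (suc j) = bounded-resp-≈ (rearrange _ _ _) (rearrange _ _ _)
      (bounded-+ (go j) (bounded-expTerm isAbs (j ℕ.+ m)))
      where
      rearrange : ∀ a b t → (a − b) + t ≈ (a + t) − b
      rearrange a b t = solve 3 (λ a b t → (a :- b) :+ t := (a :+ t) :- b) refl a b t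

  -- What the square has beyond the triangle is a sum of products of terms, and each product is
  -- dominated by the same product at |x| and |y|. Convergence is thereby reduced to nonnegative
  -- arguments.
  bounded-square−triangle : ∀ {x y p q} → IsAbs x p → IsAbs y q → ∀ N →
    Bounded (S x N * S y N − triangle x y N) (S p N * S q N − triangle p q N)
  bounded-square−triangle {x} {y} {p} {q} absx absy N =
    bounded-resp-≈ (sym (square−triangle x y N)) (sym (square−triangle p q N))
      (bounded-partialSum N λ i _ →
        bounded-* (bounded-expTerm absx i) (bounded-S-difference absy (ℕ.m∸n≤m N i)))

  -- Indices i, j < N have i + j < 2N, so the square of side `N` lies inside the triangle of side
  -- 2N; with nonnegative terms the inclusion becomes an inequality.
  square≤triangle : ∀ {p q} → 0# ≤ p → 0# ≤ q → ∀ N → S p N * S q N ≤ triangle p q (N ℕ.+ N)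
  square≤triangle {p} {q} 0≤p 0≤q N = begin
    S p N * S q N
      ≈⟨ trans (*-comm _ _) (partialSum-*ˡ (S q N) (expTerm p) N) ⟩
    partialSum (λ i → S q N * expTerm p i) N
      ≤⟨ partialSum-mono N termwise ⟩
    partialSum (λ i → expTerm p i * S q (N ℕ.+ N ∸ i)) N
      ≤⟨ partialSum-extend nonNegative (ℕ.m≤m+n N N) ⟩
    triangle p q (N ℕ.+ N) ∎
    where
    termwise : ∀ i → i ℕ.< N → S q N * expTerm p i ≤ expTerm p i * S q (N ℕ.+ N ∸ i)
    termwise i i<N = begin
      S q N * expTerm p i                ≈⟨ *-comm _ _ ⟩
      expTerm p i * S q N
        ≤⟨ *-monoˡ-≤ (0≤expTerm 0≤p i) (partialSum-extend (0≤expTerm 0≤q) N≤) ⟩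
      expTerm p i * S q (N ℕ.+ N ∸ i)    ∎
      where
      N≤ : N ℕ.≤ N ℕ.+ N ∸ i
      N≤ = ℕ.≤-trans (ℕ.m≤m+n N (N ∸ i)) (ℕ.≤-reflexive (≡.sym (ℕ.+-∸-assoc N (ℕ.<⇒≤ i<N))))
    nonNegative : ∀ i → 0# ≤ expTerm p i * S q (N ℕ.+ N ∸ i)
    nonNegative i = *-nonNegative (0≤expTerm 0≤p i)
      (partialSum-extend (0≤expTerm 0≤q) {0} {N ℕ.+ N ∸ i} z≤n)

  -- The error at |x|, |y| is at most the piece of the series of `exp (p + q)` between `n` and 2n:
  -- the square fits into the triangle of side 2n, and triangles are partial sums of that series.
  -- The Cauchy property makes the piece small.
  exp-close : ∀ {x y p q ε} → IsAbs x p → IsAbs y q → 0# < ε →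
    ∃[ N ] ∀ n → N ℕ.≤ n → Bounded (S x n * S y n − S (x + y) n) ε
  exp-close {x} {y} {p} {q} {ε} absx absy 0<ε = N , λ n N≤n →
    let (lo , hi) = bounded-resp-≈
                      (+-congˡ (-‿cong (triangle≈S x y n))) (+-congˡ (-‿cong (triangle≈S p q n)))
                      (bounded-square−triangle absx absy n)
        bound : S p n * S q n − S (p + q) n ≤ ε
        bound = begin
          S p n * S q n − S (p + q) n
            ≤⟨ +-mono-≤ (square≤triangle (proj₁ absx) (proj₁ absy) n) ≤-refl ⟩
          triangle p q (n ℕ.+ n) − S (p + q) n     ≈⟨ +-congʳ (triangle≈S p q (n ℕ.+ n)) ⟩
          S (p + q) (n ℕ.+ n) − S (p + q) n
            ≤⟨ +-mono-≤ (proj₁ (close (n ℕ.+ n) n (ℕ.≤-trans N≤n (ℕ.m≤m+n n n)) N≤n)) ≤-refl ⟩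
          (S (p + q) n + ε) − S (p + q) n
            ≈⟨ solve 2 (λ s e → (s :+ e) :- s := e) refl _ _ ⟩
          ε                                        ∎
    in ≤-trans lo bound , ≤-trans hi bound
    where
    N = proj₁ (exp-cauchy (p + q) ε 0<ε)
    close = proj₂ (exp-cauchy (p + q) ε 0<ε)

  bounded-close : ∀ {a b ε} → ∣ a - b ∣≤ ε → Bounded (b − a) ε
  bounded-close {a} {b} {ε} (a≤b+ε , b≤a+ε) =
    ≤-trans (+-mono-≤ b≤a+ε ≤-refl) (≤-reflexive (solve 2 (λ a e → (a :+ e) :- a := e) refl a ε)) ,
    ≤-trans (≤-reflexive (solve 2 (λ a b → :- (b :- a) := a :- b) refl a b))
      (≤-trans (+-mono-≤ a≤b+ε ≤-refl)
        (≤-reflexive (solve 2 (λ b e → (b :+ e) :- b := e) refl b ε)))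

  isAbs⇒bounded : ∀ {x p} → IsAbs x p → Bounded x p
  isAbs⇒bounded isAbs = bounded-resp-≈ (*-identityʳ _) (*-identityʳ _)
    (bounded-*ˡ isAbs (≤-refl , -1≤1))
    where
    -1≤1 : - 1# ≤ 1#
    -1≤1 = ≤-from-difference (+-nonNegative 0≤1 0≤1) (solve 0 (:1 := :- :1 :+ (:1 :+ :1)) refl)

  -- The errors are ε|Y|, |X|ε, ε², and ε twice, with ε² ≤ ε since ε ≤ 1; this is the coefficient P
  -- + Q + 3. It has to be independent of the index `n` at which the partial sums are taken.
  exp-+-bounded : ∀ x y ε → 0# < ε → ε ≤ 1# →
    let P = proj₁ (abs (exp x)) ; Q = proj₁ (abs (exp y)) in
    Bounded (exp x * exp y − exp (x + y)) ((P + Q + fromℕ 3) * ε)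
  exp-+-bounded x y ε 0<ε ε≤1 = bounded-resp-≈ decompose refl
    (≤-trans (proj₁ total-bound) shrink , ≤-trans (proj₂ total-bound) shrink)
    where
    X = exp x
    Y = exp y
    Z = exp (x + y)
    P = proj₁ (abs X)
    Q = proj₁ (abs Y)
    N₁ = S→exp x ε 0<ε
    N₂ = S→exp y ε 0<ε
    N₃ = S→exp (x + y) ε 0<ε
    N₄ = exp-close (proj₂ (abs x)) (proj₂ (abs y)) 0<ε
    n = (proj₁ N₁ ℕ.+ proj₁ N₂) ℕ.+ (proj₁ N₃ ℕ.+ proj₁ N₄)
    X-X′ : Bounded (X − S x n) ε
    X-X′ = bounded-close (proj₂ N₁ n (ℕ.≤-trans (ℕ.m≤m+n _ (proj₁ N₂)) (ℕ.m≤m+n _ _)))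
    Y-Y′ : Bounded (Y − S y n) ε
    Y-Y′ = bounded-close (proj₂ N₂ n (ℕ.≤-trans (ℕ.m≤n+m _ (proj₁ N₁)) (ℕ.m≤m+n _ _)))
    Z′-Z : Bounded (S (x + y) n − Z) ε
    Z′-Z = bounded-close (proj₂ z , proj₁ z)
      where z = proj₂ N₃ n (ℕ.≤-trans (ℕ.m≤m+n _ (proj₁ N₄)) (ℕ.m≤n+m _ (proj₁ N₁ ℕ.+ proj₁ N₂)))
    prod : Bounded (S x n * S y n − S (x + y) n) ε
    prod = proj₂ N₄ n (ℕ.≤-trans (ℕ.m≤n+m _ (proj₁ N₃)) (ℕ.m≤n+m _ (proj₁ N₁ ℕ.+ proj₁ N₂)))
    -1-bounded : Bounded (- 1#) 1#
    -1-bounded = ≤-trans (proj₂ one) ≤-refl , ≤-reflexive (solve 0 (:- (:- :1) := :1) refl)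
      where one = isAbs⇒bounded {1#} {1#} (0≤1 , inj₁ refl)
    total-bound =
      bounded-+ (bounded-+ (bounded-+ (bounded-* X-X′ (isAbs⇒bounded (proj₂ (abs Y))))
                                      (bounded-* (isAbs⇒bounded (proj₂ (abs X))) Y-Y′))
                           (bounded-* -1-bounded (bounded-* X-X′ Y-Y′)))
                (bounded-+ prod Z′-Z)
    -- Expanded around the limits X and Y instead of the partial sums, so that the coefficients do
    -- not vary with `n`; the price is the second-order term.
    decompose : ((X − S x n) * Y + X * (Y − S y n)) + - 1# * ((X − S x n) * (Y − S y n))
                  + ((S x n * S y n − S (x + y) n) + (S (x + y) n − Z)) ≈ X * Y − Z
    decompose = solve 6 (λ X Y Z x y z →
      ((X :- x) :* Y :+ X :* (Y :- y)) :+ :- :1 :* ((X :- x) :* (Y :- y))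
        :+ ((x :* y :- z) :+ (z :- Z)) := X :* Y :- Z) refl X Y Z (S x n) (S y n) (S (x + y) n)
    shrink : ((ε * Q + P * ε) + 1# * (ε * ε)) + (ε + ε) ≤ (P + Q + fromℕ 3) * ε
    shrink = begin
      ((ε * Q + P * ε) + 1# * (ε * ε)) + (ε + ε)
        ≤⟨ +-mono-≤ (+-monoʳ-≤ _ (*-monoˡ-≤ 0≤1 (*-monoˡ-≤ (proj₁ 0<ε) ε≤1))) ≤-refl ⟩
      ((ε * Q + P * ε) + 1# * (ε * 1#)) + (ε + ε)
        ≈⟨ solve 3 (λ e P Q → ((e :* Q :+ P :* e) :+ :1 :* (e :* :1)) :+ (e :+ e)
             := (P :+ Q :+ (:1 :+ (:1 :+ (:1 :+ :0)))) :* e) refl ε P Q ⟩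
      (P + Q + fromℕ 3) * ε ∎

  exp-+ : ∀ x y → exp (x + y) ≈ exp x * exp y
  exp-+ x y = antisym
    (≤-from-scaled-ε 0≤K λ ε 0<ε ε≤1 → begin
      Z                              ≈⟨ solve 2 (λ a z → z := a :+ :- (a :- z)) refl _ _ ⟩
      XY + - (XY − Z)                ≤⟨ +-monoʳ-≤ XY (proj₂ (exp-+-bounded x y ε 0<ε ε≤1)) ⟩
      XY + K * ε                     ∎)
    (≤-from-scaled-ε 0≤K λ ε 0<ε ε≤1 → begin
      XY                             ≈⟨ solve 2 (λ a z → a := z :+ (a :- z)) refl _ _ ⟩
      Z + (XY − Z)                   ≤⟨ +-monoʳ-≤ Z (proj₁ (exp-+-bounded x y ε 0<ε ε≤1)) ⟩
      Z + K * ε                      ∎)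
    where
    Z = exp (x + y)
    XY = exp x * exp y
    K = proj₁ (abs (exp x)) + proj₁ (abs (exp y)) + fromℕ 3
    0≤K : 0# ≤ K
    0≤K = +-nonNegative (+-nonNegative (proj₁ (proj₂ (abs (exp x)))) (proj₁ (proj₂ (abs (exp y)))))
      (0≤fromℕ 3)

  exp-0 : exp 0# ≈ 1#
  exp-0 = antisym
    (≤-respˡ-≈ (trans (*-congˡ (solve 0 (:1 :- :0 := :1) refl)) (*-identityʳ _))
      (exp-geometric ≤-refl 0<1))
    (≤-respˡ-≈ (+-identityʳ 1#) (1+x≤exp ≤-refl))

  exp-inverse : ∀ x → exp (- x) * exp x ≈ 1#
  exp-inverse x = begin-equality
    exp (- x) * exp x    ≈⟨ exp-+ (- x) x ⟨
    exp (- x + x)        ≈⟨ exp-cong (-‿inverseˡ x) ⟩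
    exp 0#               ≈⟨ exp-0 ⟩
    1#                   ∎

  1≤exp : ∀ {x} → 0# ≤ x → 1# ≤ exp x
  1≤exp 0≤x = ≤-trans (x≤x+y 0≤x) (1+x≤exp 0≤x)

  0≤exp : ∀ x → 0# ≤ exp x
  0≤exp x with total 0# x
  ... | inj₁ 0≤x = ≤-trans 0≤1 (1≤exp 0≤x)
  ... | inj₂ x≤0 = *-cancelʳ-≤ (≤-trans 0≤1 1≤e) (λ e≈0 → 1≰0 (≤-respʳ-≈ e≈0 1≤e)) (begin
    0# * exp (- x)         ≈⟨ zeroˡ _ ⟩
    0#                     ≤⟨ 0≤1 ⟩
    1#                     ≈⟨ exp-inverse x ⟨
    exp (- x) * exp x      ≈⟨ *-comm _ _ ⟩
    exp x * exp (- x)      ∎)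
    where
    1≤e : 1# ≤ exp (- x)
    1≤e = 1≤exp (x≤0⇒0≤-x x≤0)

  exp-mono : ∀ {x y} → x ≤ y → exp x ≤ exp y
  exp-mono {x} {y} x≤y = begin
    exp x                ≈⟨ *-identityʳ _ ⟨
    exp x * 1#           ≤⟨ *-monoˡ-≤ (0≤exp x) (1≤exp (x≤y⇒0≤y−x x≤y)) ⟩
    exp x * exp (y − x)  ≈⟨ exp-+ x (y − x) ⟨
    exp (x + (y − x))    ≈⟨ exp-cong (solve 2 (λ x y → x :+ (y :- x) := y) refl x y) ⟩
    exp y                ∎

  -- Affine bounds on `exp` over the unit interval

  -- The solver knows nothing of inverses. With a single inverse and the other fractions as sums of
  -- it, every numerical identity becomes polynomial modulo `6·⅙≈1`.
  ⅙ ⅓ ½ : ℝ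
  ⅙ = fromℕ 6 ⁻¹
  ⅓ = ⅙ + ⅙
  ½ = ⅓ + ⅙

  0<⅙ : 0# < ⅙
  0<⅙ = ⁻¹-positive (fromℕ-positive 6)

  0≤⅓ : 0# ≤ ⅓
  0≤⅓ = +-nonNegative (proj₁ 0<⅙) (proj₁ 0<⅙)

  0≤½ : 0# ≤ ½
  0≤½ = +-nonNegative 0≤⅓ (proj₁ 0<⅙)

  6·⅙≈1 : ⅙ + ⅙ + ⅙ + ⅙ + ⅙ + ⅙ ≈ 1#
  6·⅙≈1 = trans
    (solve 1 (λ s → s :+ s :+ s :+ s :+ s :+ s :=
      (:1 :+ (:1 :+ (:1 :+ (:1 :+ (:1 :+ (:1 :+ :0)))))) :* s) refl ⅙)
    (⁻¹-inverse (fromℕ≉0 6))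

  -- Since exp u ≥ 1 + u, the left side is at most 1 / (1 + u), and the right side is the chord of
  -- this convex function over [0, 1]. That is where the slope ½ comes from.
  exp-decay : ∀ {u} → 0# ≤ u → u ≤ 1# → exp (- u) ≤ 1# − ½ * u
  exp-decay {u} 0≤u u≤1 = *-cancelʳ-≤ (proj₁ 0<1+u) (<⇒≉0 0<1+u) (begin
    exp (- u) * (1# + u)       ≤⟨ *-monoˡ-≤ (0≤exp (- u)) (1+x≤exp 0≤u) ⟩
    exp (- u) * exp u          ≈⟨ exp-inverse u ⟩
    1#                         ≤⟨ ≤-from-difference 0≤difference (begin-equality
        (1# − ½ * u) * (1# + u)
          ≈⟨ solve 2 (λ u s → (:1 :- (s :+ s :+ s) :* u) :* (:1 :+ u)
               := :1 :+ u :- (s :+ s :+ s :+ s :+ s :+ s) :* u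
                  :+ (s :+ s :+ s) :* u :* (:1 :- u)) refl u ⅙ ⟩
        1# + u − (⅙ + ⅙ + ⅙ + ⅙ + ⅙ + ⅙) * u + ½ * u * (1# − u)
          ≈⟨ +-congʳ (+-congˡ (-‿cong (trans (*-congʳ 6·⅙≈1) (*-identityˡ u)))) ⟩
        1# + u − u + ½ * u * (1# − u)
          ≈⟨ +-congʳ (solve 1 (λ u → :1 :+ u :- u := :1) refl u) ⟩
        1# + ½ * u * (1# − u) ∎) ⟩
    (1# − ½ * u) * (1# + u)    ∎)
    where
    0<1+u : 0# < 1# + u
    0<1+u = ≤-trans 0≤1 (x≤x+y 0≤u) , λ 0≈ → 1≰0 (≤-respʳ-≈ (sym 0≈) (x≤x+y 0≤u))
    0≤difference : 0# ≤ ½ * u * (1# − u)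
    0≤difference = *-nonNegative (*-nonNegative 0≤½ 0≤u) (x≤y⇒0≤y−x u≤1)

  -- Here the convex majorant is 1 / (1 - v/3), and 1 + v/2 is its chord over [0, 1]. For a factor c
  -- in place of ⅓ the chord has slope c / (1 - c), which equals ½ exactly at c = ⅓.
  exp-growth : ∀ {v} → 0# ≤ v → v ≤ 1# → exp (⅓ * v) ≤ 1# + ½ * v
  exp-growth {v} 0≤v v≤1 = *-cancelʳ-≤ (proj₁ 0<1-⅓v) (<⇒≉0 0<1-⅓v) (begin
    exp (⅓ * v) * (1# − ⅓ * v)      ≤⟨ exp-geometric (*-nonNegative 0≤⅓ 0≤v) (0<−⇒< 0<1-⅓v) ⟩
    1#
      ≤⟨ ≤-from-difference (*-nonNegative (*-nonNegative (proj₁ 0<⅙) 0≤v) 0≤1-v) (begin-equality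
        (1# + ½ * v) * (1# − ⅓ * v)
          ≈⟨ solve 2 (λ v s → (:1 :+ (s :+ s :+ s) :* v) :* (:1 :- (s :+ s) :* v)
               := :1 :+ s :* v :* (:1 :- (s :+ s :+ s :+ s :+ s :+ s) :* v)) refl v ⅙ ⟩
        1# + ⅙ * v * (1# − (⅙ + ⅙ + ⅙ + ⅙ + ⅙ + ⅙) * v)
          ≈⟨ +-congˡ (*-congˡ (+-congˡ (-‿cong (trans (*-congʳ 6·⅙≈1) (*-identityˡ v))))) ⟩
        1# + ⅙ * v * (1# − v) ∎) ⟩
    (1# + ½ * v) * (1# − ⅓ * v)     ∎)
    where
    0≤1-v = x≤y⇒0≤y−x v≤1
    0<1-⅓v : 0# < 1# − ⅓ * v
    0<1-⅓v = let (0≤ , 0≉) = +-positiveʳ (+-nonNegative (*-nonNegative 0≤⅓ 0≤1-v) 0≤½) 0<⅙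
             in ≤-respʳ-≈ eq 0≤ , λ 0≈ → 0≉ (trans 0≈ (sym eq))
      where
      eq : ⅓ * (1# − v) + ½ + ⅙ ≈ 1# − ⅓ * v
      eq = trans
        (solve 2 (λ v s → (s :+ s) :* (:1 :- v) :+ ((s :+ s) :+ s) :+ s
          := (s :+ s :+ s :+ s :+ s :+ s) :- (s :+ s) :* v) refl v ⅙)
        (+-congʳ 6·⅙≈1)

  -- The product of the two bounds would contain a term in uv. It is avoided by applying only the
  -- bound on `exp (- u)` first, and then using exp (v/3) ≥ 1 in the negative part. With one slope
  -- for both variables, only the sign of the mean of v - u will matter.
  exp-step : ∀ {u v} → 0# ≤ u → u ≤ 1# → 0# ≤ v → v ≤ 1# →
    exp (⅓ * v − u) ≤ 1# + ½ * (v − u)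
  exp-step {u} {v} 0≤u u≤1 0≤v v≤1 = begin
    exp (⅓ * v − u)                     ≈⟨ exp-+ (⅓ * v) (- u) ⟩
    exp (⅓ * v) * exp (- u)             ≤⟨ *-monoˡ-≤ (0≤exp _) (exp-decay 0≤u u≤1) ⟩
    exp (⅓ * v) * (1# − ½ * u)
      ≈⟨ solve 3 (λ e h u → e :* (:1 :- h :* u) := e :- e :* (h :* u)) refl _ ½ u ⟩
    exp (⅓ * v) − exp (⅓ * v) * (½ * u) ≤⟨ +-mono-≤ (exp-growth 0≤v v≤1)
                                             (-‿anti-≤ (*-monoʳ-≤ (*-nonNegative 0≤½ 0≤u)
                                               (1≤exp (*-nonNegative 0≤⅓ 0≤v)))) ⟩
    (1# + ½ * v) − 1# * (½ * u)
      ≈⟨ solve 3 (λ h u v → (:1 :+ h :* v) :- :1 :* (h :* u) := :1 :+ h :* (v :- u)) refl ½ u v ⟩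
    1# + ½ * (v − u)                    ∎

-- Tuples of private data

-- The decompositions may have different sizes, so controllers for different matroids have different
-- types and do not fit into a `Vec`. Nested pairs allow a joint draw to be built and split one
-- coordinate at a time.
Tuple : ∀ k → (Fin k → Set) → Set
Tuple zero    X = Unit.⊤
Tuple (suc k) X = X Fin.zero × Tuple k (X ∘ Fin.suc)

get : ∀ {k} {X : Fin k → Set} → Tuple k X → ∀ j → X j
get (x , xs) Fin.zero    = x
get (x , xs) (Fin.suc j) = get xs j

readAt : ∀ {n k} {Y : Fin k → Set} → Fin n → Tuple k (λ j → Vec (Y j) n) → Tuple k Y
readAt {k = zero}  e _        = Unit.tt
readAt {k = suc k} e (v , vs) = lookup v e , readAt e vs

get-readAt : ∀ {n k} {Y : Fin k → Set} (e : Fin n) (vs : Tuple k (λ j → Vec (Y j) n)) j →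
  get (readAt e vs) j ≡ lookup (get vs j) e
get-readAt e (v , vs) Fin.zero    = ≡.refl
get-readAt e (v , vs) (Fin.suc j) = get-readAt e vs j

AgreeOff : ∀ {A : Set} {n} → Fin n → Vec A n → Vec A n → Set
AgreeOff e v v′ = ∀ i → i ≢ e → lookup v i ≡ lookup v′ i

-- Expectation, independence and deferred decisions

module Expectation {c ℓ₁ ℓ₂} (R : Reals c ℓ₁ ℓ₂) where
  open OrderedField R
  open Probability {{R}}
  open PartialOrderReasoning poset

  ⟦_⟧ : Bool → ℝ
  ⟦ b ⟧ = if b then 1# else 0#

  0≤⟦_⟧ : ∀ b → 0# ≤ ⟦ b ⟧
  0≤⟦ true  ⟧ = 0≤1
  0≤⟦ false ⟧ = ≤-refl

  ⟦_⟧≤1 : ∀ b → ⟦ b ⟧ ≤ 1#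
  ⟦ true  ⟧≤1 = ≤-refl
  ⟦ false ⟧≤1 = 0≤1

  ⟦⟧-mono : ∀ {a b} → (a ≡ true → b ≡ true) → ⟦ a ⟧ ≤ ⟦ b ⟧
  ⟦⟧-mono {false} {b} h = 0≤⟦ b ⟧
  ⟦⟧-mono {true}  {b} h rewrite h ≡.refl = ≤-refl

  ⟦∧⟧ : ∀ a b → ⟦ a ∧ b ⟧ ≈ ⟦ a ⟧ * ⟦ b ⟧
  ⟦∧⟧ true  b = sym (*-identityˡ _)
  ⟦∧⟧ false b = sym (zeroˡ _)

  sum-atMostOne : ∀ {k} (B : Fin k → Bool) → (∀ {i j} → B i ≡ true → B j ≡ true → i ≡ j) →
    sum (λ i → ⟦ B i ⟧) ≤ 1#
  sum-atMostOne {zero}  B unique = 0≤1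
  sum-atMostOne {suc k} B unique with B Fin.zero in B₀
  ... | false = ≤-respˡ-≈ (sym (+-identityˡ _))
    (sum-atMostOne (B ∘ Fin.suc) (λ p q → Fin.suc-injective (unique p q)))
  ... | true  = ≤-reflexive (trans (+-congˡ (trans (sum-cong-≋ {k} none) (sum-replicate-zero k)))
    (+-identityʳ 1#))
    where
    none : ∀ i → ⟦ B (Fin.suc i) ⟧ ≈ 0#
    none i with B (Fin.suc i) in Bᵢ
    ... | false = refl
    ... | true  = contradiction (unique B₀ Bᵢ) λ ()

  sum-δ : ∀ {n} (e : Fin n) y → sum (λ f → ⟦ does (f Fin.≟ e) ⟧ * y) ≈ y
  sum-δ {suc n} Fin.zero y = trans
    (+-cong (*-identityˡ y) (trans (sum-cong-≋ {n} (λ _ → zeroˡ y)) (sum-replicate-zero n)))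
    (+-identityʳ y)
  sum-δ {suc n} (Fin.suc e) y = trans (+-cong (zeroˡ y) (sum-δ e y)) (+-identityˡ y)

  ∏ : ∀ {k} → (Fin k → ℝ) → ℝ
  ∏ {zero}  f = 1#
  ∏ {suc k} f = f Fin.zero * ∏ (f ∘ Fin.suc)

  private variable
    A B : Set
    n k : ℕ

  E : Dist A → (A → ℝ) → ℝ
  E []            f = 0#
  E ((p , a) ∷ μ) f = p * f a + E μ f

  E-cong : ∀ (μ : Dist A) {f g} → (∀ a → f a ≈ g a) → E μ f ≈ E μ g
  E-cong []            h = refl
  E-cong ((p , a) ∷ μ) h = +-cong (*-congˡ (h a)) (E-cong μ h)

  E-+ : ∀ (μ : Dist A) f g → E μ (λ a → f a + g a) ≈ E μ f + E μ g
  E-+ []            f g = sym (+-identityʳ 0#)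
  E-+ ((p , a) ∷ μ) f g = trans (+-congˡ (E-+ μ f g))
    (solve 5 (λ p x y u v → p :* (x :+ y) :+ (u :+ v)
      := (p :* x :+ u) :+ (p :* y :+ v)) refl p _ _ _ _)

  E-− : ∀ (μ : Dist A) f g → E μ (λ a → f a − g a) ≈ E μ f − E μ g
  E-− []            f g = sym (-‿inverseʳ 0#)
  E-− ((p , a) ∷ μ) f g = trans (+-congˡ (E-− μ f g))
    (solve 5 (λ p x y u v → p :* (x :- y) :+ (u :- v)
      := (p :* x :+ u) :- (p :* y :+ v)) refl p _ _ _ _)

  E-*ˡ : ∀ (μ : Dist A) x f → E μ (λ a → x * f a) ≈ x * E μ f
  E-*ˡ []            x f = sym (zeroʳ x)
  E-*ˡ ((p , a) ∷ μ) x f = trans (+-congˡ (E-*ˡ μ x f))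
    (solve 4 (λ p x y u → p :* (x :* y) :+ x :* u := x :* (p :* y :+ u)) refl p x _ _)

  E-*ʳ : ∀ (μ : Dist A) f x → E μ (λ a → f a * x) ≈ E μ f * x
  E-*ʳ μ f x = trans (E-cong μ (λ a → *-comm (f a) x)) (trans (E-*ˡ μ x f) (*-comm x _))

  E-0 : ∀ (μ : Dist A) → E μ (λ _ → 0#) ≈ 0#
  E-0 μ = trans (E-cong μ (λ _ → sym (zeroˡ 0#))) (trans (E-*ˡ μ 0# (λ _ → 0#)) (zeroˡ _))

  E-sum : ∀ (μ : Dist A) (f : Fin n → A → ℝ) → E μ (λ a → sum (λ i → f i a)) ≈ sum (λ i → E μ (f i))
  E-sum {n = zero}  μ f = E-0 μ
  E-sum {n = suc n} μ f = trans (E-+ μ (f Fin.zero) _) (+-congˡ (E-sum μ (f ∘ Fin.suc)))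

  E-comm : ∀ (μ : Dist A) (ν : Dist B) (f : A → B → ℝ) →
    E μ (λ a → E ν (f a)) ≈ E ν (λ b → E μ (λ a → f a b))
  E-comm []            ν f = sym (E-0 ν)
  E-comm ((p , a) ∷ μ) ν f = begin-equality
    p * E ν (f a) + E μ (λ a → E ν (f a))
      ≈⟨ +-cong (E-*ˡ ν p (f a)) (sym (E-comm μ ν f)) ⟨
    E ν (λ b → p * f a b) + E ν (λ b → E μ (λ a → f a b))  ≈⟨ E-+ ν _ _ ⟨
    E ν (λ b → p * f a b + E μ (λ a → f a b))              ∎

  E-++ : ∀ (μ ν : Dist A) f → E (μ ++ ν) f ≈ E μ f + E ν f
  E-++ []            ν f = sym (+-identityˡ _)
  E-++ ((p , a) ∷ μ) ν f = trans (+-congˡ (E-++ μ ν f)) (sym (+-assoc _ _ _))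

  E-scale : ∀ p (μ : Dist A) f → E (List.map (λ (q , b) → p * q , b) μ) f ≈ p * E μ f
  E-scale p []            f = sym (zeroʳ p)
  E-scale p ((q , a) ∷ μ) f = trans (+-cong (*-assoc p q _) (E-scale p μ f)) (sym (distribˡ p _ _))

  E->>= : ∀ (μ : Dist A) (κ : A → Dist B) f → E (μ >>= κ) f ≈ E μ (λ a → E (κ a) f)
  E->>= []            κ f = refl
  E->>= ((p , a) ∷ μ) κ f = trans (E-++ (List.map _ (κ a)) _ f)
    (+-cong (E-scale p (κ a) f) (E->>= μ κ f))

  E-return : ∀ (a : A) f → E (return a) f ≈ f a
  E-return a f = trans (+-identityʳ _) (*-identityˡ _)

  E->>=-return : ∀ (μ : Dist A) (g : A → B) f → E (μ >>= λ a → return (g a)) f ≈ E μ (λ a → f (g a))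
  E->>=-return μ g f = trans (E->>= μ (λ a → return (g a)) f) (E-cong μ λ a → E-return (g a) f)

  E-independently : ∀ (μ : Fin (suc n) → Dist A) f →
    E (independently μ) f ≈ E (μ Fin.zero) λ a → E (independently (μ ∘ Fin.suc)) λ as → f (a ∷ as)
  E-independently μ f = trans (E->>= (μ Fin.zero) _ f) (E-cong (μ Fin.zero) λ a →
    E->>=-return (independently (μ ∘ Fin.suc)) (a ∷_) f)

  Pr≈E : ∀ {p} {P : Pred A p} (μ : Dist A) (P? : Decidable P) →
    Pr μ P? ≈ E μ (λ a → ⟦ does (P? a) ⟧)
  Pr≈E []            P? = refl
  Pr≈E ((p , a) ∷ μ) P? with P? a
  ... | yes _ = +-cong (sym (*-identityʳ p)) (Pr≈E μ P?)
  ... | no  _ = trans (Pr≈E μ P?) (trans (sym (+-identityˡ _)) (+-congʳ (sym (zeroʳ p))))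

  -- Formulated through `E` and not through the weights, so that it passes through `>>=` directly
  -- and can be checked for controllers from a closed formula for their expectation.
  record IsProbability (μ : Dist A) : Set (c Level.⊔ ℓ₁ Level.⊔ ℓ₂) where
    field
      mono  : ∀ {f g} → (∀ a → f a ≤ g a) → E μ f ≤ E μ g
      mass : E μ (λ _ → 1#) ≈ 1#

    constant : ∀ x → E μ (λ _ → x) ≈ x
    constant x = begin-equality
      E μ (λ _ → x)       ≈⟨ E-cong μ (λ _ → sym (*-identityʳ x)) ⟩
      E μ (λ _ → x * 1#)  ≈⟨ E-*ˡ μ x _ ⟩
      x * E μ (λ _ → 1#)  ≈⟨ *-congˡ mass ⟩
      x * 1#              ≈⟨ *-identityʳ x ⟩
      x                   ∎

    nonNegative : ∀ {f} → (∀ a → 0# ≤ f a) → 0# ≤ E μ f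
    nonNegative 0≤f = ≤-respˡ-≈ (E-0 μ) (mono 0≤f)

  open IsProbability public

  return-isProbability : ∀ (a : A) → IsProbability (return a)
  return-isProbability a = record
    { mono  = λ {f} {g} f≤g → ≤-respˡ-≈ (sym (E-return a f))
      (≤-respʳ-≈ (sym (E-return a g)) (f≤g a))
    ; mass = E-return a _
    }

  >>=-isProbability : ∀ {μ : Dist A} {κ : A → Dist B} → IsProbability μ →
    (∀ a → IsProbability (κ a)) →
    IsProbability (μ >>= κ)
  >>=-isProbability {μ = μ} {κ} pμ pκ = record
    { mono  = λ {f} {g} f≤g → ≤-respˡ-≈ (sym (E->>= μ κ f)) (≤-respʳ-≈ (sym (E->>= μ κ g))
                (mono pμ (λ a → mono (pκ a) f≤g)))
    ; mass = trans (E->>= μ κ _) (trans (E-cong μ (λ a → mass (pκ a))) (mass pμ))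
    }

  independently-isProbability : ∀ {μ : Fin n → Dist A} → (∀ i → IsProbability (μ i)) →
    IsProbability (independently μ)
  independently-isProbability {n = zero}  p = return-isProbability []
  independently-isProbability {n = suc n} p = >>=-isProbability (p Fin.zero) λ a →
    >>=-isProbability (independently-isProbability (p ∘ Fin.suc)) λ as →
      return-isProbability (a ∷ as)

  joint : ∀ {k} {X : Fin k → Set} → (∀ j → Dist (X j)) → Dist (Tuple k X)
  joint {zero}  μ = return Unit.tt
  joint {suc k} μ = do
    a  ← μ Fin.zero
    as ← joint (μ ∘ Fin.suc)
    return (a , as)

  E-joint : ∀ {X : Fin (suc k) → Set} (μ : ∀ j → Dist (X j)) f →
    E (joint μ) f ≈ E (μ Fin.zero) λ a → E (joint (λ j → μ (Fin.suc j))) λ as → f (a , as)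
  E-joint μ f = trans (E->>= (μ Fin.zero) _ f) (E-cong (μ Fin.zero) λ a →
    E->>=-return (joint (λ j → μ (Fin.suc j))) (a ,_) f)

  joint-isProbability : ∀ {X : Fin k → Set} {μ : ∀ j → Dist (X j)} → (∀ j → IsProbability (μ j)) →
    IsProbability (joint μ)
  joint-isProbability {k = zero}  p = return-isProbability Unit.tt
  joint-isProbability {k = suc k} p = >>=-isProbability (p Fin.zero) λ a →
    >>=-isProbability (joint-isProbability (λ j → p (Fin.suc j))) λ as →
      return-isProbability (a , as)

  joint-∏ : ∀ {X : Fin k → Set} (μ : ∀ j → Dist (X j)) (g : ∀ j → X j → ℝ) →
    E (joint μ) (λ d → ∏ (λ j → g j (get d j))) ≈ ∏ (λ j → E (μ j) (g j))
  joint-∏ {k = zero}  μ g = E-return Unit.tt _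
  joint-∏ {k = suc k} {X} μ g = begin-equality
    E (joint μ) (λ d → ∏ (λ j → g j (get {X = X} d j)))
      ≈⟨ E-joint μ _ ⟩
    E (μ Fin.zero) (λ a → E (joint μ′) λ as → g Fin.zero a * ∏ (λ j → g (Fin.suc j) (get as j)))
      ≈⟨ E-cong (μ Fin.zero) (λ a → E-*ˡ (joint μ′) (g Fin.zero a) _) ⟩
    E (μ Fin.zero) (λ a → g Fin.zero a * E (joint μ′) λ as → ∏ (λ j → g (Fin.suc j) (get as j)))
      ≈⟨ E-*ʳ (μ Fin.zero) (g Fin.zero) _ ⟩
    E (μ Fin.zero) (g Fin.zero) * E (joint μ′) (λ as → ∏ (λ j → g (Fin.suc j) (get as j)))
      ≈⟨ *-congˡ (joint-∏ μ′ (λ j → g (Fin.suc j))) ⟩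
    ∏ (λ j → E (μ j) (g j)) ∎
    where μ′ = λ j → μ (Fin.suc j)

  joint-marginal : ∀ {X : Fin k → Set} {μ : ∀ j → Dist (X j)} → (∀ j → IsProbability (μ j)) →
    ∀ j (g : X j → ℝ) → E (joint μ) (λ d → g (get d j)) ≈ E (μ j) g
  joint-marginal {μ = μ} p Fin.zero g = trans (E-joint μ _) (E-cong (μ Fin.zero) λ a →
    constant (joint-isProbability (λ j → p (Fin.suc j))) (g a))
  joint-marginal {μ = μ} p (Fin.suc j) g = trans (E-joint μ _)
    (trans (constant (p Fin.zero) _) (joint-marginal (λ j → p (Fin.suc j)) j g))

  -- Independence of coordinate `e` from the rest, for an `H` whose vector argument is insensitive
  -- to that coordinate. The whole vector is redrawn, including the stale entry at `e`, which keeps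
  -- the product distribution intact instead of deleting a coordinate.
  resample : ∀ {μ : Fin n → Dist A} → (∀ i → IsProbability (μ i)) → ∀ e (H : A → Vec A n → ℝ) →
    (∀ b v v′ → AgreeOff e v v′ → H b v ≈ H b v′) →
    E (independently μ) (λ v → H (lookup v e) v) ≈ E (μ e) λ b → E (independently μ) (H b)
  resample {n = suc n} {μ = μ} p Fin.zero H inv = begin-equality
    E (independently μ) (λ v → H (lookup v Fin.zero) v)
      ≈⟨ E-independently μ _ ⟩
    E μ₀ (λ b → E μ′ λ v → H b (b ∷ v))
      ≈⟨ E-cong μ₀ (λ b → begin-equality
           -- A dummy draw `a` is added for coordinate zero, and `inv` then lets it replace `b`
           -- inside the vector.
           E μ′ (λ v → H b (b ∷ v))                 ≈⟨ constant (p Fin.zero) _ ⟨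
           E μ₀ (λ a → E μ′ λ v → H b (b ∷ v))
             ≈⟨ E-cong μ₀ (λ a → E-cong μ′ (λ v → inv b (b ∷ v) (a ∷ v) (agree a b v))) ⟩
           E μ₀ (λ a → E μ′ λ v → H b (a ∷ v))      ≈⟨ E-independently μ (H b) ⟨
           E (independently μ) (H b)                ∎) ⟩
    E μ₀ (λ b → E (independently μ) (H b)) ∎
    where
    μ₀ = μ Fin.zero
    μ′ = independently (μ ∘ Fin.suc)
    agree : ∀ a b v → AgreeOff Fin.zero (b ∷ v) (a ∷ v)
    agree a b v Fin.zero    i≢e = contradiction ≡.refl i≢e
    agree a b v (Fin.suc i) i≢e = ≡.refl
  resample {n = suc n} {μ = μ} p (Fin.suc e) H inv = begin-equality
    E (independently μ) (λ v → H (lookup v (Fin.suc e)) v)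
      ≈⟨ E-independently μ _ ⟩
    E μ₀ (λ a → E μ′ λ v → H (lookup v e) (a ∷ v))
      ≈⟨ E-cong μ₀ (λ a → resample (p ∘ Fin.suc) e (λ b v → H b (a ∷ v))
           (λ b v v′ agree → inv b (a ∷ v) (a ∷ v′) (extend a v v′ agree))) ⟩
    E μ₀ (λ a → E (μ (Fin.suc e)) λ b → E μ′ λ v → H b (a ∷ v))
      ≈⟨ E-comm μ₀ (μ (Fin.suc e)) _ ⟩
    E (μ (Fin.suc e)) (λ b → E μ₀ λ a → E μ′ λ v → H b (a ∷ v))
      ≈⟨ E-cong (μ (Fin.suc e)) (λ b → E-independently μ (H b)) ⟨
    E (μ (Fin.suc e)) (λ b → E (independently μ) (H b)) ∎
    where
    μ₀ = μ Fin.zero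
    μ′ = independently (μ ∘ Fin.suc)
    extend : ∀ a v v′ → AgreeOff e v v′ → AgreeOff (Fin.suc e) (a ∷ v) (a ∷ v′)
    extend a v v′ agree Fin.zero    i≢e = ≡.refl
    extend a v v′ agree (Fin.suc i) i≢e = agree i (i≢e ∘ ≡.cong Fin.suc)

  joint-resample : ∀ {Y : Fin k → Set} {μ : ∀ j → Fin n → Dist (Y j)} →
    (∀ j i → IsProbability (μ j i)) →
    ∀ e (H : Tuple k Y → Tuple k (λ j → Vec (Y j) n) → ℝ) →
    (∀ d C C′ → (∀ j → AgreeOff e (get C j) (get C′ j)) → H d C ≈ H d C′) →
    E (joint (λ j → independently (μ j))) (λ C → H (readAt e C) C) ≈
    E (joint (λ j → μ j e)) λ d → E (joint (λ j → independently (μ j))) (H d)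
  joint-resample {k = zero}  p e H inv =
    trans (E-return Unit.tt _) (sym (trans (E-return Unit.tt _) (E-return Unit.tt _)))
  joint-resample {k = suc k} {Y = Y} {μ = μ} p e H inv = begin-equality
    E (joint (λ j → independently (μ j))) (λ C → H (readAt {Y = Y} e C) C)
      ≈⟨ E-joint (λ j → independently (μ j)) _ ⟩
    E μ₀ (λ v → E μ′ λ C → H (lookup v e , readAt e C) (v , C))
      ≈⟨ E-cong μ₀ (λ v → joint-resample (λ j → p (Fin.suc j)) e
           (λ d C → H (lookup v e , d) (v , C))
           (λ d C C′ agree → inv _ _ _ (λ { Fin.zero i i≢e → ≡.refl ; (Fin.suc j) → agree j }))) ⟩
    E μ₀ (λ v → E ν′ λ d → E μ′ λ C → H (lookup v e , d) (v , C))
      ≈⟨ resample (p Fin.zero) e (λ a v → E ν′ λ d → E μ′ λ C → H (a , d) (v , C))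
           (λ a v v′ agree → E-cong ν′ λ d → E-cong μ′ λ C →
             inv _ _ _ (λ { Fin.zero → agree ; (Fin.suc j) i i≢e → ≡.refl })) ⟩
    E (μ Fin.zero e) (λ a → E μ₀ λ v → E ν′ λ d → E μ′ λ C → H (a , d) (v , C))
      ≈⟨ E-cong (μ Fin.zero e) (λ a → E-comm μ₀ ν′ _) ⟩
    E (μ Fin.zero e) (λ a → E ν′ λ d → E μ₀ λ v → E μ′ λ C → H (a , d) (v , C))
      ≈⟨ E-cong (μ Fin.zero e) (λ a → E-cong ν′ λ d →
           E-joint (λ j → independently (μ j)) (H (a , d))) ⟨
    E (μ Fin.zero e) (λ a → E ν′ λ d → E (joint (λ j → independently (μ j))) (H (a , d)))
      ≈⟨ E-joint (λ j → μ j e) _ ⟨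
    E (joint (λ j → μ j e)) (λ d → E (joint (λ j → independently (μ j))) (H d)) ∎
    where
    μ₀ = independently (μ Fin.zero)
    μ′ = joint (λ j → independently (μ (Fin.suc j)))
    ν′ = joint (λ j → μ (Fin.suc j) e)

  -- The scheme draws each family of controllers internally and returns only outputs; the analysis
  -- needs the controllers themselves, drawn jointly in advance.
  E-independently-map : ∀ {X : Fin k → Set} (μ : ∀ j → Dist (X j)) (g : ∀ j → X j → B) f →
    E (independently (λ j → μ j >>= λ c → return (g j c))) f ≈
    E (joint μ) (λ C → f (Vec.tabulate (λ j → g j (get C j))))
  E-independently-map {k = zero}  μ g f = refl
  E-independently-map {k = suc k} {X = X} μ g f = begin-equality
    E (independently (λ j → μ j >>= λ c → return (g j c))) f
      ≈⟨ E-independently (λ j → μ j >>= λ c → return (g j c)) f ⟩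
    E (μ Fin.zero >>= λ c → return (g Fin.zero c)) (λ s → rest (λ v → f (s ∷ v)))
      ≈⟨ E->>=-return (μ Fin.zero) (g Fin.zero) _ ⟩
    E (μ Fin.zero) (λ c → rest (λ v → f (g Fin.zero c ∷ v)))
      ≈⟨ E-cong (μ Fin.zero) (λ c → E-independently-map (λ j → μ (Fin.suc j)) (λ j → g (Fin.suc j))
           (λ v → f (g Fin.zero c ∷ v))) ⟩
    E (μ Fin.zero) (λ c → E (joint (λ j → μ (Fin.suc j))) λ C →
      f (g Fin.zero c ∷ Vec.tabulate (λ j → g (Fin.suc j) (get C j))))
      ≈⟨ E-joint μ _ ⟨
    E (joint μ) (λ C → f (Vec.tabulate (λ j → g j (get {X = X} C j)))) ∎
    where
    rest : (Vec _ k → ℝ) → ℝ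
    rest = E (independently (λ j → μ (Fin.suc j) >>= λ c → return (g (Fin.suc j) c)))

  -- k processes read the same bits A and private data Cⱼ; an element not
  -- yet read is independent of the states reached so far, so its data may
  -- be drawn only when it is processed.
  module Unrolling {n k : ℕ} {Y State : Fin k → Set}
    (step : ∀ j → Fin n → Bool → Y j → State j → State j)
    (α : Fin n → Dist Bool) (μ : ∀ j → Fin n → Dist (Y j))
    (pα : ∀ i → IsProbability (α i)) (pμ : ∀ j i → IsProbability (μ j i))
    (V : (∀ j → State j) → ℝ) (V-cong : ∀ {s s′} → (∀ j → s j ≡ s′ j) → V s ≈ V s′) where

    run : ∀ j → List (Fin n) → Vec Bool n → Vec (Y j) n → State j → State j
    run j []      A C s = s
    run j (e ∷ l) A C s = run j l A C (step j e (lookup A e) (lookup C e) s)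

    sequential : List (Fin n) → (∀ j → State j) → ℝ
    sequential []      s = V s
    sequential (e ∷ l) s = E (α e) λ b → E (joint (λ j → μ j e)) λ d →
      sequential l (λ j → step j e b (get d j) (s j))

    run-AgreeOff : ∀ j {e l A A′ C C′} → ListAll (e ≢_) l → AgreeOff e A A′ → AgreeOff e C C′ →
      ∀ s →
      run j l A C s ≡ run j l A′ C′ s
    run-AgreeOff j [] a c s = ≡.refl
    run-AgreeOff j {l = i ∷ l} {A} {A′} {C} {C′} (e≢i ∷ e∉l) a c s
      rewrite a i (e≢i ∘ ≡.sym) | c i (e≢i ∘ ≡.sym) = run-AgreeOff j e∉l a c _

    -- In a repetition-free order the coordinate read at the head is never read again, so
    -- `run-AgreeOff` provides the insensitivity that resampling demands. The common bit is
    -- extracted first, then the private data of all `k` processes together.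
    unroll : ∀ {l} → ListUnique l → ∀ s →
      E (independently α) (λ A → E (joint (λ j → independently (μ j))) λ C →
        V (λ j → run j l A (get C j) (s j)))
        ≈ sequential l s
    unroll [] s = trans (E-cong (independently α)
      (λ A → constant (joint-isProbability (λ j → independently-isProbability (pμ j))) (V s)))
                        (constant (independently-isProbability pα) (V s))
    unroll {e ∷ l} (e∉l ∷ l!) s = begin-equality
      E 𝔸 (λ A → E ℂ λ C → V (λ j → run j l A (get C j)
        (step j e (lookup A e) (lookup (get C j) e) (s j))))
        ≈⟨ E-cong 𝔸 (λ A → E-cong ℂ λ C → V-cong (λ j →
             ≡.cong (λ d → run j l A (get C j) (step j e (lookup A e) d (s j)))
               (≡.sym (get-readAt e C j)))) ⟩
      E 𝔸 (λ A → E ℂ λ C → V (λ j → run j l A (get C j)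
        (step j e (lookup A e) (get (readAt e C) j) (s j))))
        ≈⟨ resample pα e (λ b A → E ℂ λ C →
             V (λ j → run j l A (get C j) (step j e b (get (readAt e C) j) (s j))))
             (λ b A A′ agree → E-cong ℂ λ C → V-cong λ j →
               run-AgreeOff j e∉l agree (λ _ _ → ≡.refl) _) ⟩
      E (α e) (λ b → E 𝔸 λ A → E ℂ λ C →
        V (λ j → run j l A (get C j) (step j e b (get (readAt e C) j) (s j))))
        ≈⟨ E-cong (α e) (λ b → E-cong 𝔸 λ A →
             joint-resample pμ e (λ d C → V
               (λ j → run j l A (get C j) (step j e b (get d j) (s j))))
               (λ d C C′ agree → V-cong λ j → run-AgreeOff j e∉l (λ _ _ → ≡.refl) (agree j) _)) ⟩
      E (α e) (λ b → E 𝔸 λ A → E 𝔻 λ d → E ℂ λ C →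
        V (λ j → run j l A (get C j) (step j e b (get d j) (s j))))
        ≈⟨ E-cong (α e) (λ b → E-comm 𝔸 𝔻 _) ⟩
      E (α e) (λ b → E 𝔻 λ d → E 𝔸 λ A → E ℂ λ C →
        V (λ j → run j l A (get C j) (step j e b (get d j) (s j))))
        ≈⟨ E-cong (α e) (λ b → E-cong 𝔻 λ d → unroll l! (λ j → step j e b (get d j) (s j))) ⟩
      sequential (e ∷ l) s ∎
      where
      𝔸 = independently α
      ℂ = joint (λ j → independently (μ j))
      𝔻 = joint (λ j → μ j e)

-- Repetition-free words as draws without replacement

remove : ∀ {n} → Subset n → Fin n → Subset n
remove U e = U [ e ]≔ false

∣remove∣ : ∀ {n} (U : Subset n) e → lookup U e ≡ true → suc ∣ remove U e ∣ ≡ ∣ U ∣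
∣remove∣ (true  ∷ U) Fin.zero    eq = ≡.refl
∣remove∣ (true  ∷ U) (Fin.suc e) eq = ≡.cong suc (∣remove∣ U e eq)
∣remove∣ (false ∷ U) (Fin.suc e) eq = ∣remove∣ U e eq

∣U∣≡0⇒empty : ∀ {n} (U : Subset n) → ∣ U ∣ ≡ 0 → ∀ e → lookup U e ≡ false
∣U∣≡0⇒empty (false ∷ U) eq Fin.zero    = ≡.refl
∣U∣≡0⇒empty (false ∷ U) eq (Fin.suc e) = ∣U∣≡0⇒empty U eq e

-- A Boolean test for repetition-free words over `U` that shrinks the set of available elements
-- letter by letter, so its indicator factors in the same way as a sequential draw.
drawnFrom : ∀ {n m} → Subset n → Vec (Fin n) m → Bool
drawnFrom U []      = true
drawnFrom U (e ∷ w) = lookup U e ∧ drawnFrom (remove U e) w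

∈-remove : ∀ {n} (U : Subset n) {e i} → lookup (remove U e) i ≡ true → e ≢ i × lookup U i ≡ true
∈-remove U {e} {i} i∈ with e Fin.≟ i
... | yes ≡.refl = contradiction (≡.trans (≡.sym (Vec.lookup∘update e U false)) i∈) λ ()
... | no  e≢i    = e≢i , ≡.trans (≡.sym (Vec.lookup∘update′ (e≢i ∘ ≡.sym) U false)) i∈

drawnFrom-sound : ∀ {n m} U (w : Vec (Fin n) m) → drawnFrom U w ≡ true →
  Unique w × All (λ i → lookup U i ≡ true) w
drawnFrom-sound U []      _  = [] , []
drawnFrom-sound U (e ∷ w) eq with lookup U e in e∈U
... | true = let (w! , w⊆) = drawnFrom-sound (remove U e) w eq in
  VecAll.map (proj₁ ∘ ∈-remove U) w⊆ ∷ w! , e∈U ∷ VecAll.map (proj₂ ∘ ∈-remove U) w⊆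

drawnFrom-complete : ∀ {n m} U {w : Vec (Fin n) m} → Unique w → All (λ i → lookup U i ≡ true) w →
  drawnFrom U w ≡ true
drawnFrom-complete U []         []          = ≡.refl
drawnFrom-complete U {e ∷ w} (e∉w ∷ w!) (e∈U ∷ w⊆U) rewrite e∈U =
  drawnFrom-complete (remove U e) w! (VecAll.map keep (VecAll.zip (e∉w , w⊆U)))
  where
  keep : ∀ {i} → e ≢ i × lookup U i ≡ true → lookup (remove U e) i ≡ true
  keep (e≢i , i∈U) = ≡.trans (Vec.lookup∘update′ (e≢i ∘ ≡.sym) U false) i∈U

unique?≡drawnFrom : ∀ {n m} (w : Vec (Fin n) m) → does (unique? w) ≡ drawnFrom ⊤ w
unique?≡drawnFrom w with unique? w
... | yes w! = ≡.sym (drawnFrom-complete ⊤ w! (all⊤ w))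
  where
  all⊤ : ∀ {n m} (w : Vec (Fin n) m) → All (λ i → lookup ⊤ i ≡ true) w
  all⊤ []      = []
  all⊤ (e ∷ w) = Vec.lookup-replicate e true ∷ all⊤ w
... | no ¬w! with drawnFrom ⊤ w in eq
...   | true  = contradiction (proj₁ (drawnFrom-sound ⊤ w eq)) ¬w!
...   | false = ≡.refl

toList-unique : ∀ {n m} {w : Vec (Fin n) m} → Unique w → ListUnique (Vec.toList w)
toList-unique []         = []
toList-unique (e∉w ∷ w!) = VecAll.toList⁺ e∉w ∷ toList-unique w!

-- Uniformly random orders

module RandomOrder {c ℓ₁ ℓ₂} (R : Reals c ℓ₁ ℓ₂) where
  open OrderedField R
  open Expectation R
  open Probability {{R}}
  open PartialOrderReasoning poset

  private variable
    A B : Set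
    n : ℕ

  ∑ : List A → (A → ℝ) → ℝ
  ∑ []       f = 0#
  ∑ (a ∷ as) f = f a + ∑ as f

  ∑-cong : ∀ (as : List A) {f g} → (∀ a → f a ≈ g a) → ∑ as f ≈ ∑ as g
  ∑-cong []       h = refl
  ∑-cong (a ∷ as) h = +-cong (h a) (∑-cong as h)

  ∑-++ : ∀ (as bs : List A) f → ∑ (as ++ bs) f ≈ ∑ as f + ∑ bs f
  ∑-++ []       bs f = sym (+-identityˡ _)
  ∑-++ (a ∷ as) bs f = trans (+-congˡ (∑-++ as bs f)) (sym (+-assoc _ _ _))

  ∑-map : ∀ (g : A → B) as f → ∑ (List.map g as) f ≈ ∑ as (λ a → f (g a))
  ∑-map g []       f = refl
  ∑-map g (a ∷ as) f = +-congˡ (∑-map g as f)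

  ∑-filter : ∀ {p} {P : Pred A p} (P? : Decidable P) as f →
    ∑ (List.filter P? as) f ≈ ∑ as (λ a → ⟦ does (P? a) ⟧ * f a)
  ∑-filter P? []       f = refl
  ∑-filter P? (a ∷ as) f with P? a
  ... | yes _ = +-cong (sym (*-identityˡ _)) (∑-filter P? as f)
  ... | no  _ = trans (∑-filter P? as f) (trans (sym (+-identityˡ _)) (+-congʳ (sym (zeroˡ _))))

  ∑-tabulate : ∀ (g : Fin n → A) f → ∑ (List.tabulate g) f ≈ sum (λ i → f (g i))
  ∑-tabulate {n = zero}  g f = refl
  ∑-tabulate {n = suc n} g f = +-congˡ (∑-tabulate (g ∘ Fin.suc) f)

  ∑-1 : ∀ (as : List A) → ∑ as (λ _ → 1#) ≈ fromℕ (List.length as)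
  ∑-1 []       = refl
  ∑-1 (a ∷ as) = +-congˡ (∑-1 as)

  E-uniform : ∀ (as : List A) f → E (uniform as) f ≈ fromℕ (List.length as) ⁻¹ * ∑ as f
  E-uniform as f = go as
    where
    p = fromℕ (List.length as) ⁻¹
    go : ∀ bs → E (List.map (λ b → p , b) bs) f ≈ p * ∑ bs f
    go []       = sym (zeroʳ p)
    go (b ∷ bs) = trans (+-congˡ (go bs)) (sym (distribˡ p _ _))

  -- The unnormalised form of drawing `m` elements one at a time without replacement. No division
  -- occurs during the recursion; one division by the number of orders is made at the end.
  ∑-drawn : ∀ m → Subset n → (Vec (Fin n) m → ℝ) → ℝ
  ∑-drawn zero    U f = f []
  ∑-drawn (suc m) U f = sum (λ e → ⟦ lookup U e ⟧ * ∑-drawn m (remove U e) (λ w → f (e ∷ w)))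

  ∑-*ˡ : ∀ x (as : List A) f → ∑ as (λ a → x * f a) ≈ x * ∑ as f
  ∑-*ˡ x []       f = sym (zeroʳ x)
  ∑-*ˡ x (a ∷ as) f = trans (+-congˡ (∑-*ˡ x as f)) (sym (distribˡ x _ _))

  ∑-product : ∀ {C : Set} (g : A → B → C) as bs f →
    ∑ (List.cartesianProductWith g as bs) f ≈ ∑ as (λ a → ∑ bs (λ b → f (g a b)))
  ∑-product g []       bs f = refl
  ∑-product g (a ∷ as) bs f = trans (∑-++ (List.map (g a) bs) _ f)
    (+-cong (∑-map (g a) bs f) (∑-product g as bs f))

  ∑-words : ∀ m (U : Subset n) f → ∑ (words n m) (λ w → ⟦ drawnFrom U w ⟧ * f w) ≈ ∑-drawn m U f
  ∑-words         zero    U f = trans (+-identityʳ _) (*-identityˡ _)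
  ∑-words {n = n} (suc m) U f = begin-equality
    ∑ (words n (suc m)) (λ w → ⟦ drawnFrom U w ⟧ * f w)
      ≈⟨ ∑-product _∷_ (List.allFin n) (words n m) _ ⟩
    ∑ (List.allFin n) (λ e → ∑ (words n m)
      (λ w → ⟦ lookup U e ∧ drawnFrom (remove U e) w ⟧ * f (e ∷ w)))
      ≈⟨ ∑-tabulate {n = n} id _ ⟩
    sum (λ e → ∑ (words n m) (λ w → ⟦ lookup U e ∧ drawnFrom (remove U e) w ⟧ * f (e ∷ w)))
      ≈⟨ sum-cong-≋ (λ e → begin-equality
           ∑ (words n m) (λ w → ⟦ lookup U e ∧ drawnFrom (remove U e) w ⟧ * f (e ∷ w))
             ≈⟨ ∑-cong (words n m) (λ w → trans (*-congʳ (⟦∧⟧ (lookup U e) _)) (*-assoc _ _ _)) ⟩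
           ∑ (words n m) (λ w → ⟦ lookup U e ⟧ * (⟦ drawnFrom (remove U e) w ⟧ * f (e ∷ w)))
             ≈⟨ ∑-*ˡ ⟦ lookup U e ⟧ (words n m) _ ⟩
           ⟦ lookup U e ⟧ * ∑ (words n m) (λ w → ⟦ drawnFrom (remove U e) w ⟧ * f (e ∷ w))
             ≈⟨ *-congˡ (∑-words m (remove U e) (λ w → f (e ∷ w))) ⟩
           ⟦ lookup U e ⟧ * ∑-drawn m (remove U e) (λ w → f (e ∷ w)) ∎) ⟩
    ∑-drawn (suc m) U f ∎

  ∑-orderings : ∀ n f → ∑ (orderings n) f ≈ ∑-drawn n ⊤ f
  ∑-orderings n f = begin-equality
    ∑ (orderings n) f                                      ≈⟨ ∑-filter unique? (words n n) f ⟩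
    ∑ (words n n) (λ w → ⟦ does (unique? w) ⟧ * f w)
      ≈⟨ ∑-cong (words n n) (λ w → reflexive (≡.cong (λ b → ⟦ b ⟧ * f w) (unique?≡drawnFrom w))) ⟩
    ∑ (words n n) (λ w → ⟦ drawnFrom ⊤ w ⟧ * f w)          ≈⟨ ∑-words n ⊤ f ⟩
    ∑-drawn n ⊤ f                                          ∎

  ∑-orderings-cong : ∀ n {f g} → (∀ w → Unique w → f w ≈ g w) →
    ∑ (orderings n) f ≈ ∑ (orderings n) g
  ∑-orderings-cong n {f} {g} h = begin-equality
    ∑ (orderings n) f                                      ≈⟨ ∑-filter unique? (words n n) f ⟩
    ∑ (words n n) (λ w → ⟦ does (unique? w) ⟧ * f w)       ≈⟨ ∑-cong (words n n) on-unique ⟩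
    ∑ (words n n) (λ w → ⟦ does (unique? w) ⟧ * g w)       ≈⟨ ∑-filter unique? (words n n) g ⟨
    ∑ (orderings n) g                                      ∎
    where
    on-unique : ∀ w → ⟦ does (unique? w) ⟧ * f w ≈ ⟦ does (unique? w) ⟧ * g w
    on-unique w with unique? w
    ... | yes w! = *-congˡ (h w w!)
    ... | no  _  = trans (zeroˡ _) (sym (zeroˡ _))

  sum-⟦⟧ : ∀ (U : Subset n) → sum (λ e → ⟦ lookup U e ⟧) ≈ fromℕ ∣ U ∣
  sum-⟦⟧ []          = refl
  sum-⟦⟧ (true  ∷ U) = +-congˡ (sum-⟦⟧ U)
  sum-⟦⟧ (false ∷ U) = trans (+-identityˡ _) (sum-⟦⟧ U)

  *-on-U : ∀ (U : Subset n) e {x y} → (lookup U e ≡ true → x ≈ y) →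
    ⟦ lookup U e ⟧ * x ≈ ⟦ lookup U e ⟧ * y
  *-on-U U e h with lookup U e
  ... | true  = *-congˡ (h ≡.refl)
  ... | false = trans (zeroˡ _) (sym (zeroˡ _))

  *-on-U-≤ : ∀ (U : Subset n) e {x y} → (lookup U e ≡ true → x ≤ y) →
    ⟦ lookup U e ⟧ * x ≤ ⟦ lookup U e ⟧ * y
  *-on-U-≤ U e h with lookup U e
  ... | true  = *-monoˡ-≤ 0≤1 (h ≡.refl)
  ... | false = ≤-reflexive (trans (zeroˡ _) (sym (zeroˡ _)))

  ∑-drawn-1 : ∀ m (U : Subset n) → ∣ U ∣ ≡ m → ∑-drawn m U (λ _ → 1#) ≈ fromℕ (m !)
  ∑-drawn-1 zero    U eq = sym (+-identityʳ 1#)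
  ∑-drawn-1 (suc m) U eq = begin-equality
    sum (λ e → ⟦ lookup U e ⟧ * ∑-drawn m (remove U e) (λ _ → 1#))
      ≈⟨ sum-cong-≋ (λ e → *-on-U U e (λ e∈U →
           ∑-drawn-1 m (remove U e) (ℕ.suc-injective (≡.trans (∣remove∣ U e e∈U) eq)))) ⟩
    sum (λ e → ⟦ lookup U e ⟧ * fromℕ (m !))
      ≈⟨ *-distribʳ-sum (fromℕ (m !)) (λ e → ⟦ lookup U e ⟧) ⟨
    sum (λ e → ⟦ lookup U e ⟧) * fromℕ (m !)
      ≈⟨ *-congʳ (trans (sum-⟦⟧ U) (reflexive (≡.cong fromℕ eq))) ⟩
    fromℕ (suc m) * fromℕ (m !)
      ≈⟨ fromℕ-* (suc m) (m !) ⟨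
    fromℕ (suc m !) ∎

  -- The orders are counted by summing 1 over draws without replacement; only the image of their
  -- number in the field is needed.
  length-orderings : ∀ n → fromℕ (List.length (orderings n)) ≈ fromℕ (n !)
  length-orderings n = trans (sym (∑-1 (orderings n)))
    (trans (∑-orderings n _) (∑-drawn-1 n ⊤ (Subset.∣⊤∣≡n n)))

  length≉0 : ∀ n → ¬ (fromℕ (List.length (orderings n)) ≈ 0#)
  length≉0 n eq = fromℕ≉0 (n !) {{ℕ._!≢0 n}} (trans (sym (length-orderings n)) eq)

  0≤length⁻¹ : ∀ n → 0# ≤ fromℕ (List.length (orderings n)) ⁻¹
  0≤length⁻¹ n = 0≤⁻¹ (0≤fromℕ (List.length (orderings n))) (length≉0 n)

  ∑-mono : ∀ (as : List A) {f g} → (∀ a → f a ≤ g a) → ∑ as f ≤ ∑ as g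
  ∑-mono []       h = ≤-refl
  ∑-mono (a ∷ as) h = +-mono-≤ (h a) (∑-mono as h)

  orderings-isProbability : ∀ n → IsProbability (uniform (orderings n))
  orderings-isProbability n = record
    { mono = λ {f} {g} f≤g → ≤-respˡ-≈ (sym (E-uniform (orderings n) f))
      (≤-respʳ-≈ (sym (E-uniform (orderings n) g))
               (*-monoˡ-≤ (0≤length⁻¹ n) (∑-mono (orderings n) f≤g)))
    ; mass = trans (E-uniform (orderings n) _) (trans (*-congˡ (∑-1 (orderings n)))
               (trans (*-comm _ _) (⁻¹-inverse (length≉0 n))))
    }

  E-∑-drawn : ∀ m (U : Subset n) (μ : Dist A) (f : A → Vec (Fin n) m → ℝ) →
    ∑-drawn m U (λ w → E μ (λ a → f a w)) ≈ E μ (λ a → ∑-drawn m U (f a))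
  E-∑-drawn zero    U μ f = refl
  E-∑-drawn (suc m) U μ f = begin-equality
    sum (λ e → ⟦ lookup U e ⟧ * ∑-drawn m (remove U e) (λ w → E μ (λ a → f a (e ∷ w))))
      ≈⟨ sum-cong-≋ (λ e → *-congˡ (E-∑-drawn m (remove U e) μ (λ a w → f a (e ∷ w)))) ⟩
    sum (λ e → ⟦ lookup U e ⟧ * E μ (λ a → ∑-drawn m (remove U e) (λ w → f a (e ∷ w))))
      ≈⟨ sum-cong-≋ (λ e → sym (E-*ˡ μ ⟦ lookup U e ⟧ _)) ⟩
    sum (λ e → E μ (λ a → ⟦ lookup U e ⟧ * ∑-drawn m (remove U e) (λ w → f a (e ∷ w))))
      ≈⟨ E-sum μ (λ e a → ⟦ lookup U e ⟧ * ∑-drawn m (remove U e) (λ w → f a (e ∷ w))) ⟨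
    E μ (λ a → ∑-drawn (suc m) U (f a)) ∎

  -- step-Φ says that Φ is a supermartingale along a uniformly random order,
  -- U being the set of elements not yet read.
  module Supermartingale {n k : ℕ} {Y State : Fin k → Set}
    (step : ∀ j → Fin n → Bool → Y j → State j → State j)
    (α : Fin n → Dist Bool) (μ : ∀ j → Fin n → Dist (Y j))
    (pα : ∀ i → IsProbability (α i)) (pμ : ∀ j i → IsProbability (μ j i))
    (V : (∀ j → State j) → ℝ) (V-cong : ∀ {s s′} → (∀ j → s j ≡ s′ j) → V s ≈ V s′)
    (Inv : (∀ j → State j) → Set)
    (step-Inv : ∀ {s} → Inv s → ∀ e b (d : Tuple k Y) → Inv (λ j → step j e b (get d j) (s j)))
    (Φ : Subset n → (∀ j → State j) → ℝ)
    (V≤Φ : ∀ U {s} → Inv s → (∀ e → lookup U e ≡ false) → V s ≤ Φ U s)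
    (step-Φ : ∀ U {s} → Inv s →
      sum (λ e → ⟦ lookup U e ⟧ * E (α e) λ b → E (joint (λ j → μ j e)) λ d →
        Φ (remove U e) (λ j → step j e b (get d j) (s j))) ≤ sum (λ e → ⟦ lookup U e ⟧) * Φ U s)
    where

    open Unrolling step α μ pα pμ V V-cong

    -- Of the (m + 1)! orders, m! begin with any given element. The induction hypothesis gives the
    -- factor m!, and `step-Φ`, being stated with a sum over `U` instead of a mean, gives the
    -- remaining factor m + 1.
    ∑-drawn-sequential : ∀ m (U : Subset n) {s} → ∣ U ∣ ≡ m → Inv s →
      ∑-drawn m U (λ w → sequential (Vec.toList w) s) ≤ fromℕ (m !) * Φ U s
    ∑-drawn-sequential zero U {s} eq inv = begin
      V s              ≤⟨ V≤Φ U inv (∣U∣≡0⇒empty U eq) ⟩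
      Φ U s            ≈⟨ *-identityˡ _ ⟨
      1# * Φ U s       ≈⟨ *-congʳ (+-identityʳ 1#) ⟨
      fromℕ 1 * Φ U s  ∎
    ∑-drawn-sequential (suc m) U {s} eq inv = begin
      sum (λ e → ⟦ lookup U e ⟧ * ∑-drawn m (remove U e) (λ w →
        E (α e) λ b → E (𝔻 e) λ d → sequential (Vec.toList w) (next e b d)))
        -- The data of the first element are drawn before the rest of the order is summed, so that
        -- the induction hypothesis meets a fixed next state.
        ≈⟨ sum-cong-≋ (λ e → *-congˡ (trans
             (E-∑-drawn m (remove U e) (α e) _)
             (E-cong (α e) λ b → E-∑-drawn m (remove U e) (𝔻 e) _))) ⟩
      sum (λ e → ⟦ lookup U e ⟧ * E (α e) λ b → E (𝔻 e) λ d →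
        ∑-drawn m (remove U e) (λ w → sequential (Vec.toList w) (next e b d)))
        ≤⟨ sum-mono-≤ (λ e → *-on-U-≤ U e λ e∈U → mono (pα e) λ b →
             mono (joint-isProbability (λ j → pμ j e)) λ d →
             ∑-drawn-sequential m (remove U e) (ℕ.suc-injective (≡.trans (∣remove∣ U e e∈U) eq))
               (step-Inv inv e b d)) ⟩
      sum (λ e → ⟦ lookup U e ⟧ * E (α e) λ b → E (𝔻 e) λ d →
        fromℕ (m !) * Φ (remove U e) (next e b d))
        ≈⟨ sum-cong-≋ (λ e → trans (*-congˡ
             (trans (E-cong (α e) λ b → E-*ˡ (𝔻 e) (fromℕ (m !)) _) (E-*ˡ (α e) (fromℕ (m !)) _)))
             (solve 3 (λ u f x → u :* (f :* x) := f :* (u :* x)) refl _ _ _)) ⟩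
      sum (λ e → fromℕ (m !) * (⟦ lookup U e ⟧ * E (α e) λ b → E (𝔻 e) λ d →
        Φ (remove U e) (next e b d)))
        ≈⟨ *-distribˡ-sum (fromℕ (m !))
             (λ e → ⟦ lookup U e ⟧ * E (α e) λ b → E (𝔻 e) λ d → Φ (remove U e) (next e b d)) ⟨
      fromℕ (m !) * sum (λ e → ⟦ lookup U e ⟧ * E (α e) λ b → E (𝔻 e) λ d →
        Φ (remove U e) (next e b d))
        ≤⟨ *-monoˡ-≤ (0≤fromℕ (m !)) (step-Φ U inv) ⟩
      fromℕ (m !) * (sum (λ e → ⟦ lookup U e ⟧) * Φ U s)
        ≈⟨ *-congˡ (*-congʳ (trans (sum-⟦⟧ U) (reflexive (≡.cong fromℕ eq)))) ⟩
      fromℕ (m !) * (fromℕ (suc m) * Φ U s)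
        ≈⟨ solve 3 (λ a b x → a :* (b :* x) := (b :* a) :* x) refl _ _ _ ⟩
      (fromℕ (suc m) * fromℕ (m !)) * Φ U s
        ≈⟨ *-congʳ (fromℕ-* (suc m) (m !)) ⟨
      fromℕ (suc m !) * Φ U s ∎
      where
      𝔻 : ∀ e → Dist (Tuple k Y)
      𝔻 e = joint (λ j → μ j e)
      next : Fin n → Bool → Tuple k Y → ∀ j → State j
      next e b d j = step j e b (get d j) (s j)

    expectation-≤ : ∀ {s} → Inv s →
      (E (uniform (orderings n)) λ σ → E (independently α) λ A →
        E (joint (λ j → independently (μ j))) λ C →
        V (λ j → run j (Vec.toList σ) A (get C j) (s j))) ≤ Φ ⊤ s
    expectation-≤ {s} inv = begin
      E (uniform (orderings n)) G
        ≈⟨ E-uniform (orderings n) G ⟩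
      N ⁻¹ * ∑ (orderings n) G
        ≈⟨ *-congˡ (∑-orderings-cong n λ w w! → unroll (toList-unique w!) s) ⟩
      N ⁻¹ * ∑ (orderings n) (λ w → sequential (Vec.toList w) s)
        ≈⟨ *-congˡ (∑-orderings n _) ⟩
      N ⁻¹ * ∑-drawn n ⊤ (λ w → sequential (Vec.toList w) s)
        ≤⟨ *-monoˡ-≤ (0≤length⁻¹ n) (∑-drawn-sequential n ⊤ (Subset.∣⊤∣≡n n) inv) ⟩
      N ⁻¹ * (fromℕ (n !) * Φ ⊤ s)
        ≈⟨ *-congˡ (*-congʳ (length-orderings n)) ⟨
      N ⁻¹ * (N * Φ ⊤ s)                                                   ≈⟨ *-assoc _ _ _ ⟨
      (N ⁻¹ * N) * Φ ⊤ s
        ≈⟨ *-congʳ (trans (*-comm _ _) (⁻¹-inverse (length≉0 n))) ⟩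
      1# * Φ ⊤ s                                                           ≈⟨ *-identityˡ _ ⟩
      Φ ⊤ s                                                                ∎
      where
      G : Vec (Fin n) n → ℝ
      G σ = E (independently α) λ A → E (joint (λ j → independently (μ j))) λ C →
        V (λ j → run j (Vec.toList σ) A (get C j) (s j))
      N = fromℕ (List.length (orderings n))

-- Membership bits of subsets

does-∈? : ∀ {n} (e : Fin n) S → does (e Subset.∈? S) ≡ lookup S e
does-∈? e S with e Subset.∈? S
... | yes e∈S = ≡.sym (Vec.[]=⇒lookup e∈S)
... | no  e∉S with lookup S e in eq
...   | true  = contradiction (Vec.lookup⇒[]= e S eq) e∉S
...   | false = ≡.refl

lookup-⊆ : ∀ {n} {p q : Subset n} {f} → p ⊆ q → lookup p f ≡ true → lookup q f ≡ true
lookup-⊆ {p = p} {q} {f} p⊆q f∈p = Vec.[]=⇒lookup (p⊆q (Vec.lookup⇒[]= f p f∈p))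

lookup-∪⁅⁆ : ∀ {n} (J : Subset n) {e f} → f ≢ e → lookup (J ∪ ⁅ e ⁆) f ≡ lookup J f
lookup-∪⁅⁆ J {e} {f} f≢e = Bool.⇔→≡ (mk⇔ to (lookup-⊆ (Subset.p⊆p∪q {p = J} ⁅ e ⁆)))
  where
  to : lookup (J ∪ ⁅ e ⁆) f ≡ true → lookup J f ≡ true
  to f∈ with Subset.x∈p∪q⁻ J ⁅ e ⁆ (Vec.lookup⇒[]= f _ f∈)
  ... | inj₁ f∈J = Vec.[]=⇒lookup f∈J
  ... | inj₂ f∈e = contradiction (Subset.x∈⁅y⁆⇒x≡y e f∈e) f≢e

lookup-delete : ∀ {n} (J : Subset n) {g f} → f ≢ g → lookup (J Subset.- g) f ≡ lookup J f
lookup-delete J {g} {f} f≢g = Bool.⇔→≡ (mk⇔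
  (lookup-⊆ (Subset.p─q⊆p J ⁅ g ⁆))
  (λ f∈J → Vec.[]=⇒lookup (Subset.x∈p∧x≢y⇒x∈p-y (Vec.lookup⇒[]= f J f∈J) f≢g)))

-- Survival and loss in one matroid

module SingleScheme {c ℓ₁ ℓ₂} (R : Reals c ℓ₁ ℓ₂) {n : ℕ} (M : Matroid n) {x : Fin n → Reals.ℝ R}
  (C : Scheme.Choices {{R}} M x) where
  open OrderedField R
  open Expectation R
  open RandomOrder R
  open Probability {{R}}
  open Scheme {{R}} hiding (Choices)
  open Scheme.Choices {{R}} C
  open Scheme.ConvexCombination {{R}} decomposition
  open Scheme.SingleMatroid {{R}} C
  open Matroid M
  open PartialOrderReasoning poset

  indicator≈⟦lookup⟧ : ∀ (S : Subset n) e → indicator S e ≈ ⟦ lookup S e ⟧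
  indicator≈⟦lookup⟧ S e = reflexive (≡.cong ⟦_⟧ (does-∈? e S))

  x≈ : ∀ e → x e ≈ sum (λ i → β i * ⟦ lookup (I i) e ⟧)
  x≈ e = trans (x-decomposed e) (sum-cong-≋ λ i → *-congˡ (indicator≈⟦lookup⟧ (I i) e))

  0≤x : ∀ e → 0# ≤ x e
  0≤x e = ≤-respʳ-≈ (sym (x≈ e)) (sum-nonNegative λ i →
    *-nonNegative (β-nonNeg i) 0≤⟦ lookup (I i) e ⟧)

  x≤1 : ∀ e → x e ≤ 1#
  x≤1 e = begin
    x e                                       ≈⟨ x≈ e ⟩
    sum (λ i → β i * ⟦ lookup (I i) e ⟧)
      ≤⟨ sum-mono-≤ (λ i → ≤-trans (*-monoˡ-≤ (β-nonNeg i) ⟦ lookup (I i) e ⟧≤1)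
           (≤-reflexive (*-identityʳ _))) ⟩
    sum β                                     ≈⟨ β-sum ⟩
    1#                                        ∎

  x≉0⇒0<x : ∀ {e} → ¬ (x e ≈ 0#) → 0# < x e
  x≉0⇒0<x x≉0 = 0≤x _ , λ 0≈x → x≉0 (sym 0≈x)

  controls? : ∀ e i → Dec (e ∈ I i × ¬ (β i ≈ 0#))
  controls? e i = (e Subset.∈? I i) ×-dec ¬? (β i ≟ 0#)

  -- The probability that `i` controls `e`, extended by zero to all indices and to elements without
  -- a controller. Expectations over controllers thus become sums over `Fin m`, which can be
  -- interchanged.
  w : Fin n → Fin m → ℝ
  w e i with 0# <? x e
  ... | no  _ = 0#
  ... | yes _ = ⟦ does (controls? e i) ⟧ * (β i ÷ x e)

  w₀ : Fin n → ℝ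
  w₀ e with 0# <? x e
  ... | no  _ = 1#
  ... | yes _ = 0#

  0≤w₀ : ∀ e → 0# ≤ w₀ e
  0≤w₀ e with 0# <? x e
  ... | no  _ = 0≤1
  ... | yes _ = ≤-refl

  E-pick : ∀ e g → E (pickController e) g ≈ w₀ e * g nothing + sum (λ i → w e i * g (just i))
  E-pick e g with 0# <? x e
  ... | no  _ = +-congˡ (sym (trans (sum-cong-≋ (λ i → zeroˡ (g (just i)))) (sum-replicate-zero m)))
  ... | yes _ = trans (begin-equality
    E (List.map h (List.filter (controls? e) (List.allFin m))) g
      ≈⟨ E-map (List.filter (controls? e) (List.allFin m)) ⟩
    ∑ (List.filter (controls? e) (List.allFin m)) (λ i → β i ÷ x e * g (just i))
      ≈⟨ ∑-filter (controls? e) (List.allFin m) _ ⟩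
    ∑ (List.allFin m) (λ i → ⟦ does (controls? e i) ⟧ * (β i ÷ x e * g (just i)))
      ≈⟨ ∑-tabulate {n = m} id _ ⟩
    sum (λ i → ⟦ does (controls? e i) ⟧ * (β i ÷ x e * g (just i)))
      ≈⟨ sum-cong-≋ {m} (λ i → sym (*-assoc _ _ _)) ⟩
    sum (λ i → ⟦ does (controls? e i) ⟧ * (β i ÷ x e) * g (just i))                         ∎)
    (trans (sym (+-identityˡ _)) (+-congʳ (sym (zeroˡ _))))
    where
    h : Fin m → ℝ × Maybe (Fin m)
    h i = β i ÷ x e , just i
    E-map : ∀ is → E (List.map h is) g ≈ ∑ is (λ i → β i ÷ x e * g (just i))
    E-map []       = refl
    E-map (i ∷ is) = +-congˡ (E-map is)

  0≤w : ∀ e i → 0# ≤ w e i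
  0≤w e i with 0# <? x e
  ... | no  _   = ≤-refl
  ... | yes 0<x = *-nonNegative 0≤⟦ does (controls? e i) ⟧
    (*-nonNegative (β-nonNeg i) (proj₁ (⁻¹-positive 0<x)))

  -- Bounds the weight of being active and controlled by `i`. The division by `x e` in the selection
  -- rule cancels the activity probability, and the bound no longer depends on `e`. Both loss
  -- estimates rest on this, one applying it to the element processed and the other to the element
  -- lost.
  x*w≤β : ∀ e i → x e * w e i ≤ β i
  x*w≤β e i with 0# <? x e
  ... | no  _   = ≤-respˡ-≈ (sym (zeroʳ _)) (β-nonNeg i)
  ... | yes 0<x = begin
    x e * (b * (β i * x e ⁻¹))
      ≈⟨ solve 4 (λ x b β y → x :* (b :* (β :* y)) := (b :* β) :* (x :* y)) refl _ _ _ _ ⟩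
    (b * β i) * (x e * x e ⁻¹)    ≈⟨ trans (*-congˡ (⁻¹-inverse (<⇒≉0 0<x))) (*-identityʳ _) ⟩
    b * β i                       ≤⟨ *-monoʳ-≤ (β-nonNeg i) ⟦ does (controls? e i) ⟧≤1 ⟩
    1# * β i                      ≈⟨ *-identityˡ _ ⟩
    β i                           ∎
    where b = ⟦ does (controls? e i) ⟧

  controls*β : ∀ e i → ⟦ does (controls? e i) ⟧ * β i ≈ β i * ⟦ lookup (I i) e ⟧
  controls*β e i with β i ≟ 0#
  ... | yes β≈0 = trans (trans (*-congˡ β≈0) (zeroʳ _)) (sym (trans (*-congʳ β≈0) (zeroˡ _)))
  ... | no  _   = trans (*-congʳ (reflexive
    (≡.cong ⟦_⟧ (≡.trans (Bool.∧-identityʳ _) (does-∈? e (I i)))))) (*-comm _ _)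

  ∑w≈1 : ∀ {e} → 0# < x e → sum (λ i → w e i) ≈ 1#
  ∑w≈1 {e} 0<x with 0# <? x e
  ... | no  0≮x = contradiction 0<x 0≮x
  ... | yes _   = begin-equality
    sum (λ i → ⟦ does (controls? e i) ⟧ * (β i * x e ⁻¹))
      ≈⟨ sum-cong-≋ (λ i → trans (sym (*-assoc _ _ _)) (*-congʳ (controls*β e i))) ⟩
    sum (λ i → β i * ⟦ lookup (I i) e ⟧ * x e ⁻¹)
      ≈⟨ *-distribʳ-sum (x e ⁻¹) (λ i → β i * ⟦ lookup (I i) e ⟧) ⟨
    sum (λ i → β i * ⟦ lookup (I i) e ⟧) * x e ⁻¹               ≈⟨ *-congʳ (x≈ e) ⟨
    x e * x e ⁻¹                                                ≈⟨ ⁻¹-inverse (<⇒≉0 0<x) ⟩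
    1#                                                          ∎

  pick-isProbability : ∀ e → IsProbability (pickController e)
  pick-isProbability e = record
    { mono  = λ {f} {g} f≤g → ≤-respˡ-≈ (sym (E-pick e f)) (≤-respʳ-≈ (sym (E-pick e g))
                (+-mono-≤ (*-monoˡ-≤ (0≤w₀ e) (f≤g nothing))
                          (sum-mono-≤ (λ i → *-monoˡ-≤ (0≤w e i) (f≤g (just i))))))
    ; mass  = trans (E-pick e (λ _ → 1#))
      (trans (+-cong (*-identityʳ _) (sum-cong-≋ {m} (λ i → *-identityʳ _))) masses)
    }
    where
    masses : w₀ e + sum (λ i → w e i) ≈ 1#
    masses with 0# <? x e | ∑w≈1 {e}
    ... | no  _   | _  = trans (+-congˡ (sum-replicate-zero m)) (+-identityʳ 1#)
    ... | yes 0<x | eq = trans (+-identityˡ _) (eq 0<x)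

  alive : Fin n → (Fin m → Subset n) → Maybe (Fin m) → Bool
  alive e cur nothing  = false
  alive e cur (just i) = lookup (cur i) e

  -- The factor that this matroid contributes to p_f. Activity is left out because the bit is shared
  -- by all matroids and must be counted only once.
  ρ : Fin n → (Fin m → Subset n) → ℝ
  ρ e cur = E (pickController e) (λ d → ⟦ alive e cur d ⟧)

  ρ≈ : ∀ e cur → ρ e cur ≈ sum (λ i → w e i * ⟦ lookup (cur i) e ⟧)
  ρ≈ e cur = trans (E-pick e _) (trans (+-congʳ (zeroʳ _)) (+-identityˡ _))

  0≤ρ : ∀ e cur → 0# ≤ ρ e cur
  0≤ρ e cur = nonNegative (pick-isProbability e) (λ d → 0≤⟦ alive e cur d ⟧)

  ρ≤1 : ∀ e cur → ρ e cur ≤ 1#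
  ρ≤1 e cur = ≤-respʳ-≈ (mass (pick-isProbability e))
    (mono (pick-isProbability e) (λ d → ⟦ alive e cur d ⟧≤1))

  ρ-initial : ∀ {e} → 0# < x e → ρ e I ≈ 1#
  ρ-initial {e} 0<x = trans (ρ≈ e I) (trans (sum-cong-≋ same) (∑w≈1 0<x))
    where
    same : ∀ i → w e i * ⟦ lookup (I i) e ⟧ ≈ w e i
    same i with 0# <? x e
    ... | no  _ = zeroˡ _
    ... | yes _ with e Subset.∈? I i
    ...   | yes e∈I rewrite Vec.[]=⇒lookup e∈I = *-identityʳ _
    ...   | no  _   = trans (*-congʳ (zeroˡ _)) (trans (zeroˡ _) (sym (zeroˡ _)))

  newCurrent : List (Observation n m) → Fin n → Fin m → (Fin m → Subset n) → Fin m → Subset n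
  newCurrent h e i cur j = if does (β j ≟ 0#) then cur j else exchange (cur j) e
    (φ h i j (cur i) (cur j) e)

  -- `process` with the bit and the controller of `e` passed as values instead of looked up, which
  -- is the form in which they can be drawn late.
  step : Fin n → Bool → Maybe (Fin m) → State → State
  step e b nothing  (state h cur S) = state (observed e b nothing ∷ h) cur S
  step e b (just i) (state h cur S) =
    if b ∧ lookup (cur i) e
    then state (observed e b (just i) ∷ h) (newCurrent h e i cur) (S ∪ ⁅ e ⁆)
    else state (observed e b (just i) ∷ h) cur S

  -- The updates made by process and step agree only pointwise.
  infix 4 _∼_
  record _∼_ (s t : State) : Set where
    constructor similar
    field
      history≡ : State.history s ≡ State.history t
      current≡ : ∀ j → State.current s j ≡ State.current t j
      chosen≡  : State.chosen s ≡ State.chosen t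

  step-history : ∀ e b d s → State.history (step e b d s) ≡ observed e b d ∷ State.history s
  step-history e b nothing  s = ≡.refl
  step-history e b (just i) s with b ∧ lookup (State.current s i) e
  ... | true  = ≡.refl
  ... | false = ≡.refl

  process-history : ∀ A ctl e s →
    State.history (process A ctl s e) ≡ observed e (does (e Subset.∈? A))
      (lookup ctl e) ∷ State.history s
  process-history A ctl e (state h cur S) with lookup ctl e in c≡
  ... | nothing = ≡.cong (λ d → observed e (does (e Subset.∈? A)) d ∷ h) c≡
  ... | just i with e Subset.∈? A in a≡ | e Subset.∈? cur i
  ...   | no  _ | _     = ≡.cong₂ (λ b d → observed e b d ∷ h) (≡.cong does a≡) c≡
  ...   | yes _ | no _  = ≡.cong₂ (λ b d → observed e b d ∷ h) (≡.cong does a≡) c≡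
  ...   | yes _ | yes _ = ≡.cong₂ (λ b d → observed e b d ∷ h) (≡.cong does a≡) c≡

  process-chosen : ∀ A ctl e {s t} → s ∼ t →
    State.chosen (process A ctl s e) ≡ State.chosen (step e (lookup A e) (lookup ctl e) t)
  process-chosen A ctl e {state h cur S} {state h′ cur′ S′} (similar _ cur≡ S≡) with lookup ctl e
  ... | nothing = S≡
  ... | just i rewrite ≡.sym (cur≡ i)
    -- `process` decides membership while `step` reads bits; abstracting each decision together with
    -- its `does-∈?` equation forces the two to take the same branch.
    with e Subset.∈? A | does-∈? e A | e Subset.∈? cur i | does-∈? e (cur i)
  ...   | no  _ | A≡ | _     | _    rewrite ≡.sym A≡ = S≡
  ...   | yes _ | A≡ | no _  | cur≡′ rewrite ≡.sym A≡ | ≡.sym cur≡′ = S≡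
  ...   | yes _ | A≡ | yes _ | cur≡′ rewrite ≡.sym A≡ | ≡.sym cur≡′ = ≡.cong (_∪ ⁅ e ⁆) S≡

  process-current : ∀ A ctl e {s t} → s ∼ t → ∀ j →
    State.current (process A ctl s e) j ≡ State.current (step e (lookup A e) (lookup ctl e) t) j
  process-current A ctl e {state h cur S} {state h′ cur′ S′}
    (similar ≡.refl cur≡ _) j with lookup ctl e
  ... | nothing = cur≡ j
  ... | just i with e Subset.∈? A | does-∈? e A | e Subset.∈? cur i | does-∈? e (cur i)
  ...   | no  _ | A≡ | _     | _    rewrite ≡.sym A≡ = cur≡ j
  ...   | yes _ | A≡ | no _  | cur≡′ rewrite ≡.sym A≡ | ≡.sym (cur≡ i) | ≡.sym cur≡′ = cur≡ j
  ...   | yes _ | A≡ | yes _ | cur≡′ rewrite ≡.sym A≡ | ≡.sym (cur≡ i) | ≡.sym cur≡′ with β j ≟ 0#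
  ...     | yes _ = cur≡ j
  ...     | no  _ rewrite cur≡ j | cur≡ i = ≡.refl

  process∼step : ∀ A ctl e {s t} → s ∼ t → process A ctl s e ∼ step e (lookup A e) (lookup ctl e) t
  process∼step A ctl e s∼t =
    similar history (process-current A ctl e s∼t) (process-chosen A ctl e s∼t)
    where
    history = ≡.trans (process-history A ctl e _) (≡.trans
      (≡.cong₂ (λ b h → observed e b (lookup ctl e) ∷ h) (does-∈? e A) (_∼_.history≡ s∼t))
      (≡.sym (step-history e (lookup A e) (lookup ctl e) _)))

  Independent : State → Set
  Independent s = ∀ j → Indep (State.current s j)

  exchange-independent : ∀ h i j {cur : Fin m → Subset n} {e} → (∀ j → Indep (cur j)) →
    lookup (cur i) e ≡ true →
    Indep (exchange (cur j) e (φ h i j (cur i) (cur j) e))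
  exchange-independent h i j {cur} {e} inv e∈I with φ h i j (cur i) (cur j) e in eq
  ... | nothing = IsExchangeMapping.adds      (φ-exchange h i j (inv i) (inv j))
    (Vec.lookup⇒[]= e _ e∈I) eq
  ... | just f  = IsExchangeMapping.exchanges (φ-exchange h i j (inv i) (inv j))
    (Vec.lookup⇒[]= e _ e∈I) eq

  step-independent : ∀ e b d {s} → Independent s → Independent (step e b d s)
  step-independent e b     nothing  inv = inv
  step-independent e false (just i) inv = inv
  step-independent e true  (just i) {state h cur S} inv j with lookup (cur i) e in e∈I
  ... | false = inv j
  ... | true with β j ≟ 0#
  ...   | yes _ = inv j
  ...   | no  _ = exchange-independent h i j inv e∈I

  _≟ᵐ_ : (p q : Maybe (Fin n)) → Dec (p ≡ q)
  _≟ᵐ_ = Maybe.≡-dec Fin._≟_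

  -- An element other than `e` can leave only by being the one swapped out. With membership counted
  -- as a number, this can be weighted by `w` and summed over the sets of the decomposition.
  exchange-keeps : ∀ J {e f} r → f ≢ e →
    ⟦ lookup J f ⟧ ≤ ⟦ lookup (exchange J e r) f ⟧ + ⟦ lookup J f ⟧ * ⟦ does (r ≟ᵐ just f) ⟧
  exchange-keeps J {e} {f} nothing f≢e rewrite lookup-∪⁅⁆ J f≢e =
    ≤-reflexive (sym (trans (+-congˡ (zeroʳ _)) (+-identityʳ _)))
  exchange-keeps J {e} {f} (just g) f≢e rewrite lookup-∪⁅⁆ (J Subset.- g) f≢e with g Fin.≟ f
  ... | yes _   = ≤-from-difference 0≤⟦ lookup (J Subset.- g) f ⟧
    (trans (+-congˡ (*-identityʳ _)) (+-comm _ _))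
  ... | no  g≢f rewrite lookup-delete J (g≢f ∘ ≡.sym) = ≤-reflexive
    (sym (trans (+-congˡ (zeroʳ _)) (+-identityʳ _)))

  exchange-shrinks : ∀ J {e f} r → f ≢ e → lookup (exchange J e r) f ≡ true → lookup J f ≡ true
  exchange-shrinks J nothing  f≢e rewrite lookup-∪⁅⁆ J f≢e = id
  exchange-shrinks J (just g) f≢e rewrite lookup-∪⁅⁆ (J Subset.- g) f≢e = lookup-⊆
    (Subset.p─q⊆p J ⁅ g ⁆)

  hit : List (Observation n m) → (Fin m → Subset n) → Fin m → Fin n → Fin m → Fin n → Bool
  hit h cur i e j f = does (φ h i j (cur i) (cur j) e ≟ᵐ just f)

  newCurrent-keeps : ∀ h e i cur j {f} → f ≢ e →
    ⟦ lookup (cur j) f ⟧ ≤ ⟦ lookup (newCurrent h e i cur j) f ⟧ + ⟦ lookup (cur j) f ⟧ *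
      ⟦ hit h cur i e j f ⟧
  newCurrent-keeps h e i cur j {f} f≢e with β j ≟ 0#
  ... | yes _ = ≤-from-difference (*-nonNegative 0≤⟦ lookup
    (cur j) f ⟧ 0≤⟦ hit h cur i e j f ⟧) refl
  ... | no  _ = exchange-keeps (cur j) (φ h i j (cur i) (cur j) e) f≢e

  newCurrent-shrinks : ∀ h e i cur j {f} → f ≢ e →
    ⟦ lookup (newCurrent h e i cur j) f ⟧ ≤ ⟦ lookup (cur j) f ⟧
  newCurrent-shrinks h e i cur j {f} f≢e with β j ≟ 0#
  ... | yes _ = ≤-refl
  ... | no  _ = ⟦⟧-mono (exchange-shrinks (cur j) (φ h i j (cur i) (cur j) e) f≢e)

  -- Bounds the drop of ρ f when e is accepted through the controller d.
  loss : State → Fin n → Maybe (Fin m) → Fin n → ℝ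
  loss s               e nothing  f = 0#
  loss (state h cur S) e (just i) f =
    ⟦ lookup (cur i) e ⟧ * sum (λ j → w f j * (⟦ lookup (cur j) f ⟧ * ⟦ hit h cur i e j f ⟧))

  0≤loss : ∀ s e d f → 0# ≤ loss s e d f
  0≤loss s               e nothing  f = ≤-refl
  0≤loss (state h cur S) e (just i) f = *-nonNegative 0≤⟦ lookup (cur i) e ⟧
    (sum-nonNegative λ j → *-nonNegative (0≤w f j)
      (*-nonNegative 0≤⟦ lookup (cur j) f ⟧ 0≤⟦ hit h cur i e j f ⟧))

  -- An update inserts nothing but the processed element, so no other element can become more likely
  -- to survive. Together with `ρ-step-≥` this meets the hypotheses of `∏-drop`.
  ρ-step-≤ : ∀ e b d s {f} → f ≢ e → ρ f (State.current (step e b d s)) ≤ ρ f (State.current s)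
  ρ-step-≤ e b     nothing  s f≢e = ≤-refl
  ρ-step-≤ e false (just i) s f≢e = ≤-refl
  ρ-step-≤ e true  (just i) (state h cur S) {f} f≢e with lookup (cur i) e
  ... | false = ≤-refl
  ... | true  = begin
    ρ f (newCurrent h e i cur)                                        ≈⟨ ρ≈ f _ ⟩
    sum (λ j → w f j * ⟦ lookup (newCurrent h e i cur j) f ⟧)
      ≤⟨ sum-mono-≤ (λ j → *-monoˡ-≤ (0≤w f j) (newCurrent-shrinks h e i cur j f≢e)) ⟩
    sum (λ j → w f j * ⟦ lookup (cur j) f ⟧)                          ≈⟨ ρ≈ f cur ⟨
    ρ f cur                                                           ∎

  ρ-step-≥ : ∀ e b d s {f} → f ≢ e →
    ρ f (State.current s) ≤ ρ f (State.current (step e b d s)) + ⟦ b ⟧ * loss s e d f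
  ρ-step-≥ e b     nothing  s f≢e = ≤-reflexive (sym (trans (+-congˡ (zeroʳ _)) (+-identityʳ _)))
  ρ-step-≥ e false (just i) s f≢e = ≤-reflexive (sym (trans (+-congˡ (zeroˡ _)) (+-identityʳ _)))
  ρ-step-≥ e true  (just i) (state h cur S) {f} f≢e with lookup (cur i) e
  ... | false = ≤-reflexive (sym (trans (+-congˡ (trans (*-congˡ (zeroˡ _)) (zeroʳ _)))
    (+-identityʳ _)))
  ... | true  = begin
    ρ f cur
      ≈⟨ ρ≈ f cur ⟩
    sum (λ j → w f j * ⟦ lookup (cur j) f ⟧)
      ≤⟨ sum-mono-≤ (λ j → *-monoˡ-≤ (0≤w f j) (newCurrent-keeps h e i cur j f≢e)) ⟩
    sum (λ j → w f j * (⟦ lookup (newCurrent h e i cur j) f ⟧ + lost j))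
      ≈⟨ trans (sum-cong-≋ (λ j → distribˡ (w f j) _ _))
           (∑-distrib-+ (λ j → w f j * ⟦ lookup (newCurrent h e i cur j) f ⟧)
           (λ j → w f j * lost j)) ⟩
    sum (λ j → w f j * ⟦ lookup (newCurrent h e i cur j) f ⟧) + sum (λ j → w f j * lost j)
      ≈⟨ +-cong (sym (ρ≈ f _)) (sym (trans (*-identityˡ _) (*-identityˡ _))) ⟩
    ρ f (newCurrent h e i cur) + 1# * (1# * sum (λ j → w f j * lost j)) ∎
    where
    lost : Fin m → ℝ
    lost j = ⟦ lookup (cur j) f ⟧ * ⟦ hit h cur i e j f ⟧

  does⇒≡ : ∀ p q → does (p ≟ᵐ q) ≡ true → p ≡ q
  does⇒≡ p q eq with p ≟ᵐ q
  ... | yes p≡q = p≡q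

  -- The worst-case companion of `E-loss≤ρ`: it uses that an exchange mapping has only one value at
  -- `e`, not that it is injective. So at most one `f` is hit in the j-th set, at cost at most
  -- `β j`. This keeps the drop in the range where `exp-step` applies.
  ∑-loss≤1 : ∀ s e d → sum (λ f → x f * loss s e d f) ≤ 1#
  ∑-loss≤1 s e nothing = ≤-trans (≤-reflexive
    (trans (sum-cong-≋ (λ f → zeroʳ (x f))) (sum-replicate-zero n))) 0≤1
  ∑-loss≤1 (state h cur S) e (just i) = begin
    sum (λ f → x f * (⟦ lookup (cur i) e ⟧ *
      sum (λ j → w f j * (⟦ lookup (cur j) f ⟧ * ⟦ hit h cur i e j f ⟧))))
      ≤⟨ sum-mono-≤ bound ⟩
    sum (λ f → sum (λ j → β j * ⟦ hit h cur i e j f ⟧))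
      ≈⟨ ∑-comm (λ f j → β j * ⟦ hit h cur i e j f ⟧) ⟩
    sum (λ j → sum (λ f → β j * ⟦ hit h cur i e j f ⟧))
      ≈⟨ sum-cong-≋ (λ j → sym (*-distribˡ-sum (β j) (λ f → ⟦ hit h cur i e j f ⟧))) ⟩
    sum (λ j → β j * sum (λ f → ⟦ hit h cur i e j f ⟧))
      ≤⟨ sum-mono-≤ (λ j → *-monoˡ-≤ (β-nonNeg j) (sum-atMostOne (hit h cur i e j) (unique j))) ⟩
    sum (λ j → β j * 1#)
      ≈⟨ trans (sum-cong-≋ (λ j → *-identityʳ (β j))) β-sum ⟩
    1# ∎
    where
    unique : ∀ j {f f′} → hit h cur i e j f ≡ true → hit h cur i e j f′ ≡ true → f ≡ f′
    unique j p q = Maybe.just-injective (≡.trans (≡.sym (does⇒≡ r _ p)) (does⇒≡ r _ q))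
      where r = φ h i j (cur i) (cur j) e
    W : Fin n → Fin m → ℝ
    W f j = w f j * (⟦ lookup (cur j) f ⟧ * ⟦ hit h cur i e j f ⟧)
    0≤W : ∀ f j → 0# ≤ W f j
    0≤W f j = *-nonNegative (0≤w f j) (*-nonNegative 0≤⟦ lookup (cur j) f ⟧ 0≤⟦ hit h cur i e j f ⟧)
    bound : ∀ f → x f * (⟦ lookup (cur i) e ⟧ * sum (W f)) ≤ sum (λ j → β j * ⟦ hit h cur i e j f ⟧)
    bound f = begin
      x f * (⟦ lookup (cur i) e ⟧ * sum (W f))
        ≤⟨ *-monoˡ-≤ (0≤x f) (*-≤ˡ (sum-nonNegative (0≤W f)) ⟦ lookup (cur i) e ⟧≤1) ⟩
      x f * sum (W f)
        ≈⟨ *-distribˡ-sum (x f) (W f) ⟩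
      sum (λ j → x f * W f j)
        ≤⟨ sum-mono-≤ (λ j → ≤-respˡ-≈ (*-assoc (x f) (w f j) _)
             (*-mono-≤ (*-nonNegative (0≤x f) (0≤w f j))
               (*-nonNegative 0≤⟦ lookup (cur j) f ⟧ 0≤⟦ hit h cur i e j f ⟧)
               (x*w≤β f j) (*-≤ˡ 0≤⟦ hit h cur i e j f ⟧ ⟦ lookup (cur j) f ⟧≤1))) ⟩
      sum (λ j → β j * ⟦ hit h cur i e j f ⟧) ∎

  -- For fixed i and j, at most one e ∈ Iᵢ is exchanged for f.
  E-loss≤ρ : ∀ s → Independent s → ∀ f →
    sum (λ e → x e * E (pickController e) (λ d → loss s e d f)) ≤ ρ f (State.current s)
  E-loss≤ρ s@(state h cur S) inv f = begin
    sum (λ e → x e * E (pickController e) (λ d → loss s e d f))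
      ≤⟨ sum-mono-≤ bound ⟩
    sum (λ e → sum (λ i → sum (λ j → β i * (W j * hits i j e))))
      ≈⟨ trans (∑-comm (λ e i → sum (λ j → β i * (W j * hits i j e))))
           (sum-cong-≋ (λ i → ∑-comm (λ e j → β i * (W j * hits i j e)))) ⟩
    sum (λ i → sum (λ j → sum (λ e → β i * (W j * hits i j e))))
      ≤⟨ sum-mono-≤ (λ i → sum-mono-≤ (λ j → collect i j)) ⟩
    sum (λ i → sum (λ j → β i * W j))
      ≈⟨ sum-cong-≋ (λ i → sym (*-distribˡ-sum (β i) W)) ⟩
    sum (λ i → β i * sum W)
      ≈⟨ *-distribʳ-sum (sum W) β ⟨
    sum β * sum W
      ≈⟨ trans (*-congʳ β-sum) (*-identityˡ _) ⟩
    sum W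
      ≈⟨ ρ≈ f cur ⟨
    ρ f cur ∎
    where
    W : Fin m → ℝ
    W j = w f j * ⟦ lookup (cur j) f ⟧
    0≤W : ∀ j → 0# ≤ W j
    0≤W j = *-nonNegative (0≤w f j) 0≤⟦ lookup (cur j) f ⟧
    hitsᵇ : Fin m → Fin m → Fin n → Bool
    hitsᵇ i j e = lookup (cur i) e ∧ hit h cur i e j f
    hits : Fin m → Fin m → Fin n → ℝ
    hits i j e = ⟦ hitsᵇ i j e ⟧
    unique : ∀ i j {e e′} → hitsᵇ i j e ≡ true → hitsᵇ i j e′ ≡ true → e ≡ e′
    unique i j {e} {e′} p q with lookup (cur i) e in e∈ | lookup (cur i) e′ in e′∈
    ... | true | true = IsExchangeMapping.injective (φ-exchange h i j (inv i) (inv j))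
      (Vec.lookup⇒[]= e _ e∈) (Vec.lookup⇒[]= e′ _ e′∈) (does⇒≡ _ (just f) p) (does⇒≡ _ (just f) q)
    collect : ∀ i j → sum (λ e → β i * (W j * hits i j e)) ≤ β i * W j
    collect i j = begin
      sum (λ e → β i * (W j * hits i j e))
        ≈⟨ sum-cong-≋ (λ e → sym (*-assoc (β i) (W j) (hits i j e))) ⟩
      sum (λ e → (β i * W j) * hits i j e)   ≈⟨ *-distribˡ-sum (β i * W j) (hits i j) ⟨
      (β i * W j) * sum (hits i j)
        ≤⟨ *-monoˡ-≤ (*-nonNegative (β-nonNeg i) (0≤W j)) (sum-atMostOne (hitsᵇ i j) (unique i j)) ⟩
      (β i * W j) * 1#                       ≈⟨ *-identityʳ _ ⟩
      β i * W j                              ∎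
    lossᵢ : Fin n → Fin m → ℝ
    lossᵢ e i = sum (λ j → W j * hits i j e)
    loss≈ : ∀ e i → loss s e (just i) f ≈ lossᵢ e i
    loss≈ e i = trans (*-distribˡ-sum ⟦ lookup (cur i) e ⟧
      (λ j → w f j * (⟦ lookup (cur j) f ⟧ * ⟦ hit h cur i e j f ⟧)))
      (sum-cong-≋ λ j → trans
        (solve 4 (λ a b c d → a :* (b :* (c :* d)) := (b :* c) :* (a :* d)) refl _ _ _ _)
        (*-congˡ (sym (⟦∧⟧ (lookup (cur i) e) (hit h cur i e j f)))))
    0≤lossᵢ : ∀ e i → 0# ≤ lossᵢ e i
    0≤lossᵢ e i = sum-nonNegative λ j → *-nonNegative (0≤W j) 0≤⟦ hitsᵇ i j e ⟧
    bound : ∀ e → x e * E (pickController e) (λ d → loss s e d f)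
      ≤ sum (λ i → sum (λ j → β i * (W j * hits i j e)))
    bound e = begin
      x e * E (pickController e) (λ d → loss s e d f)
        ≈⟨ *-congˡ (trans (E-pick e (λ d → loss s e d f))
             (trans (+-congʳ (zeroʳ _)) (+-identityˡ _))) ⟩
      x e * sum (λ i → w e i * loss s e (just i) f)
        ≈⟨ *-congˡ (sum-cong-≋ (λ i → *-congˡ (loss≈ e i))) ⟩
      x e * sum (λ i → w e i * lossᵢ e i)
        ≈⟨ *-distribˡ-sum (x e) (λ i → w e i * lossᵢ e i) ⟩
      sum (λ i → x e * (w e i * lossᵢ e i))
        ≤⟨ sum-mono-≤ (λ i → ≤-respˡ-≈ (*-assoc (x e) (w e i) (lossᵢ e i))
             (*-monoʳ-≤ (0≤lossᵢ e i) (x*w≤β e i))) ⟩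
      sum (λ i → β i * lossᵢ e i)
        ≈⟨ sum-cong-≋ (λ i → *-distribˡ-sum (β i) (λ j → W j * hits i j e)) ⟩
      sum (λ i → sum (λ j → β i * (W j * hits i j e))) ∎

  step-chosen-⊇ : ∀ e b d s f → lookup (State.chosen s) f ≡ true →
    lookup (State.chosen (step e b d s)) f ≡ true
  step-chosen-⊇ e b     nothing  s f f∈S = f∈S
  step-chosen-⊇ e b (just i) (state h cur S) f f∈S with b ∧ lookup (cur i) e
  ... | false = f∈S
  ... | true  = lookup-⊆ (Subset.p⊆p∪q {p = S} ⁅ e ⁆) f∈S

  step-chosen-∋ : ∀ e b d s → b ∧ alive e (State.current s) d ≡ true →
    lookup (State.chosen (step e b d s)) e ≡ true
  step-chosen-∋ e false nothing  s ()
  step-chosen-∋ e true  nothing  s ()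
  step-chosen-∋ e b (just i) (state h cur S) accepted rewrite accepted =
    Vec.[]=⇒lookup (Subset.q⊆p∪q S ⁅ e ⁆ (Subset.x∈⁅x⁆ e))

-- Finite products and their first-order change

module Products {c ℓ₁ ℓ₂} (R : Reals c ℓ₁ ℓ₂) where
  open OrderedField R
  open Expectation R
  open PartialOrderReasoning poset

  0≤∏ : ∀ {k} {u : Fin k → ℝ} → (∀ j → 0# ≤ u j) → 0# ≤ ∏ u
  0≤∏ {zero}  h = 0≤1
  0≤∏ {suc k} h = *-nonNegative (h Fin.zero) (0≤∏ (λ j → h (Fin.suc j)))

  ∏-mono : ∀ {k} {u v : Fin k → ℝ} → (∀ j → 0# ≤ u j) → (∀ j → u j ≤ v j) → ∏ u ≤ ∏ v
  ∏-mono {zero}  0≤u u≤v = ≤-refl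
  ∏-mono {suc k} 0≤u u≤v = *-mono-≤ (0≤u Fin.zero) (0≤∏ (λ j → 0≤u (Fin.suc j)))
    (u≤v Fin.zero) (∏-mono (λ j → 0≤u (Fin.suc j)) (λ j → u≤v (Fin.suc j)))

  ∏-cong : ∀ {k} {u v : Fin k → ℝ} → (∀ j → u j ≈ v j) → ∏ u ≈ ∏ v
  ∏-cong {zero}  h = refl
  ∏-cong {suc k} h = *-cong (h Fin.zero) (∏-cong (λ j → h (Fin.suc j)))

  ∏-1 : ∀ {k} → ∏ {k} (λ _ → 1#) ≈ 1#
  ∏-1 {zero}  = refl
  ∏-1 {suc k} = trans (*-identityˡ _) (∏-1 {k})

  ∏≤1 : ∀ {k} {u : Fin k → ℝ} → (∀ j → 0# ≤ u j) → (∀ j → u j ≤ 1#) → ∏ u ≤ 1#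
  ∏≤1 {k} 0≤u u≤1 = ≤-trans (∏-mono 0≤u u≤1) (≤-reflexive (∏-1 {k}))

  -- The product of all factors except the j-th, built without division because factors may vanish.
  ∏ᶜ : ∀ {k} → (Fin k → ℝ) → Fin k → ℝ
  ∏ᶜ u Fin.zero    = ∏ (λ j → u (Fin.suc j))
  ∏ᶜ u (Fin.suc j) = u Fin.zero * ∏ᶜ (λ j → u (Fin.suc j)) j

  0≤∏ᶜ : ∀ {k} {u : Fin k → ℝ} → (∀ j → 0# ≤ u j) → ∀ j → 0# ≤ ∏ᶜ u j
  0≤∏ᶜ h Fin.zero    = 0≤∏ (λ j → h (Fin.suc j))
  0≤∏ᶜ h (Fin.suc j) = *-nonNegative (h Fin.zero) (0≤∏ᶜ (λ j → h (Fin.suc j)) j)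

  ∏ᶜ≤1 : ∀ {k} {u : Fin k → ℝ} → (∀ j → 0# ≤ u j) → (∀ j → u j ≤ 1#) → ∀ j → ∏ᶜ u j ≤ 1#
  ∏ᶜ≤1 0≤u u≤1 Fin.zero    = ∏≤1 (λ j → 0≤u (Fin.suc j)) (λ j → u≤1 (Fin.suc j))
  ∏ᶜ≤1 0≤u u≤1 (Fin.suc j) = ≤-respʳ-≈ (*-identityˡ 1#)
    (*-mono-≤ (0≤u Fin.zero) (0≤∏ᶜ (λ j → 0≤u (Fin.suc j)) j) (u≤1 Fin.zero)
      (∏ᶜ≤1 (λ j → 0≤u (Fin.suc j)) (λ j → u≤1 (Fin.suc j)) j))

  ∏ᶜ-* : ∀ {k} (u : Fin k → ℝ) j → ∏ᶜ u j * u j ≈ ∏ u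
  ∏ᶜ-* u Fin.zero    = *-comm _ _
  ∏ᶜ-* u (Fin.suc j) = trans (*-assoc _ _ _) (*-congˡ (∏ᶜ-* (λ j → u (Fin.suc j)) j))

  -- Factors are replaced one at a time, and each `v` already in place is raised back to `u`. The
  -- coefficients then depend only on the state before the step, so taking expectations affects the
  -- losses `l` alone.
  ∏-drop : ∀ {k} {u v l : Fin k → ℝ} → (∀ j → 0# ≤ v j) → (∀ j → v j ≤ u j) → (∀ j → 0# ≤ l j) →
    (∀ j → u j ≤ v j + l j) → ∏ u ≤ ∏ v + sum (λ j → ∏ᶜ u j * l j)
  ∏-drop {zero} 0≤v v≤u 0≤l u≤v+l = ≤-reflexive (sym (+-identityʳ 1#))
  ∏-drop {suc k} {u} {v} {l} 0≤v v≤u 0≤l u≤v+l = begin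
    u₀ * ∏ u′
      ≤⟨ *-monoˡ-≤ (≤-trans (0≤v Fin.zero) (v≤u Fin.zero))
           (∏-drop (λ j → 0≤v (Fin.suc j)) (λ j → v≤u (Fin.suc j)) (λ j → 0≤l (Fin.suc j))
             (λ j → u≤v+l (Fin.suc j))) ⟩
    u₀ * (∏ v′ + sum (λ j → ∏ᶜ u′ j * l′ j))
      ≈⟨ trans (distribˡ _ _ _) (+-congˡ
           (trans (*-distribˡ-sum u₀ (λ j → ∏ᶜ u′ j * l′ j))
           (sum-cong-≋ (λ j → sym (*-assoc u₀ (∏ᶜ u′ j) (l′ j)))))) ⟩
    u₀ * ∏ v′ + rest
      ≤⟨ +-mono-≤ (*-monoʳ-≤ (0≤∏ (λ j → 0≤v (Fin.suc j))) (u≤v+l Fin.zero)) ≤-refl ⟩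
    (v₀ + l₀) * ∏ v′ + rest
      ≈⟨ +-congʳ (trans (distribʳ _ _ _) (+-congˡ (*-comm _ _))) ⟩
    (v₀ * ∏ v′ + ∏ v′ * l₀) + rest
      ≤⟨ +-mono-≤ (+-monoʳ-≤ _ (*-monoʳ-≤ (0≤l Fin.zero)
           (∏-mono (λ j → 0≤v (Fin.suc j)) (λ j → v≤u (Fin.suc j))))) ≤-refl ⟩
    (v₀ * ∏ v′ + ∏ u′ * l₀) + rest
      ≈⟨ +-assoc _ _ _ ⟩
    v₀ * ∏ v′ + (∏ u′ * l₀ + rest) ∎
    where
    u′ v′ l′ : Fin k → ℝ
    u′ j = u (Fin.suc j)
    v′ j = v (Fin.suc j)
    l′ j = l (Fin.suc j)
    u₀ = u Fin.zero
    v₀ = v Fin.zero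
    l₀ = l Fin.zero
    rest = sum (λ j → (u₀ * ∏ᶜ u′ j) * l′ j)

  sum-const : ∀ k y → sum {k} (λ _ → y) ≈ fromℕ k * y
  sum-const k y = trans (sum-cong-≋ {k} (λ _ → sym (*-identityˡ y)))
    (trans (sym (*-distribʳ-sum {k} y (λ _ → 1#))) (*-congʳ (sum-replicate k {1#})))

  E-bernoulli : ∀ p (f : Bool → ℝ) →
    E (Probability.bernoulli {{R}} p) f ≈ p * f true + (1# − p) * f false
  E-bernoulli p f = +-congˡ (+-identityʳ _)

  bernoulli-isProbability : ∀ {p} → 0# ≤ p → p ≤ 1# → IsProbability (Probability.bernoulli {{R}} p)
  bernoulli-isProbability {p} 0≤p p≤1 = record
    { mono = λ f≤g → +-mono-≤ (*-monoˡ-≤ 0≤p (f≤g true))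
      (+-mono-≤ (*-monoˡ-≤ (x≤y⇒0≤y−x p≤1) (f≤g false)) ≤-refl)
    ; mass = solve 1 (λ p → p :* :1 :+ ((:1 :- p) :* :1 :+ :0) := :1) refl p
    }

-- The potential for `k` matroids and its drift

module Potential {c ℓ₁ ℓ₂} (R : Reals c ℓ₁ ℓ₂)
  {n k : ℕ} (M : Fin k → Matroid n) {x : Fin n → Reals.ℝ R}
  (C : ∀ j → Scheme.Choices {{R}} (M j) x) (j₀ : Fin k)
  (a : Fin n → Reals.ℝ R) (0≤a : ∀ e → Reals._≤_ R (Reals.0# R) (a e))
  (a≤1 : ∀ e → Reals._≤_ R (a e) (Reals.1# R))
  where
  open OrderedField R
  open ExponentialLaws R
  open Expectation R
  open RandomOrder R
  open Products R
  open Probability {{R}}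
  open Exponential {{R}} using (exp)
  open PartialOrderReasoning poset

  module S (j : Fin k) = SingleScheme R (M j) (C j)

  State : Fin k → Set
  State j = Scheme.SingleMatroid.State {{R}} (C j)

  Y : Fin k → Set
  Y j = Maybe (Fin (Scheme.Choices.m {{R}} (C j)))

  current : ∀ {j} → State j → _
  current {j} = Scheme.SingleMatroid.State.current {{R}} {C = C j}

  chosen : ∀ {j} → State j → Subset n
  chosen {j} = Scheme.SingleMatroid.State.chosen {{R}} {C = C j}

  pick : ∀ j → Fin n → Dist (Y j)
  pick j = Scheme.SingleMatroid.pickController {{R}} (C j)

  α : Fin n → Dist Bool
  α e = bernoulli (x e)

  -- Read off from the decomposition of `x` in one of the matroids; `j₀` is the witness that there
  -- is one.
  0≤x : ∀ e → 0# ≤ x e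
  0≤x = S.0≤x j₀

  α-isProbability : ∀ e → IsProbability (α e)
  α-isProbability e = bernoulli-isProbability (0≤x e) (S.x≤1 j₀ e)

  𝔻 : Fin n → Dist (Tuple k Y)
  𝔻 e = joint (λ j → pick j e)

  𝔻-isProbability : ∀ e → IsProbability (𝔻 e)
  𝔻-isProbability e = joint-isProbability (λ j → S.pick-isProbability j e)

  next : Fin n → Bool → Tuple k Y → (∀ j → State j) → ∀ j → State j
  next e b d s j = S.step j e b (get d j) (s j)

  Inv : (∀ j → State j) → Set
  Inv s = ∀ j → S.Independent j (s j)

  u : Fin n → (∀ j → State j) → Fin k → ℝ
  u f s j = S.ρ j f (current (s j))

  0≤u : ∀ f s j → 0# ≤ u f s j
  0≤u f s j = S.0≤ρ j f (current (s j))

  u≤1 : ∀ f s j → u f s j ≤ 1#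
  u≤1 f s j = S.ρ≤1 j f (current (s j))

  -- The expected weight that f contributes if it is processed next.
  value : Fin n → (∀ j → State j) → ℝ
  value f s = a f * (x f * ∏ (u f s))

  0≤value : ∀ f s → 0# ≤ value f s
  0≤value f s = *-nonNegative (0≤a f) (*-nonNegative (0≤x f) (0≤∏ (0≤u f s)))

  inAll : Fin n → (∀ j → State j) → ℝ
  inAll f s = ∏ (λ j → ⟦ lookup (chosen (s j)) f ⟧)

  pending : Subset n → (∀ j → State j) → ℝ
  pending U s = sum (λ f → ⟦ lookup U f ⟧ * value f s)

  -- Restricted to processed elements, so that the term of `e` is zero before `e` is processed,
  -- without an invariant saying that unprocessed elements are not yet chosen.
  gained : Subset n → (∀ j → State j) → ℝ
  gained U s = sum (λ f → ⟦ not (lookup U f) ⟧ * (a f * inAll f s))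

  K κ : ℝ
  K = fromℕ (k ℕ.+ 1)
  κ = K ⁻¹

  0<K : 0# < K
  0<K = let (0≤ , 0≉) = fromℕ-positive (suc k) in ≤-respʳ-≈ eq 0≤ , λ 0≈ → 0≉ (trans 0≈ (sym eq))
    where
    eq : fromℕ (suc k) ≈ K
    eq = trans (+-comm _ _) (trans (+-congˡ (sym fromℕ1≈1)) (sym (fromℕ-+ k 1)))

  K≈ : K ≈ 1# + fromℕ k
  K≈ = trans (fromℕ-+ k 1) (trans (+-comm _ _) (+-congʳ fromℕ1≈1))

  0≤κ : 0# ≤ κ
  0≤κ = proj₁ (⁻¹-positive 0<K)

  κK≈1 : κ * K ≈ 1#
  κK≈1 = trans (*-comm _ _) (⁻¹-inverse (<⇒≉0 0<K))

  Ψ : Subset n → (∀ j → State j) → ℝ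
  Ψ U s = gained U s + ⅓ * (κ * pending U s)

  Φ : Subset n → (∀ j → State j) → ℝ
  Φ U s = exp (- Ψ U s)

  gain : Fin n → Tuple k Y → (∀ j → State j) → ℝ
  gain e d s = a e * ∏ (λ j → ⟦ S.alive j e (current (s j)) (get d j) ⟧)

  lossAt : Fin n → Tuple k Y → (∀ j → State j) → Fin n → ℝ
  lossAt e d s f = a f * (x f * sum (λ j → ∏ᶜ (u f s) j * S.loss j (s j) e (get d j) f))

  lossSum : Subset n → Fin n → Tuple k Y → (∀ j → State j) → ℝ
  lossSum U e d s = sum (λ f → ⟦ lookup U f ⟧ * lossAt e d s f)

  0≤gain : ∀ e d s → 0# ≤ gain e d s
  0≤gain e d s = *-nonNegative (0≤a e) (0≤∏ (λ j → 0≤⟦ S.alive j e (current (s j)) (get d j) ⟧))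

  gain≤1 : ∀ e d s → gain e d s ≤ 1#
  gain≤1 e d s = ≤-respʳ-≈ (*-identityˡ 1#) (*-mono-≤ (0≤a e) (0≤∏ 0≤alive) (a≤1 e)
    (∏≤1 0≤alive (λ j → ⟦ S.alive j e (current (s j)) (get d j) ⟧≤1)))
    where
    0≤alive : ∀ j → 0# ≤ ⟦ S.alive j e (current (s j)) (get d j) ⟧
    0≤alive j = 0≤⟦ S.alive j e (current (s j)) (get d j) ⟧

  0≤lossTerms : ∀ e d s f → 0# ≤ sum (λ j → ∏ᶜ (u f s) j * S.loss j (s j) e (get d j) f)
  0≤lossTerms e d s f = sum-nonNegative λ j →
    *-nonNegative (0≤∏ᶜ (0≤u f s) j) (S.0≤loss j (s j) e (get d j) f)

  0≤lossAt : ∀ e d s f → 0# ≤ lossAt e d s f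
  0≤lossAt e d s f = *-nonNegative (0≤a f) (*-nonNegative (0≤x f) (0≤lossTerms e d s f))

  0≤lossSum : ∀ U e d s → 0# ≤ lossSum U e d s
  0≤lossSum U e d s = sum-nonNegative λ f → *-nonNegative 0≤⟦ lookup U f ⟧ (0≤lossAt e d s f)

  lossSum≤k : ∀ U e d s → lossSum U e d s ≤ fromℕ k
  lossSum≤k U e d s = begin
    sum (λ f → ⟦ lookup U f ⟧ * lossAt e d s f)
      ≤⟨ sum-mono-≤ (λ f → begin
           ⟦ lookup U f ⟧ * lossAt e d s f
             ≤⟨ *-≤ˡ (0≤lossAt e d s f) ⟦ lookup U f ⟧≤1 ⟩
           lossAt e d s f
             ≤⟨ *-≤ˡ (*-nonNegative (0≤x f) (0≤lossTerms e d s f)) (a≤1 f) ⟩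
           x f * sum (λ j → ∏ᶜ (u f s) j * ℓ j f)
             ≤⟨ *-monoˡ-≤ (0≤x f) (sum-mono-≤
                  (λ j → *-≤ˡ (S.0≤loss j (s j) e (get d j) f) (∏ᶜ≤1 (0≤u f s) (u≤1 f s) j))) ⟩
           x f * sum (λ j → ℓ j f)
             ≈⟨ *-distribˡ-sum (x f) (λ j → ℓ j f) ⟩
           sum (λ j → x f * ℓ j f) ∎) ⟩
    sum (λ f → sum (λ j → x f * ℓ j f))
      ≈⟨ ∑-comm (λ f j → x f * ℓ j f) ⟩
    sum (λ j → sum (λ f → x f * ℓ j f))
      ≤⟨ sum-mono-≤ (λ j → S.∑-loss≤1 j (s j) e (get d j)) ⟩
    sum {k} (λ _ → 1#)
      ≈⟨ sum-replicate k {1#} ⟩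
    fromℕ k ∎
    where
    ℓ : Fin k → Fin n → ℝ
    ℓ j f = S.loss j (s j) e (get d j) f

  lookup-remove : ∀ (U : Subset n) {e f} → f ≢ e → lookup (remove U e) f ≡ lookup U f
  lookup-remove U f≢e = Vec.lookup∘update′ f≢e U false

  gained-step : ∀ U {e} b d s → lookup U e ≡ true →
    gained U s + ⟦ b ⟧ * gain e d s ≤ gained (remove U e) (next e b d s)
  gained-step U {e} b d s e∈U = begin
    gained U s + ⟦ b ⟧ * gain e d s
      ≈⟨ +-congˡ (sum-δ e (⟦ b ⟧ * gain e d s)) ⟨
    gained U s + sum (λ f → ⟦ does (f Fin.≟ e) ⟧ * (⟦ b ⟧ * gain e d s))
      ≈⟨ ∑-distrib-+ (λ f → ⟦ not (lookup U f) ⟧ * (a f * inAll f s))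
           (λ f → ⟦ does (f Fin.≟ e) ⟧ * (⟦ b ⟧ * gain e d s)) ⟨
    sum (λ f → ⟦ not (lookup U f) ⟧ * (a f * inAll f s) + ⟦ does (f Fin.≟ e) ⟧ *
      (⟦ b ⟧ * gain e d s))
      ≤⟨ sum-mono-≤ termwise ⟩
    gained (remove U e) s′ ∎
    where
    s′ = next e b d s
    accept : ∀ b → ⟦ b ⟧ * gain e d s ≤ a e * inAll e (next e b d s)
    accept false = ≤-trans (≤-reflexive (zeroˡ _))
      (*-nonNegative (0≤a e) (0≤∏ (λ j → 0≤⟦ lookup (chosen (next e false d s j)) e ⟧)))
    accept true  = ≤-trans (≤-reflexive (*-identityˡ _)) (*-monoˡ-≤ (0≤a e) (∏-mono
      (λ j → 0≤⟦ S.alive j e (current (s j)) (get d j) ⟧)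
      (λ j → ⟦⟧-mono (S.step-chosen-∋ j e true (get d j) (s j)))))
    termwise : ∀ f → ⟦ not (lookup U f) ⟧ * (a f * inAll f s) + ⟦ does (f Fin.≟ e) ⟧ *
      (⟦ b ⟧ * gain e d s)
      ≤ ⟦ not (lookup (remove U e) f) ⟧ * (a f * inAll f s′)
    termwise f with f Fin.≟ e
    ... | yes ≡.refl rewrite e∈U | Vec.lookup∘update e U false = begin
      0# * (a e * inAll e s) + 1# * (⟦ b ⟧ * gain e d s)
        ≈⟨ trans (+-cong (zeroˡ _) (*-identityˡ _)) (+-identityˡ _) ⟩
      ⟦ b ⟧ * gain e d s                                  ≤⟨ accept b ⟩
      a e * inAll e s′                                    ≈⟨ *-identityˡ _ ⟨
      1# * (a e * inAll e s′)                             ∎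
    ... | no f≢e rewrite lookup-remove U f≢e = begin
      ⟦ not (lookup U f) ⟧ * (a f * inAll f s) + 0# * (⟦ b ⟧ * gain e d s)
        ≈⟨ trans (+-congˡ (zeroˡ _)) (+-identityʳ _) ⟩
      ⟦ not (lookup U f) ⟧ * (a f * inAll f s)
        ≤⟨ *-monoˡ-≤ 0≤⟦ not (lookup U f) ⟧
             (*-monoˡ-≤ (0≤a f) (∏-mono (λ j → 0≤⟦ lookup (chosen (s j)) f ⟧)
             (λ j → ⟦⟧-mono (S.step-chosen-⊇ j e b (get d j) (s j) f)))) ⟩
      ⟦ not (lookup U f) ⟧ * (a f * inAll f s′) ∎

  ⟦b⟧*lossTerms : ∀ (e : Fin n) b d s f →
    sum (λ j → ∏ᶜ (u f s) j * (⟦ b ⟧ * S.loss j (s j) e (get d j) f)) ≈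
    ⟦ b ⟧ * sum (λ j → ∏ᶜ (u f s) j * S.loss j (s j) e (get d j) f)
  ⟦b⟧*lossTerms e b d s f = trans
    (sum-cong-≋ (λ j → solve 3 (λ p b l → p :* (b :* l) := b :* (p :* l)) refl (∏ᶜ (u f s) j) ⟦ b ⟧
      (S.loss j (s j) e (get d j) f)))
    (sym (*-distribˡ-sum ⟦ b ⟧ (λ j → ∏ᶜ (u f s) j * S.loss j (s j) e (get d j) f)))

  value-step : ∀ {e f} b d s → f ≢ e → value f s ≤ value f (next e b d s) + ⟦ b ⟧ * lossAt e d s f
  value-step {e} {f} b d s f≢e = begin
    a f * (x f * ∏ (u f s))
      ≤⟨ *-monoˡ-≤ (0≤a f) (*-monoˡ-≤ (0≤x f) (∏-drop (0≤u f (next e b d s))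
           (λ j → S.ρ-step-≤ j e b (get d j) (s j) f≢e)
           (λ j → *-nonNegative 0≤⟦ b ⟧ (S.0≤loss j (s j) e (get d j) f))
           (λ j → S.ρ-step-≥ j e b (get d j) (s j) f≢e))) ⟩
    a f * (x f * (∏ (u f (next e b d s)) +
      sum (λ j → ∏ᶜ (u f s) j * (⟦ b ⟧ * S.loss j (s j) e (get d j) f))))
      ≈⟨ *-congˡ (*-congˡ (+-congˡ (⟦b⟧*lossTerms e b d s f))) ⟩
    a f * (x f * (∏ (u f (next e b d s)) + ⟦ b ⟧ *
      sum (λ j → ∏ᶜ (u f s) j * S.loss j (s j) e (get d j) f)))
      ≈⟨ solve 5 (λ a x p b l → a :* (x :* (p :+ b :* l))
           := a :* (x :* p) :+ b :* (a :* (x :* l))) refl _ _ _ _ _ ⟩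
    value f (next e b d s) + ⟦ b ⟧ * lossAt e d s f ∎

  pending-step : ∀ U {e} b d s → lookup U e ≡ true →
    pending U s ≤ pending (remove U e) (next e b d s) + (value e s + ⟦ b ⟧ * lossSum U e d s)
  pending-step U {e} b d s e∈U = begin
    sum (λ f → ⟦ lookup U f ⟧ * value f s)
      ≤⟨ sum-mono-≤ termwise ⟩
    sum (λ f → T₁ f + (T₂ f + T₃ f))
      ≈⟨ trans (∑-distrib-+ T₁ (λ f → T₂ f + T₃ f)) (+-congˡ (∑-distrib-+ T₂ T₃)) ⟩
    sum T₁ + (sum T₂ + sum T₃)
      ≈⟨ +-congˡ (+-cong (sum-δ e (value e s))
           (sym (*-distribˡ-sum ⟦ b ⟧ (λ f → ⟦ lookup U f ⟧ * lossAt e d s f)))) ⟩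
    pending (remove U e) s′ + (value e s + ⟦ b ⟧ * lossSum U e d s) ∎
    where
    s′ = next e b d s
    T₁ T₂ T₃ : Fin n → ℝ
    T₁ f = ⟦ lookup (remove U e) f ⟧ * value f s′
    T₂ f = ⟦ does (f Fin.≟ e) ⟧ * value e s
    T₃ f = ⟦ b ⟧ * (⟦ lookup U f ⟧ * lossAt e d s f)
    0≤T₃ : ∀ f → 0# ≤ T₃ f
    0≤T₃ f = *-nonNegative 0≤⟦ b ⟧ (*-nonNegative 0≤⟦ lookup U f ⟧ (0≤lossAt e d s f))
    termwise : ∀ f → ⟦ lookup U f ⟧ * value f s ≤
      ⟦ lookup (remove U e) f ⟧ * value f s′ +
        (⟦ does (f Fin.≟ e) ⟧ * value e s + ⟦ b ⟧ * (⟦ lookup U f ⟧ * lossAt e d s f))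
    termwise f with f Fin.≟ e | 0≤T₃ f
    -- `lossSum` also counts the processed element itself; its term is nonnegative and merely
    -- weakens the bound.
    ... | yes ≡.refl | 0≤ rewrite e∈U | Vec.lookup∘update e U false = begin
      1# * value e s                                    ≤⟨ x≤x+y 0≤ ⟩
      1# * value e s + ⟦ b ⟧ * (1# * lossAt e d s e)
        ≈⟨ trans (sym (+-identityˡ _)) (+-congʳ (sym (zeroˡ _))) ⟩
      0# * value e s′ + (1# * value e s + ⟦ b ⟧ * (1# * lossAt e d s e)) ∎
    ... | no f≢e | _ rewrite lookup-remove U f≢e = begin
      ⟦ lookup U f ⟧ * value f s
        ≤⟨ *-monoˡ-≤ 0≤⟦ lookup U f ⟧ (value-step b d s f≢e) ⟩
      ⟦ lookup U f ⟧ * (value f s′ + ⟦ b ⟧ * lossAt e d s f)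
        ≈⟨ solve 5 (λ w v b l y → w :* (v :+ b :* l)
             := w :* v :+ (:0 :* y :+ b :* (w :* l))) refl _ _ _ _ (value e s) ⟩
      ⟦ lookup U f ⟧ * value f s′ + (0# * value e s + ⟦ b ⟧ * (⟦ lookup U f ⟧ * lossAt e d s f)) ∎

  -- Being affine in the gain and the loss, 1 + drift has a computable
  -- expectation, unlike the relative growth of Φ that it bounds.
  drift : Subset n → Fin n → Bool → Tuple k Y → (∀ j → State j) → ℝ
  drift U e b d s = ½ * (κ * (value e s + ⟦ b ⟧ * lossSum U e d s) − ⟦ b ⟧ * gain e d s)

  value≤1 : ∀ f s → value f s ≤ 1#
  value≤1 f s = ≤-trans (*-≤ˡ (*-nonNegative (0≤x f) (0≤∏ (0≤u f s))) (a≤1 f))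
    (≤-trans (*-≤ˡ (0≤∏ (0≤u f s)) (S.x≤1 j₀ f)) (∏≤1 (0≤u f s) (u≤1 f s)))

  Φ-step : ∀ U {e} b d s → lookup U e ≡ true →
    Φ (remove U e) (next e b d s) ≤ Φ U s * (1# + drift U e b d s)
  Φ-step U {e} b d s e∈U = begin
    exp (- Ψ (remove U e) s′)
      ≤⟨ exp-mono Ψ-bound ⟩
    exp (- Ψ U s + (⅓ * v − g))
      ≈⟨ exp-+ (- Ψ U s) (⅓ * v − g) ⟩
    Φ U s * exp (⅓ * v − g)
      ≤⟨ *-monoˡ-≤ (0≤exp (- Ψ U s)) (exp-step 0≤g g≤1 0≤v v≤1) ⟩
    Φ U s * (1# + ½ * (v − g)) ∎
    where
    s′ = next e b d s
    g = ⟦ b ⟧ * gain e d s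
    L = value e s + ⟦ b ⟧ * lossSum U e d s
    v = κ * L
    0≤g : 0# ≤ g
    0≤g = *-nonNegative 0≤⟦ b ⟧ (0≤gain e d s)
    g≤1 : g ≤ 1#
    g≤1 = ≤-trans (*-≤ˡ (0≤gain e d s) ⟦ b ⟧≤1) (gain≤1 e d s)
    0≤v : 0# ≤ v
    0≤v = *-nonNegative 0≤κ (+-nonNegative (0≤value e s)
      (*-nonNegative 0≤⟦ b ⟧ (0≤lossSum U e d s)))
    v≤1 : v ≤ 1#
    v≤1 = begin
      κ * L
        ≤⟨ *-monoˡ-≤ 0≤κ (+-mono-≤ (value≤1 e s)
             (≤-trans (*-≤ˡ (0≤lossSum U e d s) ⟦ b ⟧≤1) (lossSum≤k U e d s))) ⟩
      κ * (1# + fromℕ k)  ≈⟨ *-congˡ K≈ ⟨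
      κ * K               ≈⟨ κK≈1 ⟩
      1#                  ∎
    Ψ-bound : - Ψ (remove U e) s′ ≤ - Ψ U s + (⅓ * v − g)
    Ψ-bound = begin
      - (gained (remove U e) s′ + ⅓ * (κ * pending (remove U e) s′))
        ≤⟨ -‿anti-≤ (+-mono-≤ (gained-step U b d s e∈U) (*-monoˡ-≤ 0≤⅓ (*-monoˡ-≤ 0≤κ remaining))) ⟩
      - ((gained U s + g) + ⅓ * (κ * (pending U s − L)))
        ≈⟨ solve 6 (λ G g t κ P L → :- ((G :+ g) :+ t :* (κ :* (P :- L)))
             := :- (G :+ t :* (κ :* P)) :+ (t :* (κ :* L) :- g)) refl _ g ⅓ κ _ L ⟩
      - Ψ U s + (⅓ * v − g) ∎
      where
      remaining : pending U s − L ≤ pending (remove U e) s′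
      remaining = ≤-trans (+-mono-≤ (pending-step U b d s e∈U) ≤-refl)
        (≤-reflexive (solve 2 (λ p l → (p :+ l) :- l := p) refl _ L))

  E-α : ∀ e y z → E (α e) (λ b → y + ⟦ b ⟧ * z) ≈ y + x e * z
  E-α e y z = trans (E-bernoulli (x e) (λ b → y + ⟦ b ⟧ * z))
    (solve 3 (λ x y z → x :* (y :+ :1 :* z) :+ (:1 :- x) :* (y :+ :0 :* z) := y :+ x :* z) refl
      (x e) y z)

  E-gain : ∀ e s → E (𝔻 e) (λ d → gain e d s) ≈ a e * ∏ (u e s)
  E-gain e s = trans (E-*ˡ (𝔻 e) (a e) _)
    (*-congˡ (joint-∏ (λ j → pick j e) (λ j d → ⟦ S.alive j e (current (s j)) d ⟧)))

  Eloss : ∀ (e : Fin n) (s : ∀ j → State j) j (f : Fin n) → ℝ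
  Eloss e s j f = E (pick j e) (λ d → S.loss j (s j) e d f)

  E-lossSum : ∀ U e s → E (𝔻 e) (λ d → lossSum U e d s) ≈
    sum (λ f → ⟦ lookup U f ⟧ * (a f * (x f * sum (λ j → ∏ᶜ (u f s) j * Eloss e s j f))))
  E-lossSum U e s = trans (E-sum (𝔻 e) (λ f d → ⟦ lookup U f ⟧ * lossAt e d s f))
    (sum-cong-≋ λ f → begin-equality
    E (𝔻 e) (λ d → ⟦ lookup U f ⟧ * lossAt e d s f)
      ≈⟨ trans (E-*ˡ (𝔻 e) ⟦ lookup U f ⟧ _)
           (*-congˡ (trans (E-*ˡ (𝔻 e) (a f) _) (*-congˡ (E-*ˡ (𝔻 e) (x f) _)))) ⟩
    ⟦ lookup U f ⟧ * (a f * (x f * E (𝔻 e)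
      (λ d → sum (λ j → ∏ᶜ (u f s) j * S.loss j (s j) e (get d j) f))))
      ≈⟨ *-congˡ (*-congˡ (*-congˡ (trans
           (E-sum (𝔻 e) (λ j d → ∏ᶜ (u f s) j * S.loss j (s j) e (get d j) f))
           (sum-cong-≋ λ j → trans (E-*ˡ (𝔻 e) (∏ᶜ (u f s) j) _)
             (*-congˡ (joint-marginal (λ j → S.pick-isProbability j e) j
               (λ d → S.loss j (s j) e d f))))))) ⟩
    ⟦ lookup U f ⟧ * (a f * (x f * sum (λ j → ∏ᶜ (u f s) j * Eloss e s j f))) ∎)

  -- `value e s` occurs twice: multiplied by `κ` it is the weight that stops pending because `e` is
  -- processed, and with a minus sign it is the expected gain, `x e` times the mean from `E-gain`.
  E-drift : ∀ U e s → E (α e) (λ b → E (𝔻 e) λ d → 1# + drift U e b d s) ≈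
    1# + ½ * (κ * (value e s + x e * E (𝔻 e) (λ d → lossSum U e d s)) − value e s)
  E-drift U e s = begin-equality
    E (α e) (λ b → E (𝔻 e) λ d → 1# + drift U e b d s)
      ≈⟨ E-cong (α e) (λ b → trans (E-cong (𝔻 e) λ d →
           solve 6 (λ h κ V b l g → :1 :+ h :* (κ :* (V :+ b :* l) :- b :* g)
             := (:1 :+ h :* (κ :* V)) :+ b :* (h :* (κ :* l :- g))) refl ½ κ (value e s) ⟦ b ⟧
               (lossSum U e d s) (gain e d s))
           (inner b)) ⟩
    E (α e) (λ b → y + ⟦ b ⟧ * z)
      ≈⟨ E-α e y z ⟩
    y + x e * z
      ≈⟨ solve 7 (λ h κ V x l a p → (:1 :+ h :* (κ :* V)) :+ x :* (h :* (κ :* l :- a :* p))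
           := :1 :+ h :* (κ :* (V :+ x :* l) :- a :* (x :* p))) refl ½ κ (value e s) (x e) EL (a e)
             (∏ (u e s)) ⟩
    1# + ½ * (κ * (value e s + x e * EL) − value e s) ∎
    where
    EL = E (𝔻 e) (λ d → lossSum U e d s)
    y = 1# + ½ * (κ * value e s)
    z = ½ * (κ * EL − a e * ∏ (u e s))
    inner : ∀ b → E (𝔻 e) (λ d → y + ⟦ b ⟧ * (½ * (κ * lossSum U e d s − gain e d s)))
      ≈ y + ⟦ b ⟧ * z
    inner b = begin-equality
      E (𝔻 e) (λ d → y + ⟦ b ⟧ * (½ * (κ * lossSum U e d s − gain e d s)))
        ≈⟨ E-+ (𝔻 e) (λ _ → y) _ ⟩
      E (𝔻 e) (λ _ → y) + E (𝔻 e) (λ d → ⟦ b ⟧ * (½ * (κ * lossSum U e d s − gain e d s)))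
        ≈⟨ +-cong (constant (𝔻-isProbability e) y)
             (trans (E-*ˡ (𝔻 e) ⟦ b ⟧ _) (*-congˡ (trans (E-*ˡ (𝔻 e) ½ _) (*-congˡ (trans
             (E-− (𝔻 e) (λ d → κ * lossSum U e d s) (λ d → gain e d s))
             (+-cong (E-*ˡ (𝔻 e) κ _) (-‿cong (E-gain e s)))))))) ⟩
      y + ⟦ b ⟧ * z ∎

  -- Once the sums are exchanged, `E-loss≤ρ` bounds the total loss of `f` in matroid `j` by
  -- `u f s j`, the very factor missing from `∏ᶜ (u f s) j`. So each matroid costs at most one copy
  -- of the pending weight.
  ∑-E-loss : ∀ U s → Inv s →
    sum (λ e → x e * E (𝔻 e) (λ d → lossSum U e d s)) ≤ fromℕ k * pending U s
  ∑-E-loss U s inv = begin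
    sum (λ e → x e * E (𝔻 e) (λ d → lossSum U e d s))
      ≈⟨ sum-cong-≋ (λ e → trans (*-congˡ (E-lossSum U e s)) (push e)) ⟩
    sum (λ e → sum (λ f → sum (λ j → B f j * (x e * Eloss e s j f))))
      ≈⟨ trans (∑-comm (λ e f → sum (λ j → B f j * (x e * Eloss e s j f))))
           (sum-cong-≋ (λ f → ∑-comm (λ e j → B f j * (x e * Eloss e s j f)))) ⟩
    sum (λ f → sum (λ j → sum (λ e → B f j * (x e * Eloss e s j f))))
      ≤⟨ sum-mono-≤ (λ f → sum-mono-≤
           (λ j → ≤-respˡ-≈ (*-distribˡ-sum (B f j) (λ e → x e * Eloss e s j f))
           (*-monoˡ-≤ (0≤B f j) (S.E-loss≤ρ j (s j) (inv j) f)))) ⟩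
    sum (λ f → sum (λ j → B f j * u f s j))
      ≈⟨ sum-cong-≋ (λ f → trans (sum-cong-≋ (λ j → B*u f j))
           (sum-const k (⟦ lookup U f ⟧ * value f s))) ⟩
    sum (λ f → fromℕ k * (⟦ lookup U f ⟧ * value f s))
      ≈⟨ *-distribˡ-sum (fromℕ k) (λ f → ⟦ lookup U f ⟧ * value f s) ⟨
    fromℕ k * pending U s ∎
    where
    B : Fin n → Fin k → ℝ
    B f j = ⟦ lookup U f ⟧ * (a f * (x f * ∏ᶜ (u f s) j))
    0≤B : ∀ f j → 0# ≤ B f j
    0≤B f j = *-nonNegative 0≤⟦ lookup U f ⟧
      (*-nonNegative (0≤a f) (*-nonNegative (0≤x f) (0≤∏ᶜ (0≤u f s) j)))
    B*u : ∀ f j → B f j * u f s j ≈ ⟦ lookup U f ⟧ * value f s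
    B*u f j = trans
      (solve 5 (λ w a x p u → (w :* (a :* (x :* p))) :* u := w :* (a :* (x :* (p :* u)))) refl
        ⟦ lookup U f ⟧ (a f) (x f) (∏ᶜ (u f s) j) (u f s j))
      (*-congˡ (*-congˡ (*-congˡ (∏ᶜ-* (u f s) j))))
    push : ∀ e → x e * sum (λ f → ⟦ lookup U f ⟧ *
      (a f * (x f * sum (λ j → ∏ᶜ (u f s) j * Eloss e s j f)))) ≈
      sum (λ f → sum (λ j → B f j * (x e * Eloss e s j f)))
    push e = trans (*-distribˡ-sum (x e)
      (λ f → ⟦ lookup U f ⟧ * (a f * (x f * sum (λ j → ∏ᶜ (u f s) j * Eloss e s j f)))))
      (sum-cong-≋ λ f → trans
        (solve 5 (λ y w a x t → y :* (w :* (a :* (x :* t))) := (y :* w :* a :* x) :* t) refl (x e)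
          ⟦ lookup U f ⟧ (a f) (x f) _)
        (trans (*-distribˡ-sum (x e * ⟦ lookup U f ⟧ * a f * x f)
          (λ j → ∏ᶜ (u f s) j * Eloss e s j f))
          (sum-cong-≋ λ j → solve 6 (λ y w a x p l →
            (y :* w :* a :* x) :* (p :* l) := (w :* (a :* (x :* p))) :* (y :* l)) refl
            (x e) ⟦ lookup U f ⟧ (a f) (x f) (∏ᶜ (u f s) j) (Eloss e s j f))))

  step-Φ : ∀ U {s} → Inv s →
    sum (λ e → ⟦ lookup U e ⟧ * E (α e) λ b → E (𝔻 e) λ d → Φ (remove U e) (next e b d s)) ≤
    sum (λ e → ⟦ lookup U e ⟧) * Φ U s
  step-Φ U {s} inv = begin
    sum (λ e → ⟦ lookup U e ⟧ * E (α e) λ b → E (𝔻 e) λ d → Φ (remove U e) (next e b d s))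
      ≤⟨ sum-mono-≤ (λ e → *-on-U-≤ U e λ e∈U → mono (α-isProbability e) λ b →
           mono (𝔻-isProbability e) λ d → Φ-step U b d s e∈U) ⟩
    sum (λ e → ⟦ lookup U e ⟧ * E (α e) λ b → E (𝔻 e) λ d → Φ U s * (1# + drift U e b d s))
      ≈⟨ sum-cong-≋ (λ e → *-congˡ (trans
           (E-cong (α e) λ b → E-*ˡ (𝔻 e) (Φ U s) (λ d → 1# + drift U e b d s))
           (trans (E-*ˡ (α e) (Φ U s) (λ b → E (𝔻 e) λ d → 1# + drift U e b d s))
             (*-congˡ (E-drift U e s))))) ⟩
    sum (λ e → ⟦ lookup U e ⟧ * (Φ U s * (1# + ½ * (κ * (value e s + x e * EL e) − value e s))))
      ≈⟨ sum-cong-≋ (λ e → solve 7 (λ w F h κ V x l →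
           w :* (F :* (:1 :+ h :* (κ :* (V :+ x :* l) :- V))) :=
           F :* (w :+ (h :* (κ :* (w :* V :+ w :* (x :* l)) :- w :* V)))) refl ⟦ lookup U e ⟧
             (Φ U s) ½ κ (value e s) (x e) (EL e)) ⟩
    sum (λ e → Φ U s * (⟦ lookup U e ⟧ + ½ * (κ * (wV e + ⟦ lookup U e ⟧ * (x e * EL e)) − wV e)))
      -- The expected losses are nonnegative, so their sum may be extended from `U` to all elements,
      -- the range for which `∑-E-loss` is stated.
      ≤⟨ sum-mono-≤ (λ e → *-monoˡ-≤ (0≤exp _)
           (+-monoʳ-≤ _ (*-monoˡ-≤ 0≤½ (+-mono-≤ (*-monoˡ-≤ 0≤κ (+-monoʳ-≤ (wV e)
           (*-≤ˡ (0≤xEL e) ⟦ lookup U e ⟧≤1))) ≤-refl)))) ⟩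
    sum (λ e → Φ U s * (⟦ lookup U e ⟧ + ½ * (κ * (wV e + x e * EL e) − wV e)))
      ≈⟨ *-distribˡ-sum (Φ U s) (λ e → ⟦ lookup U e ⟧ + ½ * (κ * (wV e + x e * EL e) − wV e)) ⟨
    Φ U s * sum (λ e → ⟦ lookup U e ⟧ + ½ * (κ * (wV e + x e * EL e) − wV e))
      ≈⟨ *-congˡ total-drift ⟩
    Φ U s * (sum (λ e → ⟦ lookup U e ⟧) + ½ *
      (κ * (pending U s + sum (λ e → x e * EL e)) − pending U s))
      ≤⟨ *-monoˡ-≤ (0≤exp _) (+-monoʳ-≤ _
           (*-monoˡ-≤ 0≤½ (+-mono-≤ (*-monoˡ-≤ 0≤κ
           (+-monoʳ-≤ (pending U s) (∑-E-loss U s inv))) ≤-refl))) ⟩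
    Φ U s * (sum (λ e → ⟦ lookup U e ⟧) + ½ *
      (κ * (pending U s + fromℕ k * pending U s) − pending U s))
      -- One copy of the pending weight leaves with the processed elements and at most `k` are lost
      -- to exchanges. Scaled by κ = 1/(k + 1) they balance the expected gain exactly.
      ≈⟨ *-congˡ (trans (+-congˡ (trans (*-congˡ balance) (zeroʳ ½))) (+-identityʳ _)) ⟩
    Φ U s * sum (λ e → ⟦ lookup U e ⟧)
      ≈⟨ *-comm _ _ ⟩
    sum (λ e → ⟦ lookup U e ⟧) * Φ U s ∎
    where
    EL : Fin n → ℝ
    EL e = E (𝔻 e) (λ d → lossSum U e d s)
    wV : Fin n → ℝ
    wV e = ⟦ lookup U e ⟧ * value e s
    0≤xEL : ∀ e → 0# ≤ x e * EL e
    0≤xEL e = *-nonNegative (0≤x e) (nonNegative (𝔻-isProbability e) (λ d → 0≤lossSum U e d s))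
    balance : κ * (pending U s + fromℕ k * pending U s) − pending U s ≈ 0#
    balance = begin-equality
      κ * (pending U s + fromℕ k * pending U s) − pending U s
        ≈⟨ +-congʳ (solve 3 (λ κ m p → κ :* (p :+ m :* p) := (κ :* (:1 :+ m)) :* p) refl κ
             (fromℕ k) (pending U s)) ⟩
      (κ * (1# + fromℕ k)) * pending U s − pending U s
        ≈⟨ +-congʳ (trans (*-congʳ (trans (*-congˡ (sym K≈)) κK≈1)) (*-identityˡ _)) ⟩
      pending U s − pending U s
        ≈⟨ -‿inverseʳ _ ⟩
      0# ∎
    total-drift : sum (λ e → ⟦ lookup U e ⟧ + ½ * (κ * (wV e + x e * EL e) − wV e)) ≈
      sum (λ e → ⟦ lookup U e ⟧) + ½ * (κ * (pending U s + sum (λ e → x e * EL e)) − pending U s)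
    total-drift = begin-equality
      sum (λ e → ⟦ lookup U e ⟧ + ½ * (κ * (wV e + x e * EL e) − wV e))
        ≈⟨ sum-cong-≋ (λ e → solve 5 (λ w h κ V l →
             w :+ h :* (κ :* (V :+ l) :- V) := w :+ (h :* (κ :- :1) :* V :+ h :* κ :* l)) refl
             ⟦ lookup U e ⟧ ½ κ (wV e) (x e * EL e)) ⟩
      sum (λ e → ⟦ lookup U e ⟧ + (½ * (κ − 1#) * wV e + ½ * κ * (x e * EL e)))
        ≈⟨ trans (∑-distrib-+ (λ e → ⟦ lookup U e ⟧)
             (λ e → ½ * (κ − 1#) * wV e + ½ * κ * (x e * EL e)))
             (+-congˡ (trans (∑-distrib-+ (λ e → ½ * (κ − 1#) * wV e) (λ e → ½ * κ * (x e * EL e)))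
               (+-cong (sym (*-distribˡ-sum (½ * (κ − 1#)) wV))
                 (sym (*-distribˡ-sum (½ * κ) (λ e → x e * EL e)))))) ⟩
      sum (λ e → ⟦ lookup U e ⟧) + (½ * (κ − 1#) * pending U s + ½ * κ * sum (λ e → x e * EL e))
        ≈⟨ +-congˡ (solve 4 (λ h κ V l →
             h :* (κ :- :1) :* V :+ h :* κ :* l := h :* (κ :* (V :+ l) :- V)) refl ½ κ
             (pending U s) (sum (λ e → x e * EL e))) ⟩
      sum (λ e → ⟦ lookup U e ⟧) + ½ * (κ * (pending U s + sum (λ e → x e * EL e)) − pending U s) ∎

-- From the potential to the tail bound

module Concentration {c ℓ₁ ℓ₂} (R : Reals c ℓ₁ ℓ₂)
  {n k : ℕ} (M : Fin k → Matroid n) {x : Fin n → Reals.ℝ R}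
  (C : ∀ j → Scheme.Choices {{R}} (M j) x) (j₀ : Fin k)
  (a : Fin n → Reals.ℝ R) (0≤a : ∀ e → Reals._≤_ R (Reals.0# R) (a e))
  (a≤1 : ∀ e → Reals._≤_ R (a e) (Reals.1# R))
  where
  open OrderedField R
  open ExponentialLaws R
  open Expectation R
  open RandomOrder R
  open Products R
  open Probability {{R}}
  open Exponential {{R}} using (exp)
  open Scheme {{R}} using (awScheme; weight)
  open Potential R M C j₀ a 0≤a a≤1
  open PartialOrderReasoning poset

  V : (∀ j → State j) → ℝ
  V s = exp (- sum (λ f → a f * inAll f s))

  V-cong : ∀ {s s′} → (∀ j → s j ≡ s′ j) → V s ≈ V s′
  V-cong s≡s′ = exp-cong (-‿cong (sum-cong-≋ λ f → *-congˡ (∏-cong λ j →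
    reflexive (≡.cong (λ t → ⟦ lookup (chosen t) f ⟧) (s≡s′ j)))))

  V≤Φ : ∀ U {s} → Inv s → (∀ e → lookup U e ≡ false) → V s ≤ Φ U s
  V≤Φ U {s} _ U≡∅ = ≤-reflexive (exp-cong (-‿cong (sym (begin-equality
    gained U s + ⅓ * (κ * pending U s)
      ≈⟨ +-cong (sum-cong-≋ λ f → trans (*-congʳ (reflexive (≡.cong (λ b → ⟦ not b ⟧) (U≡∅ f))))
           (*-identityˡ (a f * inAll f s)))
           (*-congˡ (*-congˡ (trans (sum-cong-≋ λ f →
             trans (*-congʳ (reflexive (≡.cong ⟦_⟧ (U≡∅ f)))) (zeroˡ (value f s)))
             (sum-replicate-zero n)))) ⟩
    sum (λ f → a f * inAll f s) + ⅓ * (κ * 0#)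
      ≈⟨ trans (+-congˡ (trans (*-congˡ (zeroʳ κ)) (zeroʳ ⅓))) (+-identityʳ _) ⟩
    sum (λ f → a f * inAll f s) ∎))))

  open Supermartingale S.step α pick α-isProbability S.pick-isProbability V V-cong
    Inv (λ inv e b d j → S.step-independent j e b (get d j) (inv j)) Φ V≤Φ step-Φ
  open Unrolling S.step α pick α-isProbability S.pick-isProbability V V-cong using (run)

  s₀ : ∀ j → State j
  s₀ j = Scheme.SingleMatroid.initial {{R}} (C j)

  s₀-independent : Inv s₀
  s₀-independent j = Scheme.ConvexCombination.I-indep {{R}}
    (Scheme.Choices.decomposition {{R}} (C j))

  Q : ℝ
  Q = sum (λ e → a e * x e)

  value-initial : ∀ f → value f s₀ ≈ a f * x f
  value-initial f with x f ≟ 0#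
  -- Without a controller the survival probabilities need not be 1, but then the factor `x f` makes
  -- both sides vanish.
  ... | yes x≈0 = *-congˡ (trans (*-congʳ x≈0) (trans (zeroˡ _) (sym x≈0)))
  ... | no  x≉0 = *-congˡ (trans (*-congˡ
    (trans (∏-cong (λ j → S.ρ-initial j (S.x≉0⇒0<x j x≉0))) (∏-1 {k}))) (*-identityʳ _))

  Φ-initial : Φ ⊤ s₀ ≈ exp (- (⅓ * (κ * Q)))
  Φ-initial = exp-cong (-‿cong (trans
    (+-cong
      (trans (sum-cong-≋ λ f → trans (*-congʳ
        (reflexive (≡.cong (λ b → ⟦ not b ⟧) (Vec.lookup-replicate f true))))
        (zeroˡ (a f * inAll f s₀)))
             (sum-replicate-zero n))
      (*-congˡ (*-congˡ (sum-cong-≋ λ f →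
        trans (*-congʳ (reflexive (≡.cong ⟦_⟧ (Vec.lookup-replicate f true))))
        (trans (*-identityˡ _) (value-initial f))))))
    (+-identityˡ _)))

  foldl∼run : ∀ j A ctl l {s t} → S._∼_ j s t →
    S._∼_ j (List.foldl (Scheme.SingleMatroid.process {{R}} (C j) A ctl) s l) (run j l A ctl t)
  foldl∼run j A ctl []      s∼t = s∼t
  foldl∼run j A ctl (e ∷ l) s∼t = foldl∼run j A ctl l (S.process∼step j A ctl e s∼t)

  final : ∀ j → Vec (Fin n) n → Subset n → Vec (Y j) n → Subset n
  final j σ A ctl = chosen (List.foldl (Scheme.SingleMatroid.process {{R}} (C j) A ctl) (s₀ j)
    (Vec.toList σ))

  final≡ : ∀ j σ A ctl → final j σ A ctl ≡ chosen (run j (Vec.toList σ) A ctl (s₀ j))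
  final≡ j σ A ctl = S._∼_.chosen≡
    (foldl∼run j A ctl (Vec.toList σ) (S.similar ≡.refl (λ _ → ≡.refl) ≡.refl))

  E-awScheme : ∀ g → E (awScheme C) g ≈
    (E (uniform (orderings n)) λ σ → E (independently α) λ A →
      E (joint (λ j → independently (pick j))) λ ctl →
      g (⋂ (Vec.toList (Vec.tabulate (λ j → final j σ A (get ctl j))))))
  E-awScheme g = trans (E->>= (uniform (orderings n)) _ g) (E-cong (uniform (orderings n)) λ σ →
    trans (E->>= (independently α) _ g) (E-cong (independently α) λ A →
    trans (E->>=-return (independently (λ j → Scheme.SingleMatroid.scheme {{R}} (C j) σ A))
      (λ Ss → ⋂ (Vec.toList Ss)) g)
          (E-independently-map (λ j → independently (pick j)) (λ j → final j σ A)
            (λ Ss → g (⋂ (Vec.toList Ss))))))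

  awScheme-isProbability : IsProbability (awScheme C)
  awScheme-isProbability = >>=-isProbability (orderings-isProbability n) λ σ →
    >>=-isProbability (independently-isProbability α-isProbability) λ A →
    >>=-isProbability (independently-isProbability (λ j →
      >>=-isProbability (independently-isProbability (S.pick-isProbability j)) λ ctl →
        return-isProbability _)) λ Ss →
    return-isProbability _

  ⟦lookup-⋂⟧ : ∀ {k} (T : Fin k → Subset n) f →
    ⟦ lookup (⋂ (Vec.toList (Vec.tabulate T))) f ⟧ ≈ ∏ (λ j → ⟦ lookup (T j) f ⟧)
  ⟦lookup-⋂⟧ {zero}  T f = reflexive (≡.cong ⟦_⟧ (Vec.lookup-replicate f true))
  ⟦lookup-⋂⟧ {suc k} T f = trans (reflexive (≡.cong ⟦_⟧ (Vec.lookup-zipWith _∧_ f (T Fin.zero) _)))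
    (trans (⟦∧⟧ _ _) (*-congˡ (⟦lookup-⋂⟧ (λ j → T (Fin.suc j)) f)))

  weight≈ : ∀ S → weight a S ≈ sum (λ f → a f * ⟦ lookup S f ⟧)
  weight≈ T = sum-cong-≋ λ f → trans (*-congʳ (S.indicator≈⟦lookup⟧ j₀ T f)) (*-comm _ _)

  E-exp-weight : E (awScheme C) (λ S → exp (- weight a S)) ≤ exp (- (⅓ * (κ * Q)))
  E-exp-weight = begin
    E (awScheme C) (λ S → exp (- weight a S))
      ≈⟨ E-awScheme _ ⟩
    (E (uniform (orderings n)) λ σ → E (independently α) λ A →
      E (joint (λ j → independently (pick j))) λ ctl →
      exp (- weight a (⋂ (Vec.toList (Vec.tabulate (λ j → final j σ A (get ctl j)))))))
      ≈⟨ E-cong (uniform (orderings n))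
           (λ σ → E-cong (independently α) λ A →
           E-cong (joint (λ j → independently (pick j))) λ ctl → toV σ A ctl) ⟩
    (E (uniform (orderings n)) λ σ → E (independently α) λ A →
      E (joint (λ j → independently (pick j))) λ ctl →
      V (λ j → run j (Vec.toList σ) A (get ctl j) (s₀ j)))
      ≤⟨ expectation-≤ s₀-independent ⟩
    Φ ⊤ s₀
      ≈⟨ Φ-initial ⟩
    exp (- (⅓ * (κ * Q))) ∎
    where
    toV : ∀ σ A ctl → exp (- weight a
      (⋂ (Vec.toList (Vec.tabulate (λ j → final j σ A (get ctl j)))))) ≈
      V (λ j → run j (Vec.toList σ) A (get ctl j) (s₀ j))
    toV σ A ctl = exp-cong (-‿cong (trans (weight≈ _) (sum-cong-≋ λ f → *-congˡ (trans
      (⟦lookup-⋂⟧ (λ j → final j σ A (get ctl j)) f)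
      (∏-cong λ j → reflexive (≡.cong (λ T → ⟦ lookup T f ⟧) (final≡ j σ A (get ctl j))))))))

  -- Markov's inequality for exp (B − a(S)).
  Pr-weight-≤ : ∀ B → Pr (awScheme C) (λ S → weight a S ≤? B) ≤ exp (B − ⅓ * (κ * Q))
  Pr-weight-≤ B = begin
    Pr (awScheme C) (λ S → weight a S ≤? B)
      ≈⟨ Pr≈E (awScheme C) (λ S → weight a S ≤? B) ⟩
    E (awScheme C) (λ S → ⟦ does (weight a S ≤? B) ⟧)
      ≤⟨ mono awScheme-isProbability pointwise ⟩
    E (awScheme C) (λ S → exp B * exp (- weight a S))
      ≈⟨ E-*ˡ (awScheme C) (exp B) _ ⟩
    exp B * E (awScheme C) (λ S → exp (- weight a S))
      ≤⟨ *-monoˡ-≤ (0≤exp B) E-exp-weight ⟩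
    exp B * exp (- (⅓ * (κ * Q)))
      ≈⟨ exp-+ B _ ⟨
    exp (B − ⅓ * (κ * Q)) ∎
    where
    pointwise : ∀ S → ⟦ does (weight a S ≤? B) ⟧ ≤ exp B * exp (- weight a S)
    pointwise T with weight a T ≤? B
    ... | yes w≤B = ≤-respʳ-≈ (exp-+ B _) (1≤exp (x≤y⇒0≤y−x w≤B))
    ... | no  _   = *-nonNegative (0≤exp B) (0≤exp _)

  0≤Q : 0# ≤ Q
  0≤Q = sum-nonNegative λ e → *-nonNegative (0≤a e) (0≤x e)

  1≤K : 1# ≤ K
  1≤K = ≤-respʳ-≈ (sym K≈) (x≤x+y (0≤fromℕ k))

  -- With q = Q/K, Markov's inequality leaves the exponent (⅕ - δ)q - ⅓q. Raising ⅕ to ⅓ cancels the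
  -- main terms and leaves -δq, and this is at most -δ²Q/(3K³) because δ ≤ 1 and K ≥ 1.
  concentration : ∀ δ → 0# < δ → δ < 1# ÷ fromℕ 5 →
    Pr (awScheme C) (λ S → weight a S ≤? (1# ÷ fromℕ 5 − δ) * (Q ÷ fromℕ (k ℕ.+ 1)))
      ≤ fromℕ 4 * exp (- (δ ^ 2 * Q ÷ (fromℕ 3 * fromℕ (k ℕ.+ 1) ^ 3)))
  concentration δ (0≤δ , _) (δ≤⅕ , _) = begin
    Pr (awScheme C) (λ S → weight a S ≤? (⅕ − δ) * q)
      ≤⟨ Pr-weight-≤ ((⅕ − δ) * q) ⟩
    exp ((⅕ − δ) * q − ⅓ * (κ * Q))
      ≤⟨ exp-mono exponent ⟩
    exp (- y)
      ≈⟨ *-identityˡ _ ⟨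
    1# * exp (- y)
      ≤⟨ *-monoʳ-≤ (0≤exp (- y)) (x≤x+y (0≤fromℕ 3)) ⟩
    fromℕ 4 * exp (- y) ∎
    where
    ⅕ = 1# ÷ fromℕ 5
    q = Q ÷ K
    D = fromℕ 3 * K ^ 3
    y = δ ^ 2 * Q ÷ D
    0≤q : 0# ≤ q
    0≤q = *-nonNegative 0≤Q 0≤κ
    ⅕≤⅓ : ⅕ ≤ ⅓
    ⅕≤⅓ = *-cancelʳ-≤ (0≤fromℕ 5) (fromℕ≉0 5) (begin
      ⅕ * fromℕ 5
        ≈⟨ trans (*-assoc _ _ _) (trans (*-identityˡ _)
             (trans (*-comm _ _) (⁻¹-inverse (fromℕ≉0 5)))) ⟩
      1#                                 ≤⟨ x≤x+y (+-nonNegative 0≤⅓ 0≤⅓) ⟩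
      1# + (⅓ + ⅓)                       ≈⟨ +-congʳ 6·⅙≈1 ⟨
      (⅙ + ⅙ + ⅙ + ⅙ + ⅙ + ⅙) + (⅓ + ⅓)
        ≈⟨ solve 1 (λ s → (s :+ s :+ s :+ s :+ s :+ s) :+ ((s :+ s) :+ (s :+ s)) :=
                                               (s :+ s) :* (:1 :+
                                                 (:1 :+ (:1 :+ (:1 :+ (:1 :+ :0)))))) refl ⅙ ⟩
      ⅓ * fromℕ 5                        ∎)
    ⅓≤1 : ⅓ ≤ 1#
    ⅓≤1 = ≤-from-difference (+-nonNegative 0≤⅓ 0≤⅓) (trans (sym 6·⅙≈1)
      (solve 1 (λ s → s :+ s :+ s :+ s :+ s :+ s := (s :+ s) :+ ((s :+ s) :+ (s :+ s))) refl ⅙))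
    δ≤1 : δ ≤ 1#
    δ≤1 = ≤-trans δ≤⅕ (≤-trans ⅕≤⅓ ⅓≤1)
    1≤K² : 1# ≤ K * K
    1≤K² = ≤-respˡ-≈ (*-identityˡ 1#) (*-mono-≤ 0≤1 0≤1 1≤K 1≤K)
    1≤3 : 1# ≤ fromℕ 3
    1≤3 = x≤x+y (0≤fromℕ 2)
    K≤D : K ≤ D
    K≤D = begin
      K                          ≈⟨ solve 1 (λ K → K := :1 :* (K :* :1)) refl K ⟩
      1# * (K * 1#)
        ≤⟨ *-mono-≤ 0≤1 (*-nonNegative (proj₁ 0<K) 0≤1) 1≤3 (*-monoˡ-≤ (proj₁ 0<K) 1≤K²) ⟩
      fromℕ 3 * (K * (K * K))    ≈⟨ *-congˡ (*-congˡ (*-congˡ (sym (*-identityʳ K)))) ⟩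
      D                          ∎
    0<D : 0# < D
    0<D = ≤-trans (proj₁ 0<K) K≤D , λ 0≈D →
      proj₂ 0<K (antisym (proj₁ 0<K) (≤-respʳ-≈ (sym 0≈D) K≤D))
    D⁻¹≤κ : D ⁻¹ ≤ κ
    D⁻¹≤κ = begin
      D ⁻¹               ≈⟨ trans (*-congʳ κK≈1) (*-identityˡ _) ⟨
      (κ * K) * D ⁻¹     ≤⟨ *-monoʳ-≤ (proj₁ (⁻¹-positive 0<D)) (*-monoˡ-≤ 0≤κ K≤D) ⟩
      (κ * D) * D ⁻¹
        ≈⟨ trans (*-assoc _ _ _) (trans (*-congˡ (⁻¹-inverse (<⇒≉0 0<D))) (*-identityʳ _)) ⟩
      κ                  ∎
    δ²≤δ : δ ^ 2 ≤ δ
    δ²≤δ = begin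
      δ * (δ * 1#)   ≤⟨ *-monoˡ-≤ 0≤δ (*-monoʳ-≤ 0≤1 δ≤1) ⟩
      δ * (1# * 1#)  ≈⟨ trans (*-congˡ (*-identityˡ 1#)) (*-identityʳ δ) ⟩
      δ              ∎
    0≤δ² : 0# ≤ δ ^ 2
    0≤δ² = *-nonNegative 0≤δ (*-nonNegative 0≤δ 0≤1)
    y≤δq : y ≤ δ * q
    y≤δq = begin
      δ ^ 2 * Q * D ⁻¹
        ≤⟨ *-mono-≤ (*-nonNegative 0≤δ² 0≤Q) (proj₁ (⁻¹-positive 0<D)) (*-monoʳ-≤ 0≤Q δ²≤δ) D⁻¹≤κ ⟩
      δ * Q * κ          ≈⟨ *-assoc _ _ _ ⟩
      δ * q              ∎
    exponent : (⅕ − δ) * q − ⅓ * (κ * Q) ≤ - y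
    exponent = begin
      (⅕ − δ) * q − ⅓ * (κ * Q)     ≤⟨ +-mono-≤ (*-monoʳ-≤ 0≤q (+-mono-≤ ⅕≤⅓ ≤-refl)) ≤-refl ⟩
      (⅓ − δ) * q − ⅓ * (κ * Q)
        ≈⟨ solve 4 (λ t δ Q κ → (t :- δ) :* (Q :* κ) :- t :* (κ :* Q)
             := :- (δ :* (Q :* κ))) refl ⅓ δ Q κ ⟩
      - (δ * q)                     ≤⟨ -‿anti-≤ y≤δq ⟩
      - y                           ∎

open import Defs using (ℝ; 0#; 1#; _≤_; _≤?_; _<_; _*_; -_; _−_; _÷_; _^_; sum; fromℕ;
  exp; Pr; _∈Polytope_; Choices; awScheme; weight)

theorem3 : ∀ {c ℓ₁ ℓ₂} {{R : Reals c ℓ₁ ℓ₂}}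
    (n k : ℕ) → 1 ℕ.≤ k →
    (M : Fin k → Matroid n) (x : Fin n → ℝ) → (∀ j → x ∈Polytope M j) →
    (C : ∀ j → Choices (M j) x) →
    (a : Fin n → ℝ) → (∀ e → 0# ≤ a e × a e ≤ 1#) →
    (δ : ℝ) → 0# < δ → δ < 1# ÷ fromℕ 5 →
    let Q = sum (λ e → a e * x e) in
    Pr (awScheme C) (λ S → weight a S ≤? (1# ÷ fromℕ 5 − δ) * (Q ÷ fromℕ (k ℕ.+ 1)))
    ≤ fromℕ 4 * exp (- (δ ^ 2 * Q ÷ (fromℕ 3 * fromℕ (k ℕ.+ 1) ^ 3)))
theorem3 {{R}} n (suc k) _ M x _ C a a-bounds δ 0<δ δ<⅕ =
  Concentration.concentration R M C Fin.zero a (λ e → proj₁ (a-bounds e))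
    (λ e → proj₂ (a-bounds e)) δ 0<δ δ<⅕
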